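{- Let $p$ be a prime, $p>3$, and let $a,b\in\mathbb{Z}$ with $ab\not\equiv 0\pmod p$ and $a\not\equiv b\pmod p$. Then modulo $p$: \[ \sum_{k=0}^{p-1}C_{2k}\,\frac{(a-b)^{2k}}{(-64ab)^k}\equiv \begin{cases} \frac{(ab)^{\frac{p-1}{4}}}{2(a-b)}\left((3a+b)\left(\frac{b}{p}\right)-(3b+a)\left(\frac{a}{p}\right)\right), & p\equiv 1\pmod 4,\\[4pt] \frac{(ab)^{\frac{p+1}{4}}}{2(b-a)}\left(\frac{3a+b}{a}\left(\frac{b}{p}\right)-\frac{3b+a}{b}\left(\frac{a}{p}\right)\right), & p\equiv 3\pmod 4, \end{cases} \] \[ \sum_{k=0}^{p-1}\binom{4k}{2k}\frac{(a+b)^{2k}}{(64ab)^k}\equiv \begin{cases} \frac{\left(\frac{2}{p}\right)(ab)^{\frac{p-1}{4}}}{4(a-b)}\left((3a-b)\left(\frac{b}{p}\right)-(3b-a)\left(\frac{a}{p}\right)\right), & p\equiv 1\pmod 4,\\[4pt] \frac{\left(\frac{2}{p}\right)(ab)^{\frac{p+1}{4}}}{4(b-a)}\left(\frac{3a-b}{a}\left(\frac{b}{p}\right)-\frac{3b-a}{b}\left(\frac{a}{p}\right)\right), & p\equiv 3\pmod 4. \end{cases} \]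
   Context: $C_n=\frac{1}{n+1}\binom{2n}{n}$ are the Catalan numbers; $\left(\frac{\cdot}{p}\right)$ is the Legendre symbol. Congruences between rationals with denominators prime to $p$ are in the usual sense. -}

module Defs where

open import Data.Bool using (Bool; true; false; if_then_else_)
open import Data.Nat as ℕ using (ℕ; zero; suc; _≡ᵇ_)
open import Data.Nat.Combinatorics using (_C_)
open import Data.Nat.Divisibility as ℕD using ()
open import Data.Integer as ℤ using (ℤ; +_; _%ℕ_; ∣_∣)
open import Data.Rational as ℚ using (ℚ; 0ℚ; ↥_; _÷_; ≢-nonZero)
open import Data.Rational.Properties using (_≟_)
open import Data.List using (List; upTo; map; foldr)
open import Data.Bool.ListAction using (any)
open import Relation.Nullary using (yes; no)

⟦_⟧ : ℤ → ℚ
⟦ z ⟧ = z ℚ./ 1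

-- total division of rationals (x ÷₀ 0 = 0); only ever applied to
-- nonzero denominators in the statement, under its hypotheses
infixl 7 _÷₀_
_÷₀_ : ℚ → ℚ → ℚ
x ÷₀ y with y ≟ 0ℚ
... | yes _ = 0ℚ
... | no y≢0 = _÷_ x y {{≢-nonZero y≢0}}

-- Catalan numbers C_n = binom(2n,n)/(n+1) (exact division in ℕ)
catalan : ℕ → ℕ
catalan n = ((2 ℕ.* n) C n) ℕ./ suc n

Σ< : ℕ → (ℕ → ℚ) → ℚ
Σ< n f = foldr ℚ._+_ 0ℚ (map f (upTo n))

legendre : ℤ → ℕ → ℤ
legendre a zero = + 0
legendre a p@(suc n) with a %ℕ p
... | zero = + 0
... | r@(suc _) =
  if any (λ x → ((x ℕ.* x) ℕ.% p) ≡ᵇ r) (upTo p) then + 1 else ℤ.- (+ 1)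

-- congruence of rationals modulo p: p divides the numerator of x - y
-- (for x, y with denominators prime to p this is the usual notion)
infix 4 _≡_[modℚ_]
_≡_[modℚ_] : ℚ → ℚ → ℕ → Set
x ≡ y [modℚ p ] = p ℕD.∣ ∣ ↥ (x ℚ.- y) ∣

{-# OPTIONS --safe #-}

-- Write B(n) for the central binomial coefficient, p = 2m + 1, and let v lie in a commutative
-- ring of characteristic p. Modulo p one has B(n) ≡ (-4)^n C(m,n) and B(p+n) ≡ 2 B(n) for n < p,
-- so Σ_{n<2p} B(n) v^n = G(v) with G(v) = (1 - 4v)^m (1 + 2v^p). The second sum of the theorem is
-- the even part of G; as 2 C_n = 4 B(n) - B(n+1), the first one is a combination of the even and
-- the odd part, namely 4v Σ C_{2k} v^{2k} = (1 + 4v) G(-v) - (1 - 4v) G(v).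
--
-- With c = b (second sum) or c = -b (first sum), e = c/a, h² = e and v = (1 + e)/(8h), the squared
-- argument v² is the one of the theorem, and 1 ∓ 4v = ∓(1 ∓ h)²/(2h). Hence the powers in G(±v) are
-- evaluated by the Frobenius identity (1 ∓ h)^p = 1 ∓ h e^m in (ℤ/p)[h]. Euler's criterion turns the
-- m-th powers into Legendre symbols, and the first sum also needs the value of the symbol of 2.

module Submission where

open import Defs
open import Algebra.Bundles using (CommutativeRing)
import Algebra.Solver.Ring as RingSolver
open import Algebra.Solver.Ring.AlmostCommutativeRing using (_-Raw-AlmostCommutative⟶_; fromCommutativeRing)
open import Algebra.Structures using (IsCommutativeRing)
open import Data.Bool using (true; false; T)
open import Data.Bool.ListAction using (any)
open import Data.Empty using (⊥)
open import Data.Integer as ℤ using (ℤ; +_; -[1+_]; 0ℤ; 1ℤ; ∣_∣)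
open import Data.Integer.DivMod using (a≡a%ℕn+[a/ℕn]*n; n%ℕd<d)
import Data.Integer.Divisibility.Signed as ℤ∣
import Data.Integer.Properties as ℤₚ
open import Data.Integer.Tactic.RingSolver using (solve-∀)
open import Data.List using (List; []; _∷_; length; applyUpTo; upTo; foldr; map)
open import Data.List.Membership.Propositional using (lose)
open import Data.List.Membership.Propositional.Properties using (∈-upTo⁺)
open import Data.List.Properties using (length-applyUpTo)
open import Data.List.Relation.Unary.All as All using (All; []; _∷_)
import Data.List.Relation.Unary.All.Properties as All
open import Data.List.Relation.Unary.AllPairs using (AllPairs; []; _∷_)
import Data.List.Relation.Unary.AllPairs.Properties as AllPairs
open import Data.List.Relation.Unary.Any using (satisfied)
open import Data.List.Relation.Unary.Any.Properties using (any⁺; any⁻)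
import Data.Maybe as Maybe
open import Data.Nat as ℕ using (ℕ; zero; suc; _<_; _≤_; z≤n; s≤s; z<s; s<s)
open import Data.Nat.Combinatorics using (_C_; nCk≡nC[n∸k]; nCk+nC[k+1]≡[n+1]C[k+1]; k>n⇒nCk≡0; nCn≡1; nC1≡n)
open import Data.Nat.DivMod using (m≡m%n+[m/n]*n; m%n<n; m*n/n≡m; m/n*n≡m)
open import Data.Nat.Divisibility as ℕ∣ using (_∣_)
open import Data.Nat.Primality using (Prime; euclidsLemma; prime⇒nonTrivial; prime⇒nonZero; ¬prime[0]; ¬prime[1])
import Data.Nat.Properties as ℕₚ
import Data.Nat.Tactic.RingSolver as ℕ-Solver
open import Data.Product using (_×_; _,_; proj₁; proj₂; ∃)
open import Data.Rational as ℚ using (ℚ; 0ℚ; ↥_; ↧_; toℚᵘ)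
import Data.Rational.Properties as ℚₚ
open import Data.Rational.Unnormalised as ℚᵘ using (mkℚᵘ; *≡*)
import Data.Rational.Unnormalised.Properties as ℚᵘₚ
open import Data.Sum using (_⊎_; inj₁; inj₂; [_,_]′)
open import Function using (_∘_; id)
open import Level using (0ℓ)
open import Relation.Binary.Definitions using (tri<; tri≈; tri>)
open import Relation.Binary.PropositionalEquality as ≡ using (_≡_; cong; cong₂; subst)
open import Relation.Nullary using (¬_; yes; no; contradiction)
open import Relation.Nullary.Decidable using (dec⇒maybe)

-- The root h of e need not lie in ℤ/p, and adjoining it formally gives a ring with zero divisors
-- when e is already a square. No case distinction is made: the identities over `R[√d]` are free of
-- division, the denominators (2h)^m, 4h and 1 - h² or 1 + h² stay as factors, and only elements
-- with a named inverse are cancelled. The final identities contain h only through h² = e, so they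
-- compare images of integers and descend to congruences modulo p, whether or not e is a square.
--
-- The factor left on the unknown sum shows where a ≢ b enters. For the second sum it is 1 - e with
-- e = b/a, for the first it is 1 + e with e = -b/a; both equal (a - b)/a.
--
-- The symbol of 2 comes from (2h)^m. In the first sum the power of e = -b/a also brings a power of
-- -1, which cancels that symbol by the second supplementary law; hence the first formula shows
-- none.
--
-- Rationals are met only at the end: each side of a congruence is given a residue, and equal
-- residues give the congruence.

-- Binomial coefficients, central binomial coefficients and Catalan numbers.

module Binomial where

  open import Data.Nat using (_+_; _*_)
  open ℕₚ
  open ℕ∣ using (m∣m*n; ∣m+n∣m⇒∣n)
  open ≡ using (refl; sym; trans; module ≡-Reasoning)

  absorption : ∀ n k → suc k * (suc n C suc k) ≡ suc n * (n C k)
  absorption zero    zero    = refl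
  absorption zero    (suc k) = trans (cong (suc (suc k) *_) (k>n⇒nCk≡0 {1} {2 + k} (s≤s (s≤s z≤n)))) (*-zeroʳ (2 + k))
  absorption (suc n) zero    = trans (*-identityˡ _) (trans (nC1≡n (2 + n)) (sym (*-identityʳ (2 + n))))
  absorption (suc n) (suc k) = begin
    suc (suc k) * (suc (suc n) C suc (suc k))
      ≡⟨ cong (suc (suc k) *_) (nCk+nC[k+1]≡[n+1]C[k+1] (suc n) (suc k)) ⟨
    suc (suc k) * (X + Y)                   ≡⟨ expand k X Y ⟩
    X + (suc k * X + suc (suc k) * Y)       ≡⟨ cong (_+_ X) (cong₂ _+_ (absorption n k) (absorption n (suc k))) ⟩
    X + (suc n * (n C k) + suc n * (n C suc k)) ≡⟨ cong (_+_ X) (*-distribˡ-+ (suc n) (n C k) (n C suc k)) ⟨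
    X + suc n * (n C k + n C suc k)         ≡⟨ cong (λ z → X + suc n * z) (nCk+nC[k+1]≡[n+1]C[k+1] n k) ⟩
    suc (suc n) * X                         ∎
    where
    open ≡-Reasoning
    X = suc n C suc k
    Y = suc n C suc (suc k)
    expand : ∀ k x y → suc (suc k) * (x + y) ≡ x + (suc k * x + suc (suc k) * y)
    expand = ℕ-Solver.solve-∀

  -- This is C(n,k+1) = C(n,k) (n-k)/(k+1), with the division cleared and the subtraction moved to
  -- the other side so that everything stays in ℕ.
  next-column : ∀ n k → suc k * (n C suc k) + suc k * (n C k) ≡ suc n * (n C k)
  next-column n k = begin
    suc k * (n C suc k) + suc k * (n C k) ≡⟨ +-comm (suc k * (n C suc k)) _ ⟩
    suc k * (n C k) + suc k * (n C suc k) ≡⟨ *-distribˡ-+ (suc k) (n C k) (n C suc k) ⟨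
    suc k * (n C k + n C suc k)           ≡⟨ cong (suc k *_) (nCk+nC[k+1]≡[n+1]C[k+1] n k) ⟩
    suc k * (suc n C suc k)               ≡⟨ absorption n k ⟩
    suc n * (n C k)                       ∎
    where open ≡-Reasoning

  C-symm : ∀ k d → (k + d) C k ≡ (k + d) C d
  C-symm k d = trans (nCk≡nC[n∸k] (m≤m+n k d)) (cong ((k + d) C_) (m+n∸m≡n k d))

  -- Absorption read through the symmetry of row k + d. Writing the row as k + d avoids the
  -- truncated difference n - k.
  next-row : ∀ k d → suc d * (suc (k + d) C k) ≡ suc (k + d) * ((k + d) C k)
  next-row k d = begin
    suc d * (suc (k + d) C k)       ≡⟨ cong (λ n → suc d * (n C k)) (+-suc k d) ⟨
    suc d * ((k + suc d) C k)       ≡⟨ cong (suc d *_) (C-symm k (suc d)) ⟩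
    suc d * ((k + suc d) C suc d)   ≡⟨ cong (λ n → suc d * (n C suc d)) (+-suc k d) ⟩
    suc d * (suc (k + d) C suc d)   ≡⟨ absorption (k + d) d ⟩
    suc (k + d) * ((k + d) C d)     ≡⟨ cong (suc (k + d) *_) (C-symm k d) ⟨
    suc (k + d) * ((k + d) C k)     ∎
    where open ≡-Reasoning

  central : ℕ → ℕ
  central n = (2 * n) C n

  2*suc : ∀ n → 2 * suc n ≡ suc (suc (2 * n))
  2*suc = ℕ-Solver.solve-∀

  [1+2n]C[1+n]≡[1+2n]Cn : ∀ n → suc (2 * n) C suc n ≡ suc (2 * n) C n
  [1+2n]C[1+n]≡[1+2n]Cn n = subst (λ k → k C suc n ≡ k C n) (eq n) (C-symm (suc n) n)
    where
    eq : ∀ n → suc n + n ≡ suc (2 * n)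
    eq = ℕ-Solver.solve-∀

  central-suc≡double : ∀ n → central (suc n) ≡ 2 * (suc (2 * n) C suc n)
  central-suc≡double n = begin
    (2 * suc n) C suc n             ≡⟨ cong (_C suc n) (2*suc n) ⟩
    suc (suc (2 * n)) C suc n       ≡⟨ nCk+nC[k+1]≡[n+1]C[k+1] (suc (2 * n)) n ⟨
    suc (2 * n) C n + Y             ≡⟨ cong (_+ Y) ([1+2n]C[1+n]≡[1+2n]Cn n) ⟨
    Y + Y                           ≡⟨ cong (_+_ Y) (+-identityʳ Y) ⟨
    2 * Y                           ∎
    where
    open ≡-Reasoning
    Y = suc (2 * n) C suc n

  -- The ratio B(n+1)/B(n) = 2(2n+1)/(n+1). The inductions modulo p below all advance by it.
  central-suc : ∀ n → suc n * central (suc n) ≡ 2 * suc (2 * n) * central n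
  central-suc n = begin
    suc n * central (suc n)               ≡⟨ cong (suc n *_) (central-suc≡double n) ⟩
    suc n * (2 * (suc (2 * n) C suc n))   ≡⟨ swap (suc n) (suc (2 * n) C suc n) ⟩
    2 * (suc n * (suc (2 * n) C suc n))   ≡⟨ cong (2 *_) (absorption (2 * n) n) ⟩
    2 * (suc (2 * n) * central n)         ≡⟨ *-assoc 2 (suc (2 * n)) (central n) ⟨
    2 * suc (2 * n) * central n           ∎
    where
    open ≡-Reasoning
    swap : ∀ x y → x * (2 * y) ≡ 2 * (x * y)
    swap = ℕ-Solver.solve-∀

  -- From (n+1) C(2n,n+1) = n B(n) one gets B(n) = (n+1) (B(n) - C(2n,n+1)). This makes the
  -- truncated division in `catalan` exact.
  suc∣central : ∀ n → suc n ∣ central n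
  suc∣central n = ∣m+n∣m⇒∣n (subst (suc n ∣_) (sym eq) (m∣m*n _)) (m∣m*n ((2 * n) C suc n))
    where
    open ≡-Reasoning
    expand : ∀ n b → suc (2 * n) * b ≡ n * b + suc n * b
    expand = ℕ-Solver.solve-∀
    above : suc n * ((2 * n) C suc n) ≡ n * central n
    above = +-cancelʳ-≡ (suc n * central n) _ _
      (trans (next-column (2 * n) n) (expand n (central n)))
    eq : suc n * ((2 * n) C suc n) + central n ≡ suc n * central n
    eq = trans (cong (_+ central n) above) (+-comm (n * central n) (central n))

  -- After multiplication by n + 1 both summands become multiples of B(n), and the claim is 2 + (4n
  -- + 2) = 4(n + 1).
  catalan-central : ∀ n → 2 * catalan n + central (suc n) ≡ 4 * central n
  catalan-central n = *-cancelˡ-≡ _ _ (suc n) (begin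
    suc n * (2 * catalan n + central (suc n))             ≡⟨ expand (suc n) (catalan n) (central (suc n)) ⟩
    2 * (catalan n * suc n) + suc n * central (suc n)     ≡⟨ cong₂ (λ x y → 2 * x + y) (m/n*n≡m (suc∣central n)) (central-suc n) ⟩
    2 * central n + 2 * suc (2 * n) * central n           ≡⟨ collect n (central n) ⟩
    suc n * (4 * central n)                               ∎)
    where
    open ≡-Reasoning
    expand : ∀ n c b → n * (2 * c + b) ≡ 2 * (c * n) + n * b
    expand = ℕ-Solver.solve-∀
    collect : ∀ n b → 2 * b + 2 * suc (2 * n) * b ≡ suc n * (4 * b)
    collect = ℕ-Solver.solve-∀

open Binomial

-- Rings receiving the integers: sums, the binomial theorem and Frobenius.

∑ℤ : ℕ → (ℕ → ℤ) → ℤ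
∑ℤ zero    f = 0ℤ
∑ℤ (suc n) f = ∑ℤ n f ℤ.+ f n

-- By absorption (k+1) C(p,k+1) is a multiple of p, and p does not divide k + 1.
prime∣binomial : ∀ {p} → Prime p → ∀ {k} → suc k < p → p ∣ p C suc k
prime∣binomial {suc q} pp {k} k<p with euclidsLemma (suc k) (suc q C suc k) pp
    (subst (suc q ∣_) (≡.sym (absorption q k)) (ℕ∣.m∣m*n (q C k)))
... | inj₁ p∣k = contradiction p∣k (ℕ∣.>⇒∤ k<p)
... | inj₂ p∣C = p∣C

-- One toolkit for ℤ/p, its quadratic extension and ℚ. The map φ makes integers the coefficients of
-- the ring solver, so numerals can be normalised in each of these rings.
module IntegerAlgebra {r ℓ} (R : CommutativeRing r ℓ)
    (φ : ℤ.+-*-rawRing -Raw-AlmostCommutative⟶ fromCommutativeRing R) where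

  open CommutativeRing R public
  open _-Raw-AlmostCommutative⟶_ φ public renaming (⟦_⟧ to ι)
  open import Algebra.Properties.CommutativeSemiring.Exp commutativeSemiring public
  open import Relation.Binary.Reasoning.Setoid setoid public

  open RingSolver ℤ.+-*-rawRing (fromCommutativeRing R) φ
    (λ i j → Maybe.map (reflexive ∘ cong ι) (dec⇒maybe (i ℤₚ.≟ j))) public
    using (solve; _:=_; _:+_; _:*_; _:-_; :-_; _:^_; con)

  ι-^ : ∀ i n → ι (i ℤ.^ n) ≈ ι i ^ n
  ι-^ i zero    = 1-homo
  ι-^ i (suc n) = trans (*-homo i (i ℤ.^ n)) (*-congˡ (ι-^ i n))

  -- The solver proves identities but takes no hypotheses. An identity that holds only modulo u = v
  -- is therefore supplied together with the cofactor q of u - v.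
  ≈-by : ∀ {x y u v} q → x ≈ y + q * (u - v) → u ≈ v → x ≈ y
  ≈-by {x} {y} {u} {v} q eq u≈v = begin
    x               ≈⟨ eq ⟩
    y + q * (u - v) ≈⟨ +-congˡ (*-congˡ (+-congʳ u≈v)) ⟩
    y + q * (v - v) ≈⟨ solve 3 (λ y q v → y :+ q :* (v :- v) := y) refl y q v ⟩
    y               ∎

  x≈y⇒x-y≈0 : ∀ {x y} → x ≈ y → x - y ≈ 0#
  x≈y⇒x-y≈0 {x} {y} x≈y = trans (+-congʳ x≈y) (-‿inverseʳ y)

  x-y≈0⇒x≈y : ∀ {x y} → x - y ≈ 0# → x ≈ y
  x-y≈0⇒x≈y {x} {y} d≈0 = trans (solve 2 (λ x y → x := (x :- y) :+ y) refl x y)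
    (trans (+-congʳ d≈0) (+-identityˡ y))

  *-distribˡ-- : ∀ u x y → u * (x - y) ≈ u * x - u * y
  *-distribˡ-- = solve 3 (λ u x y → u :* (x :- y) := u :* x :- u :* y) refl

  -- Cancellation by an explicit inverse, valid also in a ring with zero divisors such as the
  -- quadratic extension.
  *-cancel-unit : ∀ {x y} u u′ → u * u′ ≈ 1# → x * u ≈ y * u → x ≈ y
  *-cancel-unit {x} {y} u u′ uu′ eq = begin
    x            ≈⟨ *-identityʳ x ⟨
    x * 1#       ≈⟨ *-congˡ uu′ ⟨
    x * (u * u′) ≈⟨ *-assoc x u u′ ⟨
    x * u * u′   ≈⟨ *-congʳ eq ⟩
    y * u * u′   ≈⟨ *-assoc y u u′ ⟩
    y * (u * u′) ≈⟨ *-congˡ uu′ ⟩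
    y * 1#       ≈⟨ *-identityʳ y ⟩
    y            ∎

  +-cancelˡ : ∀ z {x y} → z + x ≈ z + y → x ≈ y
  +-cancelˡ z {x} {y} eq = ≈-by (ι 1ℤ)
    (solve 3 (λ x y z → x := y :+ con 1ℤ :* (z :+ x :- (z :+ y))) refl x y z) eq

  1^ : ∀ n → 1# ^ n ≈ 1#
  1^ zero    = refl
  1^ (suc n) = trans (*-identityˡ _) (1^ n)

  square-^ : ∀ x k → x ^ (2 ℕ.* k) ≈ (x * x) ^ k
  square-^ x k = trans (sym (^-assocʳ x 2 k)) (^-congˡ k (*-congˡ (*-identityʳ x)))

  ^-unit : ∀ {u u′} n → u * u′ ≈ 1# → u ^ n * u′ ^ n ≈ 1#
  ^-unit {u} {u′} n uu′ = begin
    u ^ n * u′ ^ n ≈⟨ ^-distrib-* u u′ n ⟨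
    (u * u′) ^ n   ≈⟨ ^-congˡ n uu′ ⟩
    1# ^ n         ≈⟨ 1^ n ⟩
    1#             ∎

  ∑ : ℕ → (ℕ → Carrier) → Carrier
  ∑ zero    f = 0#
  ∑ (suc n) f = ∑ n f + f n

  ∑-cong : ∀ n {f g} → (∀ {k} → k < n → f k ≈ g k) → ∑ n f ≈ ∑ n g
  ∑-cong zero    eq = refl
  ∑-cong (suc n) eq = +-cong (∑-cong n (eq ∘ ℕₚ.m<n⇒m<1+n)) (eq (ℕₚ.n<1+n n))

  ∑-+ : ∀ n f g → ∑ n (λ k → f k + g k) ≈ ∑ n f + ∑ n g
  ∑-+ zero    f g = sym (+-identityˡ 0#)
  ∑-+ (suc n) f g = trans (+-congʳ (∑-+ n f g))
    (solve 4 (λ a b c d → a :+ b :+ (c :+ d) := a :+ c :+ (b :+ d)) refl (∑ n f) (∑ n g) (f n) (g n))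

  ∑-* : ∀ n x f → ∑ n (λ k → x * f k) ≈ x * ∑ n f
  ∑-* zero    x f = sym (zeroʳ x)
  ∑-* (suc n) x f = trans (+-congʳ (∑-* n x f)) (sym (distribˡ x (∑ n f) (f n)))

  ∑-split : ∀ n k f → ∑ (n ℕ.+ k) f ≈ ∑ n f + ∑ k (f ∘ (n ℕ.+_))
  ∑-split n zero    f rewrite ℕₚ.+-identityʳ n = sym (+-identityʳ _)
  ∑-split n (suc k) f rewrite ℕₚ.+-suc n k = trans (+-congʳ (∑-split n k f)) (+-assoc _ _ _)

  ∑-parity : ∀ n f → ∑ (2 ℕ.* n) f ≈ ∑ n (λ k → f (2 ℕ.* k)) + ∑ n (λ k → f (suc (2 ℕ.* k)))
  ∑-parity zero    f = sym (+-identityˡ 0#)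
  ∑-parity (suc n) f rewrite ℕₚ.+-suc n (n ℕ.+ 0) = trans (+-congʳ (+-congʳ (∑-parity n f)))
    (solve 4 (λ a b c d → a :+ b :+ c :+ d := a :+ c :+ (b :+ d)) refl
      (∑ n _) (∑ n _) (f (2 ℕ.* n)) (f (suc (2 ℕ.* n))))

  ι-∑ : ∀ n f → ι (∑ℤ n f) ≈ ∑ n (ι ∘ f)
  ι-∑ zero    f = 0-homo
  ι-∑ (suc n) f = trans (+-homo (∑ℤ n f) (f n)) (+-congʳ (ι-∑ n f))

  module _ (x : Carrier) where

    private
      term : ℕ → ℕ → Carrier
      term m k = ι (+ (m C k)) * x ^ k

      pascal : ∀ m k → ι (+ (suc m C suc k)) ≈ ι (+ (m C k)) + ι (+ (m C suc k))
      pascal m k = trans (reflexive (cong (ι ∘ +_) (≡.sym (nCk+nC[k+1]≡[n+1]C[k+1] m k))))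
                         (+-homo (+ (m C k)) (+ (m C suc k)))

    binomial-suc : ∀ m n → ∑ (suc n) (term (suc m)) ≈ ∑ (suc n) (term m) + x * ∑ n (term m)
    binomial-suc m zero    = sym (trans (+-congˡ (zeroʳ x)) (+-identityʳ _))
    binomial-suc m (suc n) = begin
      ∑ (suc n) (term (suc m)) + term (suc m) (suc n)
        ≈⟨ +-cong (binomial-suc m n) (*-congʳ (pascal m n)) ⟩
      ∑ (suc n) (term m) + x * ∑ n (term m) + (ι (+ (m C n)) + ι (+ (m C suc n))) * (x * x ^ n)
        ≈⟨ solve 6 (λ s t a b x y →
             s :+ x :* t :+ (a :+ b) :* (x :* y) := s :+ b :* (x :* y) :+ x :* (t :+ a :* y)) refl
             (∑ (suc n) (term m)) (∑ n (term m)) (ι (+ (m C n))) (ι (+ (m C suc n))) x (x ^ n) ⟩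
      ∑ (suc (suc n)) (term m) + x * ∑ (suc n) (term m) ∎

    binomial-stable : ∀ {m n} → m < n → ∑ (suc n) (term m) ≈ ∑ n (term m)
    binomial-stable {m} {n} m<n = begin
      ∑ n (term m) + ι (+ (m C n)) * x ^ n ≈⟨ +-congˡ (*-congʳ (reflexive (cong (ι ∘ +_) (k>n⇒nCk≡0 m<n)))) ⟩
      ∑ n (term m) + ι 0ℤ * x ^ n          ≈⟨ solve 2 (λ s y → s :+ con 0ℤ :* y := s) refl (∑ n (term m)) (x ^ n) ⟩
      ∑ n (term m)                         ∎

    -- The range may exceed the degree: the terms beyond m vanish. This lets the sum for exponent m
    -- run over all indices below p.
    binomial : ∀ {m n} → m < n → ∑ n (term m) ≈ (1# + x) ^ m
    binomial {zero} {suc zero} _ = trans (+-identityˡ _) (trans (*-congʳ 1-homo) (*-identityˡ 1#))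
    binomial {zero} {suc (suc n)} _ = trans (binomial-stable {0} {suc n} z<s) (binomial {0} {suc n} z<s)
    binomial {suc m} {suc n} (s<s m<n) = begin
      ∑ (suc n) (term (suc m))               ≈⟨ binomial-suc m n ⟩
      ∑ (suc n) (term m) + x * ∑ n (term m)  ≈⟨ +-congʳ (binomial-stable m<n) ⟩
      ∑ n (term m) + x * ∑ n (term m)        ≈⟨ +-cong (binomial m<n) (*-congˡ (binomial m<n)) ⟩
      (1# + x) ^ m + x * (1# + x) ^ m        ≈⟨ +-congʳ (*-identityˡ _) ⟨
      1# * (1# + x) ^ m + x * (1# + x) ^ m   ≈⟨ distribʳ _ 1# x ⟨
      (1# + x) ^ suc m                       ∎

  ∑-zero : ∀ n {f} → (∀ {k} → k < n → f k ≈ 0#) → ∑ n f ≈ 0#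
  ∑-zero zero    eq = refl
  ∑-zero (suc n) eq = trans (+-cong (∑-zero n (eq ∘ ℕₚ.m<n⇒m<1+n)) (eq (ℕₚ.n<1+n n))) (+-identityˡ 0#)

  module Characteristic {p : ℕ} (pp : Prime p) (p≈0 : ι (+ p) ≈ 0#) where

    ι-multiple : ∀ {n} → p ∣ n → ι (+ n) ≈ 0#
    ι-multiple (ℕ∣.divides q ≡.refl) = begin
      ι (+ (q ℕ.* p))     ≡⟨ cong ι (ℤₚ.pos-* q p) ⟩
      ι (+ q ℤ.* + p)     ≈⟨ *-homo (+ q) (+ p) ⟩
      ι (+ q) * ι (+ p)   ≈⟨ *-congˡ p≈0 ⟩
      ι (+ q) * 0#        ≈⟨ zeroʳ _ ⟩
      0#                  ∎

    -- The middle binomial coefficients are divisible by p. The shape 1 + x covers all later bases: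
    -- 1 - h, 1 + h², and the successive integers in Fermat's theorem.
    frobenius-1+ : ∀ x → (1# + x) ^ p ≈ 1# + x ^ p
    frobenius-1+ x = helper p ≡.refl
      where
      term : ℕ → Carrier
      term k = ι (+ (p C k)) * x ^ k
      helper : ∀ q → q ≡ p → (1# + x) ^ p ≈ 1# + x ^ p
      helper zero ≡.refl = contradiction pp ¬prime[0]
      helper (suc q) q≡p = begin
        (1# + x) ^ p                            ≈⟨ binomial x (ℕₚ.n<1+n p) ⟨
        ∑ p term + term p                       ≡⟨ cong (λ n → ∑ n term + term p) q≡p ⟨
        ∑ (1 ℕ.+ q) term + term p               ≈⟨ +-congʳ (∑-split 1 q term) ⟩
        0# + term 0 + ∑ q (term ∘ suc) + term p
          ≈⟨ +-cong (+-congˡ (∑-zero q λ {k} k<q → trans (*-congʳ (ι-multiple (prime∣binomial pp {k} (subst (suc k <_) q≡p (s<s k<q))))) (zeroˡ _)))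
                    (*-congʳ (reflexive (cong (ι ∘ +_) (nCn≡1 p)))) ⟩
        0# + ι 1ℤ * 1# + 0# + ι 1ℤ * x ^ p      ≈⟨ +-cong (+-congʳ (+-congˡ (*-congʳ 1-homo))) (*-congʳ 1-homo) ⟩
        0# + 1# * 1# + 0# + 1# * x ^ p          ≈⟨ +-cong (trans (+-identityʳ _) (trans (+-identityˡ _) (*-identityˡ 1#))) (*-identityˡ _) ⟩
        1# + x ^ p                              ∎

-- The ring ℤ/p.

module Congruence (p : ℕ) where

  infix 4 _≈_
  -- The quotient is part of the data, so a congruence can be matched on and substituted as an
  -- equation between integers.
  record _≈_ (x y : ℤ) : Set where
    constructor differ-by
    field
      quotient : ℤ
      equation : x ≡ y ℤ.+ quotient ℤ.* + p

  ≡⇒≈ : ∀ {x y} → x ≡ y → x ≈ y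
  ≡⇒≈ {x} ≡.refl = differ-by 0ℤ (≡.sym (ℤₚ.+-identityʳ x))

  private
    ≈-sym : ∀ {x y} → x ≈ y → y ≈ x
    ≈-sym {x} {y} (differ-by q ≡.refl) = differ-by (ℤ.- q) (eq y q (+ p))
      where
      eq : ∀ y q p → y ≡ y ℤ.+ q ℤ.* p ℤ.+ (ℤ.- q) ℤ.* p
      eq = solve-∀

    ≈-trans : ∀ {x y z} → x ≈ y → y ≈ z → x ≈ z
    ≈-trans {z = z} (differ-by q ≡.refl) (differ-by r ≡.refl) = differ-by (r ℤ.+ q) (eq z q r (+ p))
      where
      eq : ∀ z q r p → z ℤ.+ r ℤ.* p ℤ.+ q ℤ.* p ≡ z ℤ.+ (r ℤ.+ q) ℤ.* p
      eq = solve-∀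

    +-cong′ : ∀ {x y u v} → x ≈ y → u ≈ v → x ℤ.+ u ≈ y ℤ.+ v
    +-cong′ {y = y} {v = v} (differ-by q ≡.refl) (differ-by r ≡.refl) = differ-by (q ℤ.+ r) (eq y v q r (+ p))
      where
      eq : ∀ y v q r p → y ℤ.+ q ℤ.* p ℤ.+ (v ℤ.+ r ℤ.* p) ≡ y ℤ.+ v ℤ.+ (q ℤ.+ r) ℤ.* p
      eq = solve-∀

    *-cong′ : ∀ {x y u v} → x ≈ y → u ≈ v → x ℤ.* u ≈ y ℤ.* v
    *-cong′ {y = y} {v = v} (differ-by q ≡.refl) (differ-by r ≡.refl) =
      differ-by (q ℤ.* v ℤ.+ (y ℤ.+ q ℤ.* + p) ℤ.* r) (eq y v q r (+ p))
      where
      eq : ∀ y v q r p → (y ℤ.+ q ℤ.* p) ℤ.* (v ℤ.+ r ℤ.* p) ≡ y ℤ.* v ℤ.+ (q ℤ.* v ℤ.+ (y ℤ.+ q ℤ.* p) ℤ.* r) ℤ.* p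
      eq = solve-∀

    -‿cong′ : ∀ {x y} → x ≈ y → ℤ.- x ≈ ℤ.- y
    -‿cong′ {y = y} (differ-by q ≡.refl) = differ-by (ℤ.- q) (eq y q (+ p))
      where
      eq : ∀ y q p → ℤ.- (y ℤ.+ q ℤ.* p) ≡ ℤ.- y ℤ.+ (ℤ.- q) ℤ.* p
      eq = solve-∀

  isCommutativeRing : IsCommutativeRing _≈_ ℤ._+_ ℤ._*_ ℤ.-_ 0ℤ 1ℤ
  isCommutativeRing = record
    { isRing = record
      { +-isAbelianGroup = record
        { isGroup = record
          { isMonoid = record
            { isSemigroup = record
              { isMagma = record
                { isEquivalence = record { refl = ≡⇒≈ ≡.refl ; sym = ≈-sym ; trans = ≈-trans }
                ; ∙-cong = +-cong′
                }
              ; assoc = λ x y z → ≡⇒≈ (ℤₚ.+-assoc x y z)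
              }
            ; identity = (λ x → ≡⇒≈ (ℤₚ.+-identityˡ x)) , (λ x → ≡⇒≈ (ℤₚ.+-identityʳ x))
            }
          ; inverse = (λ x → ≡⇒≈ (ℤₚ.+-inverseˡ x)) , (λ x → ≡⇒≈ (ℤₚ.+-inverseʳ x))
          ; ⁻¹-cong = -‿cong′
          }
        ; comm = λ x y → ≡⇒≈ (ℤₚ.+-comm x y)
        }
      ; *-cong = *-cong′
      ; *-assoc = λ x y z → ≡⇒≈ (ℤₚ.*-assoc x y z)
      ; *-identity = (λ x → ≡⇒≈ (ℤₚ.*-identityˡ x)) , (λ x → ≡⇒≈ (ℤₚ.*-identityʳ x))
      ; distrib = (λ x y z → ≡⇒≈ (ℤₚ.*-distribˡ-+ x y z)) , (λ x y z → ≡⇒≈ (ℤₚ.*-distribʳ-+ x y z))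
      }
    ; *-comm = λ x y → ≡⇒≈ (ℤₚ.*-comm x y)
    }

  -- The carrier is ℤ itself with congruence as equality, so the reduction map is the identity and a
  -- residue can be written as any integer.
  ℤ/p : CommutativeRing 0ℓ 0ℓ
  ℤ/p = record { isCommutativeRing = isCommutativeRing }

  reduction : ℤ.+-*-rawRing -Raw-AlmostCommutative⟶ fromCommutativeRing ℤ/p
  reduction = record
    { ⟦_⟧ = id
    ; +-homo = λ _ _ → ≡⇒≈ ≡.refl
    ; *-homo = λ _ _ → ≡⇒≈ ≡.refl
    ; -‿homo = λ _ → ≡⇒≈ ≡.refl
    ; 0-homo = ≡⇒≈ ≡.refl
    ; 1-homo = ≡⇒≈ ≡.refl
    }

  ≈0⇒∣ : ∀ {x} → x ≈ 0ℤ → p ∣ ∣ x ∣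
  ≈0⇒∣ (differ-by q eq) = ℤ∣.∣⇒∣ᵤ (ℤ∣.divides q (≡.trans eq (ℤₚ.+-identityˡ _)))

  ∣⇒≈0 : ∀ {x} → p ∣ ∣ x ∣ → x ≈ 0ℤ
  ∣⇒≈0 p∣x with ℤ∣.divides q eq ← ℤ∣.∣ᵤ⇒∣ {+ p} p∣x = differ-by q (≡.trans eq (≡.sym (ℤₚ.+-identityˡ _)))

central-next : ∀ n → + suc n ℤ.* + central (suc n) ≡ + 2 ℤ.* (+ 1 ℤ.+ + 2 ℤ.* + n) ℤ.* + central n
central-next n = begin
  + suc n ℤ.* + central (suc n)                   ≡⟨ ℤₚ.pos-* (suc n) (central (suc n)) ⟨
  + (suc n ℕ.* central (suc n))                   ≡⟨ cong +_ (central-suc n) ⟩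
  + (2 ℕ.* suc (2 ℕ.* n) ℕ.* central n)           ≡⟨ ℤₚ.pos-* (2 ℕ.* suc (2 ℕ.* n)) (central n) ⟩
  + (2 ℕ.* suc (2 ℕ.* n)) ℤ.* + central n         ≡⟨ cong (ℤ._* + central n) (ℤₚ.pos-* 2 (suc (2 ℕ.* n))) ⟩
  + 2 ℤ.* (+ 1 ℤ.+ + (2 ℕ.* n)) ℤ.* + central n   ≡⟨ cong (λ z → + 2 ℤ.* (+ 1 ℤ.+ z) ℤ.* + central n) (ℤₚ.pos-* 2 n) ⟩
  + 2 ℤ.* (+ 1 ℤ.+ + 2 ℤ.* + n) ℤ.* + central n   ∎
  where open ≡.≡-Reasoning

-- Arithmetic modulo a prime, and central binomial coefficients modulo p.

module PrimeField {p : ℕ} (pp : Prime p) where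

  open Congruence p using (ℤ/p; reduction; differ-by; ≡⇒≈; ≈0⇒∣; ∣⇒≈0) public
  open IntegerAlgebra ℤ/p reduction public

  p≈0 : + p ≈ 0ℤ
  p≈0 = ∣⇒≈0 ℕ∣.∣-refl

  open Characteristic pp p≈0 public

  ≈0-split : ∀ x y → x * y ≈ 0ℤ → x ≈ 0ℤ ⊎ y ≈ 0ℤ
  ≈0-split x y xy≈0 with euclidsLemma ∣ x ∣ ∣ y ∣ pp (subst (p ∣_) (ℤₚ.abs-* x y) (≈0⇒∣ xy≈0))
  ... | inj₁ p∣x = inj₁ (∣⇒≈0 p∣x)
  ... | inj₂ p∣y = inj₂ (∣⇒≈0 p∣y)

  *-cancelˡ : ∀ u {x y} → ¬ u ≈ 0ℤ → u * x ≈ u * y → x ≈ y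
  *-cancelˡ u {x} {y} u≉0 eq = [ (λ u≈0 → contradiction u≈0 u≉0) , x-y≈0⇒x≈y ]′
    (≈0-split u (x - y) (trans (*-distribˡ-- u x y) (x≈y⇒x-y≈0 eq)))

  ≉0-* : ∀ {x y} → ¬ x ≈ 0ℤ → ¬ y ≈ 0ℤ → ¬ x * y ≈ 0ℤ
  ≉0-* {x} {y} x≉0 y≉0 eq = [ x≉0 , y≉0 ]′ (≈0-split x y eq)

  small≉0 : ∀ {n} → suc n < p → ¬ + suc n ≈ 0ℤ
  small≉0 n<p n≈0 = ℕ∣.>⇒∤ n<p (≈0⇒∣ n≈0)

  1≉0 : ¬ 1ℤ ≈ 0ℤ
  1≉0 = small≉0 (ℕ.nonTrivial⇒n>1 p {{prime⇒nonTrivial pp}})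

  unit≉0 : ∀ {x x′} → x * x′ ≈ 1ℤ → ¬ x ≈ 0ℤ
  unit≉0 {x} {x′} xx′ x≈0 = 1≉0 (trans (sym xx′) (trans (*-congʳ {x′} x≈0) (zeroˡ x′)))

  -- Induction away from 0 by (1 + x)^p = 1 + x^p. For negative x this identity is read backwards,
  -- from 1 + x to x.
  fermat : ∀ x → x ^ p ≈ x
  fermat (+ zero) = 0^ p {{prime⇒nonZero pp}}
    where
    0^ : ∀ n .{{_ : ℕ.NonZero n}} → 0ℤ ^ n ≈ 0ℤ
    0^ (suc n) = zeroˡ (0ℤ ^ n)
  fermat (+ suc n) = trans (frobenius-1+ (+ n)) (+-congˡ {1ℤ} (fermat (+ n)))
  fermat -[1+ n ] = +-cancelˡ 1ℤ (trans (sym (frobenius-1+ -[1+ n ])) (next n))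
    where
    next : ∀ n → (1ℤ + -[1+ n ]) ^ p ≈ 1ℤ + -[1+ n ]
    next zero    = fermat 0ℤ
    next (suc n) = fermat -[1+ n ]

  fermat-unit : ∀ {n x} → p ≡ suc n → ¬ x ≈ 0ℤ → x ^ n ≈ 1ℤ
  fermat-unit {n} {x} ≡.refl x≉0 = *-cancelˡ x x≉0 (trans (fermat x) (sym (*-identityʳ x)))

  -- The inverse is x^(p-2); the auxiliary `go` exposes p as q + 2.
  inverse : ∀ {x} → ¬ x ≈ 0ℤ → ∃ λ x′ → x * x′ ≈ 1ℤ
  inverse {x} x≉0 = go p ≡.refl
    where
    go : ∀ q → q ≡ p → ∃ λ x′ → x * x′ ≈ 1ℤ
    go zero          ≡.refl = contradiction pp ¬prime[0]
    go (suc zero)    ≡.refl = contradiction pp ¬prime[1]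
    go (suc (suc q)) eq   = x ^ q , fermat-unit {suc q} (≡.sym eq) x≉0

  module _ {m : ℕ} (p≡1+2m : p ≡ suc (2 ℕ.* m)) where

    -- Both sides obey the same recurrence modulo p: (n+1) B(n+1) = 2(2n+1) B(n), while (n+1)
    -- C(m,n+1) = (m-n) C(m,n) and 2(2n+1) ≡ -4(m-n). The bound n < p allows the division by n + 1
    -- at each step.
    central≈binomial : ∀ n → n < p → + central n ≈ (ℤ.- + 4) ^ n * + (m C n)
    central≈binomial zero    _ = refl
    central≈binomial (suc n) n<p = *-cancelˡ (+ suc n) (small≉0 n<p) (begin
      + suc n * + central (suc n)                         ≡⟨ central-next n ⟩
      + 2 * (+ 1 + + 2 * + n) * + central n               ≈⟨ *-congˡ {+ 2 * (+ 1 + + 2 * + n)} (central≈binomial n (ℕₚ.<-trans (ℕₚ.n<1+n n) n<p)) ⟩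
      -- The exact relation is 2(2n+1) = -4(m-n) + 2p, whence the quotient 2Xc.
      + 2 * (+ 1 + + 2 * + n) * (X * c)                   ≈⟨ differ-by (+ 2 * X * c) (identity (+ n) (+ m) X c c₁ (+ p) column P) ⟩
      + suc n * ((ℤ.- + 4) * X * c₁)                      ∎)
      where
      X = (ℤ.- + 4) ^ n
      c = + (m C n)
      c₁ = + (m C suc n)
      P : + p ≡ + 1 ℤ.+ + 2 ℤ.* + m
      P = ≡.trans (cong +_ p≡1+2m) (cong (ℤ._+_ (+ 1)) (ℤₚ.pos-* 2 m))
      column : + suc n ℤ.* c₁ ℤ.+ + suc n ℤ.* c ≡ + suc m ℤ.* c
      column = ≡.trans (≡.sym (cong₂ ℤ._+_ (ℤₚ.pos-* (suc n) (m C suc n)) (ℤₚ.pos-* (suc n) (m C n))))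
        (≡.trans (cong +_ (next-column m n)) (ℤₚ.pos-* (suc m) (m C n)))
      identity : ∀ N M X c c₁ P → (+ 1 ℤ.+ N) ℤ.* c₁ ℤ.+ (+ 1 ℤ.+ N) ℤ.* c ≡ (+ 1 ℤ.+ M) ℤ.* c → P ≡ + 1 ℤ.+ + 2 ℤ.* M →
        + 2 ℤ.* (+ 1 ℤ.+ + 2 ℤ.* N) ℤ.* (X ℤ.* c) ≡
        (+ 1 ℤ.+ N) ℤ.* ((ℤ.- + 4) ℤ.* X ℤ.* c₁) ℤ.+ + 2 ℤ.* X ℤ.* c ℤ.* P
      identity N M X c c₁ P col ≡.refl = ≡.trans (lhs N M X c)
        (≡.trans (cong (λ z → + 4 ℤ.* X ℤ.* (+ 1 ℤ.+ N) ℤ.* c ℤ.- + 4 ℤ.* X ℤ.* z ℤ.+ + 2 ℤ.* X ℤ.* c ℤ.* (+ 1 ℤ.+ + 2 ℤ.* M)) (≡.sym col)) (rhs N M X c c₁))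
        where
        lhs : ∀ N M X c → + 2 ℤ.* (+ 1 ℤ.+ + 2 ℤ.* N) ℤ.* (X ℤ.* c) ≡
          + 4 ℤ.* X ℤ.* (+ 1 ℤ.+ N) ℤ.* c ℤ.- + 4 ℤ.* X ℤ.* ((+ 1 ℤ.+ M) ℤ.* c) ℤ.+ + 2 ℤ.* X ℤ.* c ℤ.* (+ 1 ℤ.+ + 2 ℤ.* M)
        lhs = solve-∀
        rhs : ∀ N M X c c₁ → + 4 ℤ.* X ℤ.* (+ 1 ℤ.+ N) ℤ.* c ℤ.- + 4 ℤ.* X ℤ.* ((+ 1 ℤ.+ N) ℤ.* c₁ ℤ.+ (+ 1 ℤ.+ N) ℤ.* c) ℤ.+ + 2 ℤ.* X ℤ.* c ℤ.* (+ 1 ℤ.+ + 2 ℤ.* M) ≡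
          (+ 1 ℤ.+ N) ℤ.* ((ℤ.- + 4) ℤ.* X ℤ.* c₁) ℤ.+ + 2 ℤ.* X ℤ.* c ℤ.* (+ 1 ℤ.+ + 2 ℤ.* M)
        rhs = solve-∀

  -- A case of Lucas' theorem. Passing from d to d + 1 multiplies by (p+d+1)/(d+1), which is 1
  -- modulo p.
  [p+d]Cp≈1 : ∀ d → d < p → + ((p ℕ.+ d) C p) ≈ 1ℤ
  [p+d]Cp≈1 zero    _ = ≡⇒≈ (cong +_ (≡.trans (cong (_C p) (ℕₚ.+-identityʳ p)) (nCn≡1 p)))
  [p+d]Cp≈1 (suc d) d<p rewrite ℕₚ.+-suc p d = *-cancelˡ (+ suc d) (small≉0 d<p) (begin
    + suc d * + (suc (p ℕ.+ d) C p)          ≡⟨ row ⟩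
    + suc (p ℕ.+ d) * + ((p ℕ.+ d) C p)      ≈⟨ *-cong {+ suc (p ℕ.+ d)} {+ suc d} (differ-by 1ℤ (reorder (+ p) (+ d))) ([p+d]Cp≈1 d (ℕₚ.<-trans (ℕₚ.n<1+n d) d<p)) ⟩
    + suc d * 1ℤ                             ∎)
    where
    row : + suc d ℤ.* + (suc (p ℕ.+ d) C p) ≡ + suc (p ℕ.+ d) ℤ.* + ((p ℕ.+ d) C p)
    row = ≡.trans (≡.sym (ℤₚ.pos-* (suc d) _)) (≡.trans (cong +_ (next-row p d)) (ℤₚ.pos-* (suc (p ℕ.+ d)) _))
    reorder : ∀ P D → + 1 ℤ.+ (P ℤ.+ D) ≡ + 1 ℤ.+ D ℤ.+ + 1 ℤ.* P
    reorder = solve-∀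

  -- B(p) = 2 C(2p-1,p), and C(2p-1,p) is the case d = p - 1 of the preceding congruence.
  central-p : + central p ≈ + 2
  central-p = go p ≡.refl
    where
    go : ∀ q → q ≡ p → + central p ≈ + 2
    go zero    ≡.refl = contradiction pp ¬prime[0]
    go (suc q) ≡.refl = begin
      + central (suc q)                    ≡⟨ cong +_ (central-suc≡double q) ⟩
      + (2 ℕ.* (suc (2 ℕ.* q) C suc q))    ≡⟨ ℤₚ.pos-* 2 (suc (2 ℕ.* q) C suc q) ⟩
      + 2 * + (suc (2 ℕ.* q) C suc q)      ≡⟨ cong (λ n → + 2 * + (suc (q ℕ.+ n) C suc q)) (ℕₚ.+-identityʳ q) ⟩
      + 2 * + ((suc q ℕ.+ q) C suc q)      ≈⟨ *-congˡ {+ 2} ([p+d]Cp≈1 q (ℕₚ.n<1+n q)) ⟩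
      + 2                                  ∎

  -- The recurrences for B at p + j and at j have congruent coefficients, so the factor 2 found at j
  -- = 0 persists.
  central-shift : ∀ j → j < p → + central (p ℕ.+ j) ≈ + 2 * + central j
  central-shift zero    _   = trans (≡⇒≈ (cong (+_ ∘ central) (ℕₚ.+-identityʳ p))) central-p
  central-shift (suc j) j<p rewrite ℕₚ.+-suc p j with central-shift j (ℕₚ.<-trans (ℕₚ.n<1+n j) j<p)
  ... | differ-by t eq = *-cancelˡ (+ suc j) (small≉0 j<p)
      -- The multiples of p collected here: the p in the coefficient of B(p+j), the quotient t of
      -- the induction hypothesis, and the replacement of p + j + 1 by j + 1 on the left.
      (differ-by (+ 8 ℤ.* + central j ℤ.+ + 2 ℤ.* (+ 1 ℤ.+ + 2 ℤ.* (+ p ℤ.+ + j)) ℤ.* t ℤ.- + central (suc (p ℕ.+ j)))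
        (identity (+ p) (+ j) (+ central (p ℕ.+ j)) (+ central (suc (p ℕ.+ j))) (+ central j) (+ central (suc j)) t
        eq (central-next (p ℕ.+ j)) (central-next j)))
    where
    identity : ∀ P J B B₁ b b₁ t → B ≡ + 2 ℤ.* b ℤ.+ t ℤ.* P →
      (+ 1 ℤ.+ (P ℤ.+ J)) ℤ.* B₁ ≡ + 2 ℤ.* (+ 1 ℤ.+ + 2 ℤ.* (P ℤ.+ J)) ℤ.* B →
      (+ 1 ℤ.+ J) ℤ.* b₁ ≡ + 2 ℤ.* (+ 1 ℤ.+ + 2 ℤ.* J) ℤ.* b →
      (+ 1 ℤ.+ J) ℤ.* B₁ ≡ (+ 1 ℤ.+ J) ℤ.* (+ 2 ℤ.* b₁) ℤ.+
        (+ 8 ℤ.* b ℤ.+ + 2 ℤ.* (+ 1 ℤ.+ + 2 ℤ.* (P ℤ.+ J)) ℤ.* t ℤ.- B₁) ℤ.* P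
    identity P J _ B₁ b b₁ t ≡.refl e₁ e₂ = ≡.trans (lhs P J B₁) (≡.trans (cong (ℤ._- P ℤ.* B₁) e₁)
        (≡.trans (mid P J B₁ b t) (≡.trans (cong (λ z → + 2 ℤ.* z ℤ.+ R) (≡.sym e₂)) (rhs J b₁ R))))
      where
      R = (+ 8 ℤ.* b ℤ.+ + 2 ℤ.* (+ 1 ℤ.+ + 2 ℤ.* (P ℤ.+ J)) ℤ.* t ℤ.- B₁) ℤ.* P
      lhs : ∀ P J B₁ → (+ 1 ℤ.+ J) ℤ.* B₁ ≡ (+ 1 ℤ.+ (P ℤ.+ J)) ℤ.* B₁ ℤ.- P ℤ.* B₁
      lhs = solve-∀
      mid : ∀ P J B₁ b t → + 2 ℤ.* (+ 1 ℤ.+ + 2 ℤ.* (P ℤ.+ J)) ℤ.* (+ 2 ℤ.* b ℤ.+ t ℤ.* P) ℤ.- P ℤ.* B₁ ≡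
        + 2 ℤ.* (+ 2 ℤ.* (+ 1 ℤ.+ + 2 ℤ.* J) ℤ.* b) ℤ.+
        (+ 8 ℤ.* b ℤ.+ + 2 ℤ.* (+ 1 ℤ.+ + 2 ℤ.* (P ℤ.+ J)) ℤ.* t ℤ.- B₁) ℤ.* P
      mid = solve-∀
      rhs : ∀ J b₁ R → + 2 ℤ.* ((+ 1 ℤ.+ J) ℤ.* b₁) ℤ.+ R ≡ (+ 1 ℤ.+ J) ℤ.* (+ 2 ℤ.* b₁) ℤ.+ R
      rhs = solve-∀

  central∑ catalan∑ : ℤ → ℤ
  central∑ t = ∑ℤ p (λ k → + central (2 ℕ.* k) ℤ.* t ^ k)
  catalan∑ t = ∑ℤ p (λ k → + catalan (2 ℕ.* k) ℤ.* t ^ k)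

-- The generating function of the central binomial coefficients in characteristic p.

module GeneratingFunction {r ℓ} (R : CommutativeRing r ℓ)
    (φ : ℤ.+-*-rawRing -Raw-AlmostCommutative⟶ fromCommutativeRing R)
    {p : ℕ} (pp : Prime p) (p≈0 : CommutativeRing._≈_ R (_-Raw-AlmostCommutative⟶_.⟦_⟧ φ (+ p)) (CommutativeRing.0# R))
    {m : ℕ} (p≡1+2m : p ≡ suc (2 ℕ.* m)) where

  open IntegerAlgebra R φ
  open Characteristic pp p≈0
  private module 𝔽 = PrimeField pp

  ι-cong : ∀ {x y} → x 𝔽.≈ y → ι x ≈ ι y
  ι-cong {x} {y} (𝔽.differ-by q ≡.refl) = begin
    ι (y ℤ.+ q ℤ.* + p)       ≈⟨ +-homo y (q ℤ.* + p) ⟩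
    ι y + ι (q ℤ.* + p)       ≈⟨ +-congˡ (*-homo q (+ p)) ⟩
    ι y + ι q * ι (+ p)       ≈⟨ +-congˡ (*-congˡ p≈0) ⟩
    ι y + ι q * 0#            ≈⟨ +-congˡ (zeroʳ (ι q)) ⟩
    ι y + 0#                  ≈⟨ +-identityʳ (ι y) ⟩
    ι y                       ∎

  ι-𝔽^ : ∀ i n → ι (i 𝔽.^ n) ≈ ι i ^ n
  ι-𝔽^ i n = trans (ι-cong (𝔽.sym (𝔽.ι-^ i n))) (ι-^ i n)

  ι-fermat : ∀ i → ι i ^ p ≈ ι i
  ι-fermat i = trans (sym (ι-𝔽^ i p)) (ι-cong (𝔽.fermat i))

  m<p : m < p
  m<p = subst (m <_) (≡.sym p≡1+2m) (s≤s (ℕₚ.m≤m+n m (m ℕ.+ 0)))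

  G : Carrier → Carrier
  G v = (1# + ι (ℤ.- + 4) * v) ^ m * (1# + ι (+ 2) * v ^ p)

  -- The range is 2p because the theorem sums B(2k) over k < p. The lower half is a binomial
  -- expansion with exponent m, and the upper half is 2v^p times the lower one.
  central-sum : ∀ v → ∑ (2 ℕ.* p) (λ n → ι (+ central n) * v ^ n) ≈ G v
  central-sum v = begin
    ∑ (p ℕ.+ (p ℕ.+ 0)) f                       ≡⟨ cong (λ n → ∑ (p ℕ.+ n) f) (ℕₚ.+-identityʳ p) ⟩
    ∑ (p ℕ.+ p) f                               ≈⟨ ∑-split p p f ⟩
    ∑ p f + ∑ p (f ∘ (p ℕ.+_))                  ≈⟨ +-congˡ (∑-cong p upper) ⟩
    ∑ p f + ∑ p (λ j → ι (+ 2) * v ^ p * f j)   ≈⟨ +-congˡ (∑-* p (ι (+ 2) * v ^ p) f) ⟩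
    ∑ p f + ι (+ 2) * v ^ p * ∑ p f
      -- In solver terms the power `s :^ 0` stands for `1#`, whereas `con 1ℤ` stands for `ι 1ℤ`.
      ≈⟨ solve 2 (λ s t → s :+ t :* s := s :* (s :^ 0 :+ t)) refl (∑ p f) (ι (+ 2) * v ^ p) ⟩
    ∑ p f * (1# + ι (+ 2) * v ^ p)              ≈⟨ *-congʳ lower ⟩
    G v                                         ∎
    where
    f : ℕ → Carrier
    f n = ι (+ central n) * v ^ n
    upper : ∀ {j} → j < p → f (p ℕ.+ j) ≈ ι (+ 2) * v ^ p * f j
    upper {j} j<p = begin
      ι (+ central (p ℕ.+ j)) * v ^ (p ℕ.+ j)
        ≈⟨ *-cong (trans (ι-cong (𝔽.central-shift j j<p)) (*-homo (+ 2) (+ central j))) (^-homo-* v p j) ⟩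
      ι (+ 2) * ι (+ central j) * (v ^ p * v ^ j)
        ≈⟨ solve 4 (λ a b x y → a :* b :* (x :* y) := a :* x :* (b :* y)) refl _ _ _ _ ⟩
      ι (+ 2) * v ^ p * f j ∎
    lower : ∑ p f ≈ (1# + ι (ℤ.- + 4) * v) ^ m
    lower = trans (∑-cong p term) (binomial (ι (ℤ.- + 4) * v) m<p)
      where
      term : ∀ {n} → n < p → f n ≈ ι (+ (m C n)) * (ι (ℤ.- + 4) * v) ^ n
      term {n} n<p = begin
        ι (+ central n) * v ^ n                      ≈⟨ *-congʳ (ι-cong (𝔽.central≈binomial p≡1+2m n n<p)) ⟩
        ι ((ℤ.- + 4) 𝔽.^ n ℤ.* + (m C n)) * v ^ n    ≈⟨ *-congʳ (*-homo ((ℤ.- + 4) 𝔽.^ n) (+ (m C n))) ⟩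
        ι ((ℤ.- + 4) 𝔽.^ n) * ι (+ (m C n)) * v ^ n  ≈⟨ *-congʳ (*-congʳ (ι-𝔽^ (ℤ.- + 4) n)) ⟩
        ι (ℤ.- + 4) ^ n * ι (+ (m C n)) * v ^ n
          ≈⟨ solve 3 (λ a b c → a :* b :* c := b :* (a :* c)) refl _ _ _ ⟩
        ι (+ (m C n)) * (ι (ℤ.- + 4) ^ n * v ^ n)    ≈⟨ *-congˡ (^-distrib-* (ι (ℤ.- + 4)) v n) ⟨
        ι (+ (m C n)) * (ι (ℤ.- + 4) * v) ^ n        ∎

  -- The first two take the square t = v² as argument: t is the image of an integer, while v exists
  -- only in the extension.
  evenSum catalanSum oddSum : Carrier → Carrier
  evenSum t = ∑ p (λ k → ι (+ central (2 ℕ.* k)) * t ^ k)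
  catalanSum t = ∑ p (λ k → ι (+ catalan (2 ℕ.* k)) * t ^ k)
  oddSum v = ∑ p (λ k → ι (+ central (suc (2 ℕ.* k))) * v ^ suc (2 ℕ.* k))

  even+odd : ∀ v → evenSum (v * v) + oddSum v ≈ G v
  even+odd v = begin
    evenSum (v * v) + oddSum v    ≈⟨ +-congʳ (∑-cong p λ {k} _ → *-congˡ (square-^ v k)) ⟨
    _ + oddSum v                  ≈⟨ ∑-parity p (λ n → ι (+ central n) * v ^ n) ⟨
    _                             ≈⟨ central-sum v ⟩
    G v                           ∎

  neg-square : ∀ v → - v * - v ≈ v * v
  neg-square = solve 1 (λ v → (:- v) :* (:- v) := v :* v) refl

  neg-odd-^ : ∀ v k → (- v) ^ suc (2 ℕ.* k) ≈ - (v ^ suc (2 ℕ.* k))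
  neg-odd-^ v k = begin
    - v * (- v) ^ (2 ℕ.* k)   ≈⟨ *-congˡ (square-^ (- v) k) ⟩
    - v * (- v * - v) ^ k     ≈⟨ *-congˡ (^-congˡ k (neg-square v)) ⟩
    - v * (v * v) ^ k         ≈⟨ *-congˡ (square-^ v k) ⟨
    - v * v ^ (2 ℕ.* k)       ≈⟨ solve 2 (λ v w → :- v :* w := :- (v :* w)) refl v (v ^ (2 ℕ.* k)) ⟩
    - (v ^ suc (2 ℕ.* k))     ∎

  even-odd : ∀ v → evenSum (v * v) - oddSum v ≈ G (- v)
  even-odd v = begin
    evenSum (v * v) - oddSum v            ≈⟨ +-cong (∑-cong p λ {k} _ → *-congˡ (^-congˡ k (neg-square v))) flip ⟨
    evenSum (- v * - v) + oddSum (- v)    ≈⟨ even+odd (- v) ⟩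
    G (- v)                               ∎
    where
    minus : ∀ x y → x * - y ≈ - ι 1ℤ * (x * y)
    minus = solve 2 (λ x y → x :* :- y := :- con 1ℤ :* (x :* y)) refl
    flip : oddSum (- v) ≈ - oddSum v
    flip = begin
      oddSum (- v)              ≈⟨ ∑-cong p (λ {k} _ → trans (*-congˡ (neg-odd-^ v k)) (minus _ _)) ⟩
      ∑ p (λ k → - ι 1ℤ * (ι (+ central (suc (2 ℕ.* k))) * v ^ suc (2 ℕ.* k)))  ≈⟨ ∑-* p (- ι 1ℤ) _ ⟩
      - ι 1ℤ * oddSum v         ≈⟨ solve 1 (λ x → :- con 1ℤ :* x := :- x) refl (oddSum v) ⟩
      - oddSum v                ∎

  evenSum-G : ∀ v → ι (+ 2) * evenSum (v * v) ≈ G v + G (- v)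
  evenSum-G v = trans (solve 2 (λ e o → con (+ 2) :* e := e :+ o :+ (e :- o)) refl _ (oddSum v))
                      (+-cong (even+odd v) (even-odd v))

  -- The relation 2 C_n + B(n+1) = 4 B(n) at n = 2k, multiplied by v^(2k+1). The index shift by one
  -- is what brings in the odd part.
  catalanSum-evenSum : ∀ v → ι (+ 2) * v * catalanSum (v * v) + oddSum v ≈ ι (+ 4) * v * evenSum (v * v)
  catalanSum-evenSum v = begin
    ι (+ 2) * v * catalanSum (v * v) + oddSum v   ≈⟨ +-congʳ (∑-* p (ι (+ 2) * v) _) ⟨
    _ + oddSum v                                  ≈⟨ ∑-+ p _ _ ⟨
    _                                             ≈⟨ ∑-cong p (λ {k} _ → term k) ⟩
    _                                             ≈⟨ ∑-* p (ι (+ 4) * v) _ ⟩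
    ι (+ 4) * v * evenSum (v * v)                 ∎
    where
    catalan-eq : ∀ n → ι (+ 2) * ι (+ catalan n) + ι (+ central (suc n)) ≈ ι (+ 4) * ι (+ central n)
    catalan-eq n = begin
      ι (+ 2) * ι (+ catalan n) + ι (+ central (suc n))   ≈⟨ +-congʳ (*-homo (+ 2) (+ catalan n)) ⟨
      ι (+ 2 ℤ.* + catalan n) + ι (+ central (suc n))     ≡⟨ cong (λ z → ι z + ι (+ central (suc n))) (ℤₚ.pos-* 2 (catalan n)) ⟨
      ι (+ (2 ℕ.* catalan n)) + ι (+ central (suc n))     ≈⟨ +-homo (+ (2 ℕ.* catalan n)) (+ central (suc n)) ⟨
      ι (+ (2 ℕ.* catalan n ℕ.+ central (suc n)))         ≡⟨ cong (ι ∘ +_) (catalan-central n) ⟩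
      ι (+ (4 ℕ.* central n))                             ≡⟨ cong ι (ℤₚ.pos-* 4 (central n)) ⟩
      ι (+ 4 ℤ.* + central n)                             ≈⟨ *-homo (+ 4) (+ central n) ⟩
      ι (+ 4) * ι (+ central n)                           ∎
    term : ∀ k → ι (+ 2) * v * (ι (+ catalan (2 ℕ.* k)) * (v * v) ^ k) + ι (+ central (suc (2 ℕ.* k))) * v ^ suc (2 ℕ.* k)
               ≈ ι (+ 4) * v * (ι (+ central (2 ℕ.* k)) * (v * v) ^ k)
    term k = begin
      ι (+ 2) * v * (c * w) + B₁ * (v * v ^ (2 ℕ.* k))    ≈⟨ +-congˡ (*-congˡ (*-congˡ (square-^ v k))) ⟩
      ι (+ 2) * v * (c * w) + B₁ * (v * w)
        ≈⟨ solve 4 (λ v c w b → con (+ 2) :* v :* (c :* w) :+ b :* (v :* w) := (con (+ 2) :* c :+ b) :* (v :* w)) refl v c w B₁ ⟩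
      (ι (+ 2) * c + B₁) * (v * w)                        ≈⟨ *-congʳ (catalan-eq (2 ℕ.* k)) ⟩
      ι (+ 4) * B * (v * w)
        ≈⟨ solve 3 (λ v b w → con (+ 4) :* b :* (v :* w) := con (+ 4) :* v :* (b :* w)) refl v B w ⟩
      ι (+ 4) * v * (B * w)                               ∎
      where
      c = ι (+ catalan (2 ℕ.* k))
      w = (v * v) ^ k
      B = ι (+ central (2 ℕ.* k))
      B₁ = ι (+ central (suc (2 ℕ.* k)))

  catalanSum-G : ∀ v → ι (+ 4) * v * catalanSum (v * v) ≈
                 (1# + ι (ℤ.- + 4) * - v) * G (- v) - (1# + ι (ℤ.- + 4) * v) * G v
  catalanSum-G v = begin
    ι (+ 4) * v * c
      ≈⟨ solve 4 (λ v c e o → con (+ 4) :* v :* c := con (+ 2) :* (con (+ 2) :* v :* c :+ o) :- con (+ 2) :* o) refl v c e o ⟩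
    ι (+ 2) * (ι (+ 2) * v * c + o) - ι (+ 2) * o     ≈⟨ +-congʳ (*-congˡ (catalanSum-evenSum v)) ⟩
    ι (+ 2) * (ι (+ 4) * v * e) - ι (+ 2) * o
      ≈⟨ solve 3 (λ v e o → con (+ 2) :* (con (+ 4) :* v :* e) :- con (+ 2) :* o :=
           (v :^ 0 :+ con (ℤ.- + 4) :* :- v) :* (e :- o) :- (v :^ 0 :+ con (ℤ.- + 4) :* v) :* (e :+ o)) refl v e o ⟩
    _ ≈⟨ +-cong (*-congˡ (even-odd v)) (-‿cong (*-congˡ (even+odd v))) ⟩
    (1# + ι (ℤ.- + 4) * - v) * G (- v) - (1# + ι (ℤ.- + 4) * v) * G v ∎
    where
    c = catalanSum (v * v)
    e = evenSum (v * v)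
    o = oddSum v

  -- The Legendre symbol of -1, which separates the two classes of p modulo 4.
  σ : Carrier
  σ = ι (ℤ.- 1ℤ) ^ m

  -1*-1≈1 : ι (ℤ.- 1ℤ) * ι (ℤ.- 1ℤ) ≈ 1#
  -1*-1≈1 = trans (sym (*-homo (ℤ.- 1ℤ) (ℤ.- 1ℤ))) 1-homo

  σ*σ≈1 : σ * σ ≈ 1#
  σ*σ≈1 = ^-unit m -1*-1≈1

  ^p : ∀ x → x ^ p ≈ x * (x * x) ^ m
  ^p x = trans (^-congʳ x p≡1+2m) (*-congˡ (square-^ x m))

  neg-^m : ∀ x → (ι (+ 2) * - x) ^ m ≈ σ * (ι (+ 2) * x) ^ m
  neg-^m x = trans (^-congˡ m (solve 1 (λ x → con (+ 2) :* :- x := con (ℤ.- 1ℤ) :* (con (+ 2) :* x)) refl x))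
                   (^-distrib-* (ι (ℤ.- 1ℤ)) (ι (+ 2) * x) m)

  -- The left side is (1 - h)^p, split by p = 2m + 1 so that it matches the factor ((1 - h)²)^m
  -- coming from (1 - 4v)^m.
  frobenius-1- : ∀ {h ε} → (h * h) ^ m ≈ ε → (1# - h) * ((1# - h) * (1# - h)) ^ m ≈ 1# - h * ε
  frobenius-1- {h} {ε} hε = begin
    (1# - h) * ((1# - h) * (1# - h)) ^ m  ≈⟨ ^p (1# - h) ⟨
    (1# + - h) ^ p                        ≈⟨ frobenius-1+ (- h) ⟩
    1# + (- h) ^ p                        ≈⟨ +-congˡ (^p (- h)) ⟩
    1# + - h * (- h * - h) ^ m            ≈⟨ +-congˡ (*-congˡ (trans (^-congˡ m (neg-square h)) hε)) ⟩
    1# + - h * ε                          ≈⟨ +-congˡ (solve 2 (λ h ε → :- h :* ε := :- (h :* ε)) refl h ε) ⟩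
    1# - h * ε                            ∎

  -- The value of G at v alone. The hypotheses are unchanged under (h, v) ↦ (-h, -v), so a second
  -- instance gives G(-v). In the application ε is e^m, the symbol of e.
  module HalfFormula {h v ε : Carrier} (hε : (h * h) ^ m ≈ ε) (εε : ε * ε ≈ 1#)
                     (8hv : ι (+ 8) * h * v ≈ 1# + h * h) where

    private
      Z = (ι (+ 2) * h) ^ m
      Q = (1# + ι (ℤ.- + 4) * v) ^ m
      W = 1# + ι (+ 2) * v ^ p
      Y = ((1# - h) * (1# - h)) ^ m
      K = ε * (1# + h * h)

    -- The p-th power of `8hv`: on the left 8^p = 8 and h^p = hε, on the right h^(2p) = h² because
    -- ε² = 1.
    v^p : ι (+ 8) * (h * ε) * v ^ p ≈ 1# + h * h
    v^p = begin
      ι (+ 8) * (h * ε) * v ^ p           ≈⟨ *-congʳ (*-cong (ι-fermat (+ 8)) (trans (^p h) (*-congˡ hε))) ⟨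
      ι (+ 8) ^ p * h ^ p * v ^ p         ≈⟨ *-congʳ (^-distrib-* (ι (+ 8)) h p) ⟨
      (ι (+ 8) * h) ^ p * v ^ p           ≈⟨ ^-distrib-* (ι (+ 8) * h) v p ⟨
      (ι (+ 8) * h * v) ^ p               ≈⟨ ^-congˡ p 8hv ⟩
      (1# + h * h) ^ p                    ≈⟨ frobenius-1+ (h * h) ⟩
      1# + (h * h) ^ p                    ≈⟨ +-congˡ (^p (h * h)) ⟩
      1# + h * h * (h * h * (h * h)) ^ m  ≈⟨ +-congˡ (*-congˡ (^-distrib-* (h * h) (h * h) m)) ⟩
      1# + h * h * ((h * h) ^ m * (h * h) ^ m) ≈⟨ +-congˡ (*-congˡ (trans (*-cong hε hε) εε)) ⟩
      1# + h * h * 1#                     ≈⟨ +-congˡ (*-identityʳ (h * h)) ⟩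
      1# + h * h                          ∎

    second-factor : ι (+ 4) * h * W ≈ ι (+ 4) * h + K
    second-factor = begin
      ι (+ 4) * h * W
        -- Inserting ε² = 1 turns 8h v^p into ε times the left side of `v^p`.
        ≈⟨ ≈-by (- (ι (+ 8) * h * v ^ p)) (solve 3 (λ h ε w →
             con (+ 4) :* h :* (h :^ 0 :+ con (+ 2) :* w) :=
             con (+ 4) :* h :+ ε :* (con (+ 8) :* (h :* ε) :* w) :+ :- (con (+ 8) :* h :* w) :* (ε :* ε :- h :^ 0)) refl h ε (v ^ p)) εε ⟩
      ι (+ 4) * h + ε * (ι (+ 8) * (h * ε) * v ^ p)  ≈⟨ +-congˡ (*-congˡ v^p) ⟩
      ι (+ 4) * h + K                                ∎

    first-base : ι (+ 2) * h * (1# + ι (ℤ.- + 4) * v) ≈ ι (ℤ.- 1ℤ) * ((1# - h) * (1# - h))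
    first-base = ≈-by (ι (ℤ.- 1ℤ)) (solve 2 (λ h v →
      con (+ 2) :* h :* (h :^ 0 :+ con (ℤ.- + 4) :* v) :=
      con (ℤ.- 1ℤ) :* ((h :^ 0 :- h) :* (h :^ 0 :- h)) :+ con (ℤ.- 1ℤ) :* (con (+ 8) :* h :* v :- (h :^ 0 :+ h :* h))) refl h v) 8hv

    first-factor : Z * Q ≈ σ * Y
    first-factor = begin
      Z * Q                                         ≈⟨ ^-distrib-* _ _ m ⟨
      (ι (+ 2) * h * (1# + ι (ℤ.- + 4) * v)) ^ m    ≈⟨ ^-congˡ m first-base ⟩
      (ι (ℤ.- 1ℤ) * ((1# - h) * (1# - h))) ^ m      ≈⟨ ^-distrib-* _ _ m ⟩
      σ * Y                                         ∎

    -- Of 1 - h² = (1 + h)(1 - h) the second factor completes ((1 - h)²)^m to a p-th power. The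
    -- first does the same after h ↦ -h, so G(v) and G(-v) share one prefactor up to sign.
    half-even : Z * (1# - h * h) * (ι (+ 4) * h) * G v ≈ σ * ((1# + h) * (1# - h * ε)) * (ι (+ 4) * h + K)
    half-even = begin
      Z * (1# - h * h) * (ι (+ 4) * h) * (Q * W)
        ≈⟨ solve 4 (λ z h q w → z :* (h :^ 0 :- h :* h) :* (con (+ 4) :* h) :* (q :* w) :=
             z :* q :* (h :^ 0 :- h :* h) :* (con (+ 4) :* h :* w)) refl Z h Q W ⟩
      Z * Q * (1# - h * h) * (ι (+ 4) * h * W)        ≈⟨ *-cong (*-congʳ first-factor) second-factor ⟩
      σ * Y * (1# - h * h) * (ι (+ 4) * h + K)
        ≈⟨ *-congʳ (solve 3 (λ s y h → s :* y :* (h :^ 0 :- h :* h) := s :* ((h :^ 0 :+ h) :* ((h :^ 0 :- h) :* y))) refl σ Y h) ⟩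
      σ * ((1# + h) * ((1# - h) * Y)) * (ι (+ 4) * h + K)  ≈⟨ *-congʳ (*-congˡ (*-congˡ (frobenius-1- hε))) ⟩
      σ * ((1# + h) * (1# - h * ε)) * (ι (+ 4) * h + K) ∎

    -- The factor 1 - 4v contributes (1 - h)². One 1 - h completes the p-th power and the other
    -- survives, so 1 - h² does not enter the prefactor.
    half-catalan : Z * (ι (+ 2) * h) * (ι (+ 4) * h) * ((1# + ι (ℤ.- + 4) * v) * G v) ≈
                   - (σ * ((1# - h) * (1# - h * ε)) * (ι (+ 4) * h + K))
    half-catalan = begin
      Z * (ι (+ 2) * h) * (ι (+ 4) * h) * ((1# + ι (ℤ.- + 4) * v) * (Q * W))
        ≈⟨ solve 5 (λ z h q w u → z :* (con (+ 2) :* h) :* (con (+ 4) :* h) :* (u :* (q :* w)) :=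
             z :* q :* (con (+ 2) :* h :* u) :* (con (+ 4) :* h :* w)) refl Z h Q W (1# + ι (ℤ.- + 4) * v) ⟩
      Z * Q * (ι (+ 2) * h * (1# + ι (ℤ.- + 4) * v)) * (ι (+ 4) * h * W) ≈⟨ *-cong (*-cong first-factor first-base) second-factor ⟩
      σ * Y * (ι (ℤ.- 1ℤ) * ((1# - h) * (1# - h))) * (ι (+ 4) * h + K)
        ≈⟨ solve 4 (λ s y u w → s :* y :* (con (ℤ.- 1ℤ) :* (u :* u)) :* w := :- (s :* (u :* (u :* y)) :* w)) refl σ Y (1# - h) (ι (+ 4) * h + K) ⟩
      - (σ * ((1# - h) * ((1# - h) * Y)) * (ι (+ 4) * h + K))
        ≈⟨ -‿cong (*-congʳ (*-congˡ (*-congˡ (frobenius-1- hε)))) ⟩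
      - (σ * ((1# - h) * (1# - h * ε)) * (ι (+ 4) * h + K)) ∎

  module Formula {h v ε : Carrier} (hε : (h * h) ^ m ≈ ε) (εε : ε * ε ≈ 1#)
                 (8hv : ι (+ 8) * h * v ≈ 1# + h * h) where

    private
      Z = (ι (+ 2) * h) ^ m
      K = ε * (1# + h * h)
      module P = HalfFormula hε εε 8hv
      module N = HalfFormula { - h} { - v} (trans (^-congˡ m (neg-square h)) hε) εε
        (trans (solve 2 (λ h v → con (+ 8) :* :- h :* :- v := con (+ 8) :* h :* v) refl h v)
          (trans 8hv (+-congˡ (sym (neg-square h)))))

    negative-even : Z * (1# - h * h) * (ι (+ 4) * h) * G (- v) ≈ (1# - h) * (1# + h * ε) * (ι (+ 4) * h - K)
    negative-even = begin
      Z * (1# - h * h) * (ι (+ 4) * h) * G (- v)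
        -- σ² = 1 is inserted; one σ is then absorbed by changing (2h)^m into (2(-h))^m, as the
        -- instance at -h requires.
        ≈⟨ ≈-by (- (Z * (1# - h * h) * (ι (+ 4) * h) * G (- v))) (solve 4 (λ s z h g →
             z :* (h :^ 0 :- h :* h) :* (con (+ 4) :* h) :* g :=
             :- (s :* (s :* z :* (h :^ 0 :- :- h :* :- h) :* (con (+ 4) :* :- h) :* g))
             :+ :- (z :* (h :^ 0 :- h :* h) :* (con (+ 4) :* h) :* g) :* (s :* s :- h :^ 0)) refl σ Z h (G (- v))) σ*σ≈1 ⟩
      - (σ * (σ * Z * (1# - - h * - h) * (ι (+ 4) * - h) * G (- v)))
        ≈⟨ -‿cong (*-congˡ (*-congʳ (*-congʳ (*-congʳ (neg-^m h))))) ⟨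
      - (σ * ((ι (+ 2) * - h) ^ m * (1# - - h * - h) * (ι (+ 4) * - h) * G (- v)))
        ≈⟨ -‿cong (*-congˡ N.half-even) ⟩
      - (σ * (σ * ((1# + - h) * (1# - - h * ε)) * (ι (+ 4) * - h + ε * (1# + - h * - h))))
        ≈⟨ ≈-by ((1# - h) * (1# + h * ε) * (ι (+ 4) * h - K)) (solve 3 (λ s h ε →
             :- (s :* (s :* ((h :^ 0 :+ :- h) :* (h :^ 0 :- :- h :* ε)) :* (con (+ 4) :* :- h :+ ε :* (h :^ 0 :+ :- h :* :- h)))) :=
             (h :^ 0 :- h) :* (h :^ 0 :+ h :* ε) :* (con (+ 4) :* h :- ε :* (h :^ 0 :+ h :* h))
             :+ (h :^ 0 :- h) :* (h :^ 0 :+ h :* ε) :* (con (+ 4) :* h :- ε :* (h :^ 0 :+ h :* h)) :* (s :* s :- h :^ 0)) refl σ h ε) σ*σ≈1 ⟩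
      (1# - h) * (1# + h * ε) * (ι (+ 4) * h - K) ∎

    negative-catalan : Z * (ι (+ 2) * h) * (ι (+ 4) * h) * ((1# + ι (ℤ.- + 4) * - v) * G (- v)) ≈
                       (1# + h) * (1# + h * ε) * (ι (+ 4) * h - K)
    negative-catalan = begin
      Z * (ι (+ 2) * h) * (ι (+ 4) * h) * g
        ≈⟨ ≈-by (- (Z * (ι (+ 2) * h) * (ι (+ 4) * h) * g)) (solve 4 (λ s z h g →
             z :* (con (+ 2) :* h) :* (con (+ 4) :* h) :* g :=
             s :* (s :* z :* (con (+ 2) :* :- h) :* (con (+ 4) :* :- h) :* g)
             :+ :- (z :* (con (+ 2) :* h) :* (con (+ 4) :* h) :* g) :* (s :* s :- h :^ 0)) refl σ Z h g) σ*σ≈1 ⟩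
      σ * (σ * Z * (ι (+ 2) * - h) * (ι (+ 4) * - h) * g)
        ≈⟨ *-congˡ (*-congʳ (*-congʳ (*-congʳ (neg-^m h)))) ⟨
      σ * ((ι (+ 2) * - h) ^ m * (ι (+ 2) * - h) * (ι (+ 4) * - h) * g)
        ≈⟨ *-congˡ N.half-catalan ⟩
      σ * - (σ * ((1# - - h) * (1# - - h * ε)) * (ι (+ 4) * - h + ε * (1# + - h * - h)))
        ≈⟨ ≈-by ((1# + h) * (1# + h * ε) * (ι (+ 4) * h - K)) (solve 3 (λ s h ε →
             s :* :- (s :* ((h :^ 0 :- :- h) :* (h :^ 0 :- :- h :* ε)) :* (con (+ 4) :* :- h :+ ε :* (h :^ 0 :+ :- h :* :- h))) :=
             (h :^ 0 :+ h) :* (h :^ 0 :+ h :* ε) :* (con (+ 4) :* h :- ε :* (h :^ 0 :+ h :* h))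
             :+ (h :^ 0 :+ h) :* (h :^ 0 :+ h :* ε) :* (con (+ 4) :* h :- ε :* (h :^ 0 :+ h :* h)) :* (s :* s :- h :^ 0)) refl σ h ε) σ*σ≈1 ⟩
      (1# + h) * (1# + h * ε) * (ι (+ 4) * h - K) ∎
      where g = (1# + ι (ℤ.- + 4) * - v) * G (- v)

    evenSum-formula : Z * (1# - h * h) * (ι (+ 4) * h) * (ι (+ 2) * evenSum (v * v)) ≈
      σ * ((1# + h) * (1# - h * ε)) * (ι (+ 4) * h + K) + (1# - h) * (1# + h * ε) * (ι (+ 4) * h - K)
    evenSum-formula = trans (*-congˡ (evenSum-G v)) (trans (distribˡ _ (G v) (G (- v))) (+-cong P.half-even negative-even))

    catalanSum-formula : Z * (ι (+ 4) * h) * (1# + h * h) * catalanSum (v * v) ≈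
      (1# + h) * (1# + h * ε) * (ι (+ 4) * h - K) + σ * ((1# - h) * (1# - h * ε)) * (ι (+ 4) * h + K)
    catalanSum-formula = begin
      Z * (ι (+ 4) * h) * (1# + h * h) * c
        -- The factor 1 + h² = 8hv is split as 2h times 4v, and `catalanSum-G` evaluates 4v times
        -- the sum.
        ≈⟨ *-congʳ (*-congˡ 8hv) ⟨
      Z * (ι (+ 4) * h) * (ι (+ 8) * h * v) * c
        ≈⟨ solve 4 (λ z h v c → z :* (con (+ 4) :* h) :* (con (+ 8) :* h :* v) :* c :=
             z :* (con (+ 2) :* h) :* (con (+ 4) :* h) :* (con (+ 4) :* v :* c)) refl Z h v c ⟩
      Z * (ι (+ 2) * h) * (ι (+ 4) * h) * (ι (+ 4) * v * c)
        ≈⟨ *-congˡ (catalanSum-G v) ⟩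
      Z * (ι (+ 2) * h) * (ι (+ 4) * h) * (A - B)
        ≈⟨ *-distribˡ-- _ A B ⟩
      Z * (ι (+ 2) * h) * (ι (+ 4) * h) * A - Z * (ι (+ 2) * h) * (ι (+ 4) * h) * B
        ≈⟨ +-cong negative-catalan (-‿cong P.half-catalan) ⟩
      X₁ - - X₂
        ≈⟨ solve 2 (λ x y → x :- :- y := x :+ y) refl X₁ X₂ ⟩
      X₁ + X₂ ∎
      where
      c = catalanSum (v * v)
      A = (1# + ι (ℤ.- + 4) * - v) * G (- v)
      B = (1# + ι (ℤ.- + 4) * v) * G v
      X₁ = (1# + h) * (1# + h * ε) * (ι (+ 4) * h - K)
      X₂ = σ * ((1# - h) * (1# - h * ε)) * (ι (+ 4) * h + K)

    -- The right sides of the two formulas are odd in h for σ = 1 and even in h for σ = -1. So 2h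
    -- can be cancelled in the first case and 2 in the second, after which h occurs on the right
    -- only as h². On the left remain Z or Zh, which are 2^m times powers of h² for m even or odd
    -- respectively.
    module Units {h′ 2′ : Carrier} (hh′ : h * h′ ≈ 1#) (22′ : ι (+ 2) * 2′ ≈ 1#) where

      private
        2h-unit : ι (+ 2) * h * (2′ * h′) ≈ 1#
        2h-unit = trans (solve 4 (λ h h′ x y → x :* h :* (y :* h′) := x :* y :* (h :* h′)) refl h h′ (ι (+ 2)) 2′)
                        (trans (*-cong 22′ hh′) (*-identityˡ 1#))

      module _ (σ≈1 : σ ≈ 1#) where

        evenSum-even : ι (+ 4) * Z * (1# - h * h) * evenSum (v * v) ≈ (ι (+ 3) - h * h) - (ι (+ 3) * (h * h) - 1#) * ε
        evenSum-even = *-cancel-unit (ι (+ 2) * h) (2′ * h′) 2h-unit (begin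
          ι (+ 4) * Z * (1# - h * h) * S * (ι (+ 2) * h)
            ≈⟨ solve 4 (λ h z s x → con (+ 4) :* z :* (x :- h :* h) :* s :* (con (+ 2) :* h) :=
                 z :* (x :- h :* h) :* (con (+ 4) :* h) :* (con (+ 2) :* s)) refl h Z S 1# ⟩
          Z * (1# - h * h) * (ι (+ 4) * h) * (ι (+ 2) * S) ≈⟨ evenSum-formula ⟩
          σ * ((1# + h) * (1# - h * ε)) * (ι (+ 4) * h + K) + (1# - h) * (1# + h * ε) * (ι (+ 4) * h - K)
            ≈⟨ +-congʳ (*-congʳ (*-congʳ σ≈1)) ⟩
          1# * ((1# + h) * (1# - h * ε)) * (ι (+ 4) * h + K) + (1# - h) * (1# + h * ε) * (ι (+ 4) * h - K)
            ≈⟨ ≈-by (- (ι (+ 2) * h * (1# + h * h))) (solve 2 (λ h ε →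
                 let o = h :^ 0; k = ε :* (o :+ h :* h) in
                 o :* ((o :+ h) :* (o :- h :* ε)) :* (con (+ 4) :* h :+ k) :+ (o :- h) :* (o :+ h :* ε) :* (con (+ 4) :* h :- k) :=
                 ((con (+ 3) :- h :* h) :- (con (+ 3) :* (h :* h) :- o) :* ε) :* (con (+ 2) :* h)
                 :+ :- (con (+ 2) :* h :* (o :+ h :* h)) :* (ε :* ε :- o)) refl h ε) εε ⟩
          ((ι (+ 3) - h * h) - (ι (+ 3) * (h * h) - 1#) * ε) * (ι (+ 2) * h) ∎)
          where S = evenSum (v * v)

        catalanSum-even : ι (+ 2) * Z * (1# + h * h) * catalanSum (v * v) ≈ (ι (+ 3) - h * h) + (ι (+ 3) * (h * h) - 1#) * ε
        catalanSum-even = *-cancel-unit (ι (+ 2) * h) (2′ * h′) 2h-unit (begin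
          ι (+ 2) * Z * (1# + h * h) * S * (ι (+ 2) * h)
            ≈⟨ solve 4 (λ h z s x → con (+ 2) :* z :* (x :+ h :* h) :* s :* (con (+ 2) :* h) :=
                 z :* (con (+ 4) :* h) :* (x :+ h :* h) :* s) refl h Z S 1# ⟩
          Z * (ι (+ 4) * h) * (1# + h * h) * S ≈⟨ catalanSum-formula ⟩
          (1# + h) * (1# + h * ε) * (ι (+ 4) * h - K) + σ * ((1# - h) * (1# - h * ε)) * (ι (+ 4) * h + K)
            ≈⟨ +-congˡ (*-congʳ (*-congʳ σ≈1)) ⟩
          (1# + h) * (1# + h * ε) * (ι (+ 4) * h - K) + 1# * ((1# - h) * (1# - h * ε)) * (ι (+ 4) * h + K)
            ≈⟨ ≈-by (- (ι (+ 2) * h * (1# + h * h))) (solve 2 (λ h ε →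
                 let o = h :^ 0; k = ε :* (o :+ h :* h) in
                 (o :+ h) :* (o :+ h :* ε) :* (con (+ 4) :* h :- k) :+ o :* ((o :- h) :* (o :- h :* ε)) :* (con (+ 4) :* h :+ k) :=
                 ((con (+ 3) :- h :* h) :+ (con (+ 3) :* (h :* h) :- o) :* ε) :* (con (+ 2) :* h)
                 :+ :- (con (+ 2) :* h :* (o :+ h :* h)) :* (ε :* ε :- o)) refl h ε) εε ⟩
          ((ι (+ 3) - h * h) + (ι (+ 3) * (h * h) - 1#) * ε) * (ι (+ 2) * h) ∎)
          where S = catalanSum (v * v)

      module _ (σ≈-1 : σ ≈ - 1#) where

        evenSum-odd : ι (+ 4) * (Z * h) * (1# - h * h) * evenSum (v * v) ≈ (ι (+ 3) * (h * h) - 1#) * ε - h * h * (ι (+ 3) - h * h)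
        evenSum-odd = *-cancel-unit (ι (+ 2)) 2′ 22′ (begin
          ι (+ 4) * (Z * h) * (1# - h * h) * S * ι (+ 2)
            ≈⟨ solve 4 (λ h z s x → con (+ 4) :* (z :* h) :* (x :- h :* h) :* s :* con (+ 2) :=
                 z :* (x :- h :* h) :* (con (+ 4) :* h) :* (con (+ 2) :* s)) refl h Z S 1# ⟩
          Z * (1# - h * h) * (ι (+ 4) * h) * (ι (+ 2) * S) ≈⟨ evenSum-formula ⟩
          σ * ((1# + h) * (1# - h * ε)) * (ι (+ 4) * h + K) + (1# - h) * (1# + h * ε) * (ι (+ 4) * h - K)
            ≈⟨ +-congʳ (*-congʳ (*-congʳ σ≈-1)) ⟩
          - 1# * ((1# + h) * (1# - h * ε)) * (ι (+ 4) * h + K) + (1# - h) * (1# + h * ε) * (ι (+ 4) * h - K)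
            ≈⟨ ≈-by (ι (+ 2) * (h * h) * (1# + h * h)) (solve 2 (λ h ε →
                 let o = h :^ 0; k = ε :* (o :+ h :* h) in
                 :- o :* ((o :+ h) :* (o :- h :* ε)) :* (con (+ 4) :* h :+ k) :+ (o :- h) :* (o :+ h :* ε) :* (con (+ 4) :* h :- k) :=
                 ((con (+ 3) :* (h :* h) :- o) :* ε :- h :* h :* (con (+ 3) :- h :* h)) :* con (+ 2)
                 :+ con (+ 2) :* (h :* h) :* (o :+ h :* h) :* (ε :* ε :- o)) refl h ε) εε ⟩
          ((ι (+ 3) * (h * h) - 1#) * ε - h * h * (ι (+ 3) - h * h)) * ι (+ 2) ∎)
          where S = evenSum (v * v)

        catalanSum-odd : ι (+ 2) * (Z * h) * (1# + h * h) * catalanSum (v * v) ≈ (ι (+ 3) * (h * h) - 1#) * ε + h * h * (ι (+ 3) - h * h)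
        catalanSum-odd = *-cancel-unit (ι (+ 2)) 2′ 22′ (begin
          ι (+ 2) * (Z * h) * (1# + h * h) * S * ι (+ 2)
            ≈⟨ solve 4 (λ h z s x → con (+ 2) :* (z :* h) :* (x :+ h :* h) :* s :* con (+ 2) :=
                 z :* (con (+ 4) :* h) :* (x :+ h :* h) :* s) refl h Z S 1# ⟩
          Z * (ι (+ 4) * h) * (1# + h * h) * S ≈⟨ catalanSum-formula ⟩
          (1# + h) * (1# + h * ε) * (ι (+ 4) * h - K) + σ * ((1# - h) * (1# - h * ε)) * (ι (+ 4) * h + K)
            ≈⟨ +-congˡ (*-congʳ (*-congʳ σ≈-1)) ⟩
          (1# + h) * (1# + h * ε) * (ι (+ 4) * h - K) + - 1# * ((1# - h) * (1# - h * ε)) * (ι (+ 4) * h + K)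
            ≈⟨ ≈-by (- (ι (+ 2) * (h * h) * (1# + h * h))) (solve 2 (λ h ε →
                 let o = h :^ 0; k = ε :* (o :+ h :* h) in
                 (o :+ h) :* (o :+ h :* ε) :* (con (+ 4) :* h :- k) :+ :- o :* ((o :- h) :* (o :- h :* ε)) :* (con (+ 4) :* h :+ k) :=
                 ((con (+ 3) :* (h :* h) :- o) :* ε :+ h :* h :* (con (+ 3) :- h :* h)) :* con (+ 2)
                 :+ :- (con (+ 2) :* (h :* h) :* (o :+ h :* h)) :* (ε :* ε :- o)) refl h ε) εε ⟩
          ((ι (+ 3) * (h * h) - 1#) * ε + h * h * (ι (+ 3) - h * h)) * ι (+ 2) ∎)
          where S = catalanSum (v * v)

  -- For h² = -1 one has (1 - h)² = -2h, so (1 - h)^(p+1) evaluates 2^m up to a power of h.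
  module Supplement {h 2′ : Carrier} (hh : h * h ≈ ι (ℤ.- 1ℤ)) (22′ : ι (+ 2) * 2′ ≈ 1#) where

    private
      Z = (ι (+ 2) * - h) ^ m

      square : (1# - h) * (1# - h) ≈ ι (+ 2) * - h
      square = trans (solve 2 (λ h o → (o :- h) :* (o :- h) := con (+ 2) :* (o :* :- h) :+ (h :* h :+ o :* o)) refl h 1#)
        (trans (+-cong (*-congˡ (*-identityˡ (- h))) (trans (+-cong hh (*-identityˡ 1#)) (trans (+-congˡ (sym 1-homo)) (trans (sym (+-homo (ℤ.- 1ℤ) 1ℤ)) 0-homo)))) (+-identityʳ _))

      relation : Z * (ι (+ 2) * - h) ≈ (1# - h) * (1# - h * σ)
      relation = begin
        Z * (ι (+ 2) * - h)                                  ≈⟨ *-cong (^-congˡ m square) square ⟨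
        ((1# - h) * (1# - h)) ^ m * ((1# - h) * (1# - h))    ≈⟨ solve 2 (λ x y → y :* (x :* x) := x :* (x :* y)) refl (1# - h) _ ⟩
        (1# - h) * ((1# - h) * ((1# - h) * (1# - h)) ^ m)    ≈⟨ *-congˡ (frobenius-1- (^-congˡ m hh)) ⟩
        (1# - h) * (1# - h * σ)                              ∎

    even : σ ≈ 1# → Z ≈ 1#
    even σ≈1 = *-cancel-unit (ι (+ 2) * - h) (2′ * h) unit (begin
      Z * (ι (+ 2) * - h)         ≈⟨ relation ⟩
      (1# - h) * (1# - h * σ)     ≈⟨ *-congˡ (+-congˡ (-‿cong (trans (*-congˡ σ≈1) (*-identityʳ h)))) ⟩
      (1# - h) * (1# - h)         ≈⟨ square ⟩
      ι (+ 2) * - h               ≈⟨ *-identityˡ _ ⟨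
      1# * (ι (+ 2) * - h)        ∎)
      where
      unit : ι (+ 2) * - h * (2′ * h) ≈ 1#
      unit = trans (solve 3 (λ x y h → x :* :- h :* (y :* h) := x :* y :* (con (ℤ.- 1ℤ) :* (h :* h))) refl (ι (+ 2)) 2′ h)
        (trans (*-cong 22′ (trans (*-congˡ hh) -1*-1≈1)) (*-identityˡ 1#))

    -- Here 1 - hσ is 1 + h, and (1 - h)(1 + h) = 1 - h² = 2.
    odd : σ ≈ - 1# → Z * - h ≈ 1#
    odd σ≈-1 = *-cancel-unit (ι (+ 2)) 2′ 22′ (begin
      Z * - h * ι (+ 2)             ≈⟨ solve 3 (λ z h t → z :* :- h :* t := z :* (t :* :- h)) refl Z h (ι (+ 2)) ⟩
      Z * (ι (+ 2) * - h)           ≈⟨ relation ⟩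
      (1# - h) * (1# - h * σ)       ≈⟨ *-congˡ (+-congˡ (-‿cong (*-congˡ σ≈-1))) ⟩
      (1# - h) * (1# - h * - 1#)    ≈⟨ ≈-by (ι (ℤ.- 1ℤ)) (solve 1 (λ h → let o = h :^ 0 in
          (o :- h) :* (o :- h :* :- o) := o :* con (+ 2) :+ con (ℤ.- 1ℤ) :* (h :* h :- con (ℤ.- 1ℤ))) refl h) hh ⟩
      1# * ι (+ 2)                  ∎)

  private
    -1^even : ∀ r → ι (ℤ.- 1ℤ) ^ (2 ℕ.* r) ≈ 1#
    -1^even r = trans (square-^ (ι (ℤ.- 1ℤ)) r) (trans (^-congˡ r -1*-1≈1) (1^ r))

  σ-even : ∀ r → m ≡ 2 ℕ.* r → σ ≈ 1#
  σ-even r m≡2r = trans (^-congʳ _ m≡2r) (-1^even r)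

  σ-odd : ∀ r → m ≡ suc (2 ℕ.* r) → σ ≈ - 1#
  σ-odd r m≡1+2r = begin
    σ                                     ≈⟨ ^-congʳ _ m≡1+2r ⟩
    ι (ℤ.- 1ℤ) * ι (ℤ.- 1ℤ) ^ (2 ℕ.* r)   ≈⟨ *-congˡ (-1^even r) ⟩
    ι (ℤ.- 1ℤ) * 1#                       ≈⟨ *-identityʳ _ ⟩
    ι (ℤ.- 1ℤ)                            ≈⟨ -‿homo 1ℤ ⟩
    - ι 1ℤ                                ≈⟨ -‿cong 1-homo ⟩
    - 1#                                  ∎

  infixl 7 _⊛_
  infixl 6 _⊕_ _⊖_

  -- With its two companions this writes a proof in the shape of an integer expression, pushing ι to
  -- the leaves.
  _⊛_ : ∀ {i j x y} → ι i ≈ x → ι j ≈ y → ι (i ℤ.* j) ≈ x * y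
  p ⊛ q = trans (*-homo _ _) (*-cong p q)

  _⊕_ : ∀ {i j x y} → ι i ≈ x → ι j ≈ y → ι (i ℤ.+ j) ≈ x + y
  p ⊕ q = trans (+-homo _ _) (+-cong p q)

  _⊖_ : ∀ {i j x y} → ι i ≈ x → ι j ≈ y → ι (i ℤ.- j) ≈ x - y
  p ⊖ q = trans (+-homo _ _) (+-cong p (trans (-‿homo _) (-‿cong q)))

  module SquareRoot {h : Carrier} {e : ℤ} (hh : h * h ≈ ι e) where

    ι-e^ : ∀ n → ι (e 𝔽.^ n) ≈ (h * h) ^ n
    ι-e^ n = trans (ι-𝔽^ e n) (^-congˡ n (sym hh))

    -- For even m the power h^m is a power of h² = e, so this factor is the image of an integer. For
    -- odd m one more h is attached to reach an even exponent.
    ζ-even : ∀ r → m ≡ 2 ℕ.* r → ι ((+ 2) 𝔽.^ m ℤ.* e 𝔽.^ r) ≈ (ι (+ 2) * h) ^ m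
    ζ-even r m≡2r = begin
      ι ((+ 2) 𝔽.^ m ℤ.* e 𝔽.^ r)   ≈⟨ ι-𝔽^ (+ 2) m ⊛ ι-e^ r ⟩
      ι (+ 2) ^ m * (h * h) ^ r     ≈⟨ *-congˡ (square-^ h r) ⟨
      ι (+ 2) ^ m * h ^ (2 ℕ.* r)   ≈⟨ *-congˡ (^-congʳ h m≡2r) ⟨
      ι (+ 2) ^ m * h ^ m           ≈⟨ ^-distrib-* (ι (+ 2)) h m ⟨
      (ι (+ 2) * h) ^ m             ∎

    ζ-odd : ∀ r → m ≡ suc (2 ℕ.* r) → ι ((+ 2) 𝔽.^ m ℤ.* e 𝔽.^ suc r) ≈ (ι (+ 2) * h) ^ m * h
    ζ-odd r m≡1+2r = begin
      ι ((+ 2) 𝔽.^ m ℤ.* e 𝔽.^ suc r)           ≈⟨ ι-𝔽^ (+ 2) m ⊛ ι-e^ (suc r) ⟩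
      ι (+ 2) ^ m * (h * h * (h * h) ^ r)       ≈⟨ *-congˡ (*-congˡ (square-^ h r)) ⟨
      ι (+ 2) ^ m * (h * h * h ^ (2 ℕ.* r))     ≈⟨ solve 3 (λ t h x → t :* (h :* h :* x) := t :* (h :* x) :* h) refl _ h _ ⟩
      ι (+ 2) ^ m * h ^ suc (2 ℕ.* r) * h       ≈⟨ *-congʳ (*-congˡ (^-congʳ h m≡1+2r)) ⟨
      ι (+ 2) ^ m * h ^ m * h                   ≈⟨ *-congʳ (^-distrib-* (ι (+ 2)) h m) ⟨
      (ι (+ 2) * h) ^ m * h                     ∎

  -- Once both sides are images of integers, an equation in the extension becomes a congruence
  -- modulo p.
  module Descent (ι-injective : ∀ {x y} → ι x ≈ ι y → x 𝔽.≈ y) {h : Carrier} {e : ℤ} (hh : h * h ≈ ι e) where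

    open SquareRoot hh

    module Supplementary {2′ : ℤ} (22′ : + 2 ℤ.* 2′ 𝔽.≈ 1ℤ) (e≡-1 : e ≡ ℤ.- 1ℤ) where

      private
        module S = Supplement (trans hh (reflexive (cong ι e≡-1))) (trans (sym (*-homo (+ 2) 2′)) (trans (ι-cong 22′) 1-homo))
        -- `Supplement` evaluates the power of 2 times -h, so -h is taken as the square root of e.
        module N = SquareRoot {h = - h} (trans (neg-square h) hh)

      -- The second supplementary law, before 2^m is read as a symbol: the symbol of 2 is (-1)^r for
      -- p = 4r + 1, and (-1)^(r+1) for p = 4r + 3 in the companion.
      2^m-even : ∀ r → m ≡ 2 ℕ.* r → (+ 2) 𝔽.^ m ℤ.* e 𝔽.^ r 𝔽.≈ 1ℤ
      2^m-even r m≡2r = ι-injective (trans (N.ζ-even r m≡2r) (trans (S.even (σ-even r m≡2r)) (sym 1-homo)))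

      2^m-odd : ∀ r → m ≡ suc (2 ℕ.* r) → (+ 2) 𝔽.^ m ℤ.* e 𝔽.^ suc r 𝔽.≈ 1ℤ
      2^m-odd r m≡1+2r = ι-injective (trans (N.ζ-odd r m≡1+2r) (trans (S.odd (σ-odd r m≡1+2r)) (sym 1-homo)))

    module Sums {e′ 8′ t : ℤ} (ee′ : e ℤ.* e′ 𝔽.≈ 1ℤ) (88′ : + 8 ℤ.* 8′ 𝔽.≈ 1ℤ)
                (ε² : e 𝔽.^ m ℤ.* e 𝔽.^ m 𝔽.≈ 1ℤ)
                (t≈ : t 𝔽.≈ (1ℤ ℤ.+ e) ℤ.* (1ℤ ℤ.+ e) ℤ.* e′ ℤ.* (8′ ℤ.* 8′)) where

      private
        -- `h * ι e′` is the inverse of h, so v is (1 + e)/(8h).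
        v = ι (1ℤ ℤ.+ e) * (h * ι e′) * ι 8′

        ι-unit : ∀ {x x′} → x ℤ.* x′ 𝔽.≈ 1ℤ → ι x * ι x′ ≈ 1#
        ι-unit {x} {x′} xx′ = trans (sym (*-homo x x′)) (trans (ι-cong xx′) 1-homo)

        1+e : ι (1ℤ ℤ.+ e) ≈ 1# + h * h
        1+e = 1-homo ⊕ sym hh

        hh′ : h * (h * ι e′) ≈ 1#
        hh′ = trans (sym (*-assoc h h (ι e′))) (trans (*-congʳ hh) (ι-unit ee′))

        8hv : ι (+ 8) * h * v ≈ 1# + h * h
        8hv = begin
          ι (+ 8) * h * (ι (1ℤ ℤ.+ e) * (h * ι e′) * ι 8′)
            ≈⟨ solve 5 (λ a h b x y → a :* h :* (b :* (h :* x) :* y) := b :* (h :* (h :* x)) :* (a :* y)) refl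
                 (ι (+ 8)) h (ι (1ℤ ℤ.+ e)) (ι e′) (ι 8′) ⟩
          ι (1ℤ ℤ.+ e) * (h * (h * ι e′)) * (ι (+ 8) * ι 8′)  ≈⟨ *-cong (*-cong 1+e hh′) (ι-unit 88′) ⟩
          (1# + h * h) * 1# * 1#                              ≈⟨ trans (*-identityʳ _) (*-identityʳ _) ⟩
          1# + h * h                                          ∎

        vv : ι t ≈ v * v
        vv = begin
          ι t                                     ≈⟨ ι-cong t≈ ⟩
          ι ((1ℤ ℤ.+ e) ℤ.* (1ℤ ℤ.+ e) ℤ.* e′ ℤ.* (8′ ℤ.* 8′))
                                                  ≈⟨ refl ⊛ refl ⊛ refl ⊛ (refl ⊛ refl) ⟩
          -- The single inverse of e becomes the square of h/e by inserting 1 = h · (h/e).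
          u * u * ι e′ * (ι 8′ * ι 8′)            ≈⟨ *-congʳ (*-congˡ (*-identityˡ (ι e′))) ⟨
          u * u * (1# * ι e′) * (ι 8′ * ι 8′)     ≈⟨ *-congʳ (*-congˡ (*-congʳ hh′)) ⟨
          u * u * (h * (h * ι e′) * ι e′) * (ι 8′ * ι 8′)
            ≈⟨ solve 4 (λ u h x y → u :* u :* (h :* (h :* x) :* x) :* (y :* y) :=
                 u :* (h :* x) :* y :* (u :* (h :* x) :* y)) refl u h (ι e′) (ι 8′) ⟩
          v * v                                   ∎
          where u = ι (1ℤ ℤ.+ e)

        ε = ι (e 𝔽.^ m)

        open Formula {h} {v} {ε} (sym (ι-e^ m)) (ι-unit ε²) 8hv
        open Units {h * ι e′} {ι (+ 4) * ι 8′} hh′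
          (trans (sym (*-assoc _ _ _)) (trans (*-congʳ (sym (*-homo (+ 2) (+ 4)))) (ι-unit 88′)))

        ι-central∑ : ι (𝔽.central∑ t) ≈ evenSum (v * v)
        ι-central∑ = trans (ι-∑ p _) (∑-cong p λ {k} _ →
          trans (*-homo _ _) (*-congˡ (trans (ι-𝔽^ t k) (^-congˡ k vv))))

        ι-catalan∑ : ι (𝔽.catalan∑ t) ≈ catalanSum (v * v)
        ι-catalan∑ = trans (ι-∑ p _) (∑-cong p λ {k} _ →
          trans (*-homo _ _) (*-congˡ (trans (ι-𝔽^ t k) (^-congˡ k vv))))

        3-e : ι (+ 3 ℤ.- e) ≈ ι (+ 3) - h * h
        3-e = refl ⊖ sym hh

        3*e-1 : ι (+ 3 ℤ.* e ℤ.- 1ℤ) ≈ ι (+ 3) * (h * h) - 1#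
        3*e-1 = refl ⊛ sym hh ⊖ 1-homo

      module _ r (m≡2r : m ≡ 2 ℕ.* r) where

        central∑-even : + 4 ℤ.* ((+ 2) 𝔽.^ m ℤ.* e 𝔽.^ r) ℤ.* (1ℤ ℤ.- e) ℤ.* 𝔽.central∑ t 𝔽.≈
                        (+ 3 ℤ.- e) ℤ.- (+ 3 ℤ.* e ℤ.- 1ℤ) ℤ.* e 𝔽.^ m
        central∑-even = ι-injective (trans (refl ⊛ ζ-even r m≡2r ⊛ (1-homo ⊖ sym hh) ⊛ ι-central∑)
          (trans (evenSum-even (σ-even r m≡2r)) (sym (3-e ⊖ 3*e-1 ⊛ refl))))

        catalan∑-even : + 2 ℤ.* ((+ 2) 𝔽.^ m ℤ.* e 𝔽.^ r) ℤ.* (1ℤ ℤ.+ e) ℤ.* 𝔽.catalan∑ t 𝔽.≈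
                        (+ 3 ℤ.- e) ℤ.+ (+ 3 ℤ.* e ℤ.- 1ℤ) ℤ.* e 𝔽.^ m
        catalan∑-even = ι-injective (trans (refl ⊛ ζ-even r m≡2r ⊛ 1+e ⊛ ι-catalan∑)
          (trans (catalanSum-even (σ-even r m≡2r)) (sym (3-e ⊕ 3*e-1 ⊛ refl))))

      module _ r (m≡1+2r : m ≡ suc (2 ℕ.* r)) where

        central∑-odd : + 4 ℤ.* ((+ 2) 𝔽.^ m ℤ.* e 𝔽.^ suc r) ℤ.* (1ℤ ℤ.- e) ℤ.* 𝔽.central∑ t 𝔽.≈
                       (+ 3 ℤ.* e ℤ.- 1ℤ) ℤ.* e 𝔽.^ m ℤ.- e ℤ.* (+ 3 ℤ.- e)
        central∑-odd = ι-injective (trans (refl ⊛ ζ-odd r m≡1+2r ⊛ (1-homo ⊖ sym hh) ⊛ ι-central∑)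
          (trans (evenSum-odd (σ-odd r m≡1+2r)) (sym (3*e-1 ⊛ refl ⊖ sym hh ⊛ 3-e))))

        catalan∑-odd : + 2 ℤ.* ((+ 2) 𝔽.^ m ℤ.* e 𝔽.^ suc r) ℤ.* (1ℤ ℤ.+ e) ℤ.* 𝔽.catalan∑ t 𝔽.≈
                       (+ 3 ℤ.* e ℤ.- 1ℤ) ℤ.* e 𝔽.^ m ℤ.+ e ℤ.* (+ 3 ℤ.- e)
        catalan∑-odd = ι-injective (trans (refl ⊛ ζ-odd r m≡1+2r ⊛ 1+e ⊛ ι-catalan∑)
          (trans (catalanSum-odd (σ-odd r m≡1+2r)) (sym (3*e-1 ⊛ refl ⊕ sym hh ⊛ 3-e))))

-- Adjoining a square root to a commutative ring.

module AdjoinSquareRoot {r ℓ} (R : CommutativeRing r ℓ)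
    (φ : ℤ.+-*-rawRing -Raw-AlmostCommutative⟶ fromCommutativeRing R) (d : CommutativeRing.Carrier R) where

  open IntegerAlgebra R φ

  private
    E : Set r
    E = Carrier × Carrier

    _≋_ : E → E → Set ℓ
    (x , y) ≋ (z , w) = (x ≈ z) × (y ≈ w)

    _⊞_ _⊠_ : E → E → E
    (x , y) ⊞ (z , w) = (x + z) , (y + w)
    (x , y) ⊠ (z , w) = (x * z + d * (y * w)) , (x * w + y * z)

    ⊟_ : E → E
    ⊟ (x , y) = - x , - y

    *-comm′ : ∀ x y → (x ⊠ y) ≋ (y ⊠ x)
    *-comm′ (x , y) (z , w) =
      solve 5 (λ d x y z w → x :* z :+ d :* (y :* w) := z :* x :+ d :* (w :* y)) refl d x y z w ,
      solve 4 (λ x y z w → x :* w :+ y :* z := z :* y :+ w :* x) refl x y z w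

    *-identityˡ′ : ∀ x → ((1# , 0#) ⊠ x) ≋ x
    *-identityˡ′ (x , y) =
      trans (+-cong (*-identityˡ x) (trans (*-congˡ (zeroˡ y)) (zeroʳ d))) (+-identityʳ x) ,
      trans (+-cong (*-identityˡ y) (zeroˡ x)) (+-identityʳ y)

    distribˡ′ : ∀ x y z → (x ⊠ (y ⊞ z)) ≋ ((x ⊠ y) ⊞ (x ⊠ z))
    distribˡ′ (x , y) (z , w) (u , v) =
      solve 7 (λ d x y z w u v → x :* (z :+ u) :+ d :* (y :* (w :+ v)) :=
        x :* z :+ d :* (y :* w) :+ (x :* u :+ d :* (y :* v))) refl d x y z w u v ,
      solve 6 (λ x y z w u v → x :* (w :+ v) :+ y :* (z :+ u) :=
        x :* w :+ y :* z :+ (x :* v :+ y :* u)) refl x y z w u v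

    ≋-trans : ∀ {x y z} → x ≋ y → y ≋ z → x ≋ z
    ≋-trans (p , q) (p′ , q′) = trans p p′ , trans q q′

    ⊞-cong : ∀ {x y u v} → x ≋ y → u ≋ v → (x ⊞ u) ≋ (y ⊞ v)
    ⊞-cong (p , q) (p′ , q′) = +-cong p p′ , +-cong q q′

    distribʳ′ : ∀ x y z → ((y ⊞ z) ⊠ x) ≋ ((y ⊠ x) ⊞ (z ⊠ x))
    distribʳ′ x y z = ≋-trans (*-comm′ (y ⊞ z) x) (≋-trans (distribˡ′ x y z) (⊞-cong (*-comm′ x y) (*-comm′ x z)))

  -- The ring R[X]/(X² - d), with (x , y) for x + y√d. Nothing is assumed about d; R embeds through
  -- the first coordinate even when d is a square.
  R[√d] : CommutativeRing r ℓ
  R[√d] = record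
    { Carrier = E ; _≈_ = _≋_ ; _+_ = _⊞_ ; _*_ = _⊠_ ; -_ = ⊟_ ; 0# = 0# , 0# ; 1# = 1# , 0#
    ; isCommutativeRing = record
      { isRing = record
        { +-isAbelianGroup = record
          { isGroup = record
            { isMonoid = record
              { isSemigroup = record
                { isMagma = record
                  { isEquivalence = record
                    { refl = refl , refl
                    ; sym = λ (p , q) → sym p , sym q
                    ; trans = ≋-trans
                    }
                  ; ∙-cong = ⊞-cong
                  }
                ; assoc = λ (x , y) (z , w) (u , v) → +-assoc x z u , +-assoc y w v
                }
              ; identity = (λ (x , y) → +-identityˡ x , +-identityˡ y) , (λ (x , y) → +-identityʳ x , +-identityʳ y)
              }
            ; inverse = (λ (x , y) → -‿inverseˡ x , -‿inverseˡ y) , (λ (x , y) → -‿inverseʳ x , -‿inverseʳ y)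
            ; ⁻¹-cong = λ (p , q) → -‿cong p , -‿cong q
            }
          ; comm = λ (x , y) (z , w) → +-comm x z , +-comm y w
          }
        ; *-cong = λ (p , q) (p′ , q′) → +-cong (*-cong p p′) (*-congˡ (*-cong q q′)) , +-cong (*-cong p q′) (*-cong q p′)
        ; *-assoc = λ (x , y) (z , w) (u , v) →
            solve 7 (λ d x y z w u v → (x :* z :+ d :* (y :* w)) :* u :+ d :* ((x :* w :+ y :* z) :* v) :=
              x :* (z :* u :+ d :* (w :* v)) :+ d :* (y :* (z :* v :+ w :* u))) refl d x y z w u v ,
            solve 7 (λ d x y z w u v → (x :* z :+ d :* (y :* w)) :* v :+ (x :* w :+ y :* z) :* u :=
              x :* (z :* v :+ w :* u) :+ y :* (z :* u :+ d :* (w :* v))) refl d x y z w u v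
        ; *-identity = *-identityˡ′ , λ x → ≋-trans (*-comm′ x (1# , 0#)) (*-identityˡ′ x)
        ; distrib = distribˡ′ , distribʳ′
        }
      ; *-comm = *-comm′
      }
    }

  inclusion : ℤ.+-*-rawRing -Raw-AlmostCommutative⟶ fromCommutativeRing R[√d]
  inclusion = record
    { ⟦_⟧ = λ i → ι i , 0#
    ; +-homo = λ i j → +-homo i j , sym (+-identityˡ 0#)
    ; *-homo = λ i j →
        trans (*-homo i j) (sym (trans (+-congˡ (trans (*-congˡ (zeroˡ 0#)) (zeroʳ d))) (+-identityʳ _))) ,
        sym (trans (+-cong (zeroʳ (ι i)) (zeroˡ (ι j))) (+-identityˡ 0#))
    ; -‿homo = λ i → -‿homo i , sym (trans (sym (+-identityˡ (- 0#))) (-‿inverseʳ 0#))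
    ; 0-homo = 0-homo , refl
    ; 1-homo = 1-homo , refl
    }

  √d : E
  √d = 0# , 1#

  √d-square : (√d ⊠ √d) ≋ (d , 0#)
  √d-square = trans (+-cong (zeroˡ 0#) (trans (*-congˡ (*-identityˡ 1#)) (*-identityʳ d))) (+-identityˡ d) ,
              trans (+-cong (zeroˡ 1#) (zeroʳ 1#)) (+-identityˡ 0#)

-- From the ratio c/a back to a and c, and solving for the sum.

module Elimination {r ℓ} (R : CommutativeRing r ℓ)
    (φ : ℤ.+-*-rawRing -Raw-AlmostCommutative⟶ fromCommutativeRing R) where

  open IntegerAlgebra R φ

  -- Clears e = c/a by multiplying with a·a^m, or with a²·a^m when m is odd. A, C, Eₘ stand for the
  -- m-th powers of a, c, e, and Eᵣ for the power of e that accompanies 2^m.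
  module Homogenise {a c e A C Eₘ : Carrier} (ea : e * a ≈ c) (EA : Eₘ * A ≈ C) where

    module Even {Eᵣ q : Carrier} (EᵣA : Eᵣ * A ≈ q) where

      central-even : ∀ {κ s} → ι (+ 4) * (κ * Eᵣ) * (1# - e) * s ≈ (ι (+ 3) - e) - (ι (+ 3) * e - 1#) * Eₘ →
        ι (+ 4) * (a - c) * (κ * q) * s ≈ (ι (+ 3) * a - c) * A - (ι (+ 3) * c - a) * C
      central-even {κ} {s} eq = begin
        ι (+ 4) * (a - c) * (κ * q) * s               ≈⟨ *-congʳ (*-cong (*-congˡ (+-congˡ (-‿cong ea))) (*-congˡ EᵣA)) ⟨
        ι (+ 4) * (a - e * a) * (κ * (Eᵣ * A)) * s
          ≈⟨ solve 6 (λ a e κ E A s → con (+ 4) :* (a :- e :* a) :* (κ :* (E :* A)) :* s :=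
               con (+ 4) :* (κ :* E) :* (a :^ 0 :- e) :* s :* (a :* A)) refl a e κ Eᵣ A s ⟩
        ι (+ 4) * (κ * Eᵣ) * (1# - e) * s * (a * A)   ≈⟨ *-congʳ eq ⟩
        ((ι (+ 3) - e) - (ι (+ 3) * e - 1#) * Eₘ) * (a * A)
          ≈⟨ solve 4 (λ a e A E → ((con (+ 3) :- e) :- (con (+ 3) :* e :- a :^ 0) :* E) :* (a :* A) :=
               (con (+ 3) :* a :- e :* a) :* A :- (con (+ 3) :* (e :* a) :- a) :* (E :* A)) refl a e A Eₘ ⟩
        (ι (+ 3) * a - e * a) * A - (ι (+ 3) * (e * a) - a) * (Eₘ * A)
          ≈⟨ +-cong (*-congʳ (+-congˡ (-‿cong ea))) (-‿cong (*-cong (+-congʳ (*-congˡ ea)) EA)) ⟩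
        (ι (+ 3) * a - c) * A - (ι (+ 3) * c - a) * C ∎

      catalan-even : ∀ {κ s} → ι (+ 2) * (κ * Eᵣ) * (1# + e) * s ≈ (ι (+ 3) - e) + (ι (+ 3) * e - 1#) * Eₘ →
        ι (+ 2) * (a + c) * (κ * q) * s ≈ (ι (+ 3) * a - c) * A + (ι (+ 3) * c - a) * C
      catalan-even {κ} {s} eq = begin
        ι (+ 2) * (a + c) * (κ * q) * s               ≈⟨ *-congʳ (*-cong (*-congˡ (+-congˡ ea)) (*-congˡ EᵣA)) ⟨
        ι (+ 2) * (a + e * a) * (κ * (Eᵣ * A)) * s
          ≈⟨ solve 6 (λ a e κ E A s → con (+ 2) :* (a :+ e :* a) :* (κ :* (E :* A)) :* s :=
               con (+ 2) :* (κ :* E) :* (a :^ 0 :+ e) :* s :* (a :* A)) refl a e κ Eᵣ A s ⟩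
        ι (+ 2) * (κ * Eᵣ) * (1# + e) * s * (a * A)   ≈⟨ *-congʳ eq ⟩
        ((ι (+ 3) - e) + (ι (+ 3) * e - 1#) * Eₘ) * (a * A)
          ≈⟨ solve 4 (λ a e A E → ((con (+ 3) :- e) :+ (con (+ 3) :* e :- a :^ 0) :* E) :* (a :* A) :=
               (con (+ 3) :* a :- e :* a) :* A :+ (con (+ 3) :* (e :* a) :- a) :* (E :* A)) refl a e A Eₘ ⟩
        (ι (+ 3) * a - e * a) * A + (ι (+ 3) * (e * a) - a) * (Eₘ * A)
          ≈⟨ +-cong (*-congʳ (+-congˡ (-‿cong ea))) (*-cong (+-congʳ (*-congˡ ea)) EA) ⟩
        (ι (+ 3) * a - c) * A + (ι (+ 3) * c - a) * C ∎

    module Odd {Eᵣ q : Carrier} (EᵣA : Eᵣ * (A * a) ≈ q) where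

      central-odd : ∀ {κ s} → ι (+ 4) * (κ * Eᵣ) * (1# - e) * s ≈ (ι (+ 3) * e - 1#) * Eₘ - e * (ι (+ 3) - e) →
        ι (+ 4) * (a - c) * (κ * q) * s ≈ (ι (+ 3) * c - a) * a * C - c * (ι (+ 3) * a - c) * A
      central-odd {κ} {s} eq = begin
        ι (+ 4) * (a - c) * (κ * q) * s               ≈⟨ *-congʳ (*-cong (*-congˡ (+-congˡ (-‿cong ea))) (*-congˡ EᵣA)) ⟨
        ι (+ 4) * (a - e * a) * (κ * (Eᵣ * (A * a))) * s
          ≈⟨ solve 6 (λ a e κ E A s → con (+ 4) :* (a :- e :* a) :* (κ :* (E :* (A :* a))) :* s :=
               con (+ 4) :* (κ :* E) :* (a :^ 0 :- e) :* s :* (a :* a :* A)) refl a e κ Eᵣ A s ⟩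
        ι (+ 4) * (κ * Eᵣ) * (1# - e) * s * (a * a * A)   ≈⟨ *-congʳ eq ⟩
        ((ι (+ 3) * e - 1#) * Eₘ - e * (ι (+ 3) - e)) * (a * a * A)
          ≈⟨ solve 4 (λ a e A E → ((con (+ 3) :* e :- a :^ 0) :* E :- e :* (con (+ 3) :- e)) :* (a :* a :* A) :=
               (con (+ 3) :* (e :* a) :- a) :* a :* (E :* A) :- e :* a :* (con (+ 3) :* a :- e :* a) :* A) refl a e A Eₘ ⟩
        (ι (+ 3) * (e * a) - a) * a * (Eₘ * A) - e * a * (ι (+ 3) * a - e * a) * A
          ≈⟨ +-cong (*-cong (*-congʳ (+-congʳ (*-congˡ ea))) EA) (-‿cong (*-congʳ (*-cong ea (+-congˡ (-‿cong ea))))) ⟩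
        (ι (+ 3) * c - a) * a * C - c * (ι (+ 3) * a - c) * A ∎

      catalan-odd : ∀ {κ s} → ι (+ 2) * (κ * Eᵣ) * (1# + e) * s ≈ (ι (+ 3) * e - 1#) * Eₘ + e * (ι (+ 3) - e) →
        ι (+ 2) * (a + c) * (κ * q) * s ≈ (ι (+ 3) * c - a) * a * C + c * (ι (+ 3) * a - c) * A
      catalan-odd {κ} {s} eq = begin
        ι (+ 2) * (a + c) * (κ * q) * s               ≈⟨ *-congʳ (*-cong (*-congˡ (+-congˡ ea)) (*-congˡ EᵣA)) ⟨
        ι (+ 2) * (a + e * a) * (κ * (Eᵣ * (A * a))) * s
          ≈⟨ solve 6 (λ a e κ E A s → con (+ 2) :* (a :+ e :* a) :* (κ :* (E :* (A :* a))) :* s :=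
               con (+ 2) :* (κ :* E) :* (a :^ 0 :+ e) :* s :* (a :* a :* A)) refl a e κ Eᵣ A s ⟩
        ι (+ 2) * (κ * Eᵣ) * (1# + e) * s * (a * a * A)   ≈⟨ *-congʳ eq ⟩
        ((ι (+ 3) * e - 1#) * Eₘ + e * (ι (+ 3) - e)) * (a * a * A)
          ≈⟨ solve 4 (λ a e A E → ((con (+ 3) :* e :- a :^ 0) :* E :+ e :* (con (+ 3) :- e)) :* (a :* a :* A) :=
               (con (+ 3) :* (e :* a) :- a) :* a :* (E :* A) :+ e :* a :* (con (+ 3) :* a :- e :* a) :* A) refl a e A Eₘ ⟩
        (ι (+ 3) * (e * a) - a) * a * (Eₘ * A) + e * a * (ι (+ 3) * a - e * a) * A
          ≈⟨ +-cong (*-cong (*-congʳ (+-congʳ (*-congˡ ea))) EA) (*-congʳ (*-cong ea (+-congˡ (-‿cong ea)))) ⟩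
        (ι (+ 3) * c - a) * a * C + c * (ι (+ 3) * a - c) * A ∎

  module _ {A B κ D D′ s P Q : Carrier} (AA : A * A ≈ 1#) (BB : B * B ≈ 1#) (κκ : κ * κ ≈ 1#) where

    -- A, B and κ are their own inverses and q² = AB, so 1/q = qAB. Multiplication by AB exchanges A
    -- and B, which is why the symbol of b ends up with the coefficient P that first belonged to a.
    eliminate-even : ∀ {q} → q * q ≈ A * B → D * D′ ≈ 1# → D * (κ * q) * s ≈ P * A - Q * B →
                     s ≈ κ * q * D′ * (P * B - Q * A)
    eliminate-even {q} qq DD′ eq = begin
      s
        ≈⟨ ≈-by (- s) (solve 2 (λ s x → s := x :* s :+ :- s :* (x :- s :^ 0)) refl s (A * A * (B * B) * (κ * κ) * (D * D′)))
             (trans (*-cong (*-cong (*-cong AA BB) κκ) DD′) (trans (*-identityʳ _) (trans (*-identityʳ _) (*-identityʳ _)))) ⟩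
      A * A * (B * B) * (κ * κ) * (D * D′) * s
        ≈⟨ solve 6 (λ A B κ D E s → A :* A :* (B :* B) :* (κ :* κ) :* (D :* E) :* s :=
             A :* B :* ((A :* B) :* κ :* E :* (D :* κ :* s))) refl A B κ D D′ s ⟩
      A * B * (A * B * κ * D′ * (D * κ * s))
        ≈⟨ *-congˡ (*-congʳ (*-congʳ (*-congʳ qq))) ⟨
      A * B * (q * q * κ * D′ * (D * κ * s))
        ≈⟨ solve 7 (λ A B κ q D E s → A :* B :* (q :* q :* κ :* E :* (D :* κ :* s)) :=
             A :* B :* (κ :* q :* E :* (D :* (κ :* q) :* s))) refl A B κ q D D′ s ⟩
      A * B * (κ * q * D′ * (D * (κ * q) * s))
        ≈⟨ *-congˡ (*-congˡ eq) ⟩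
      A * B * (κ * q * D′ * (P * A - Q * B))
        ≈⟨ solve 5 (λ A B X P Q → A :* B :* (X :* (P :* A :- Q :* B)) :=
             X :* (P :* B :* (A :* A) :- Q :* A :* (B :* B))) refl A B (κ * q * D′) P Q ⟩
      κ * q * D′ * (P * B * (A * A) - Q * A * (B * B))
        ≈⟨ *-congˡ (+-cong (trans (*-congˡ AA) (*-identityʳ _)) (-‿cong (trans (*-congˡ BB) (*-identityʳ _)))) ⟩
      κ * q * D′ * (P * B - Q * A) ∎

    -- As in the even case, but q² = AB·ab, so 1/q = qAB/(ab); this produces the divisions by a and
    -- b. The sign in `- D * D′` accounts for the denominator b - a.
    eliminate-odd : ∀ {a b a′ b′ q} → a * a′ ≈ 1# → b * b′ ≈ 1# → q * q ≈ A * B * (a * b) → - D * D′ ≈ 1# →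
                    D * (κ * q) * s ≈ Q * a * B - b * P * A → s ≈ κ * q * D′ * (P * a′ * B - Q * b′ * A)
    eliminate-odd {a} {b} {a′} {b′} {q} aa′ bb′ qq DD′ eq = begin
      s
        ≈⟨ ≈-by (- s) (solve 2 (λ s x → s := x :* s :+ :- s :* (x :- s :^ 0)) refl s (A * A * (B * B) * (κ * κ) * (- D * D′) * ((a * a′) * (b * b′))))
             (trans (*-cong (*-cong (*-cong (*-cong AA BB) κκ) DD′) (*-cong aa′ bb′))
               (trans (*-cong (trans (*-identityʳ _) (trans (*-identityʳ _) (*-identityʳ _))) (*-identityʳ _)) (*-identityʳ _))) ⟩
      A * A * (B * B) * (κ * κ) * (- D * D′) * ((a * a′) * (b * b′)) * s
        ≈⟨ solve 10 (λ A B κ D E s a b x y → A :* A :* (B :* B) :* (κ :* κ) :* (:- D :* E) :* ((a :* x) :* (b :* y)) :* s :=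
             :- (A :* B :* (x :* y) :* (A :* B :* (a :* b) :* κ :* E :* (D :* κ :* s)))) refl A B κ D D′ s a b a′ b′ ⟩
      - (A * B * (a′ * b′) * (A * B * (a * b) * κ * D′ * (D * κ * s)))
        ≈⟨ -‿cong (*-congˡ (*-congʳ (*-congʳ (*-congʳ qq)))) ⟨
      - (A * B * (a′ * b′) * (q * q * κ * D′ * (D * κ * s)))
        ≈⟨ -‿cong (*-congˡ (solve 5 (λ κ q D E s → q :* q :* κ :* E :* (D :* κ :* s) :=
             κ :* q :* E :* (D :* (κ :* q) :* s)) refl κ q D D′ s)) ⟩
      - (A * B * (a′ * b′) * (κ * q * D′ * (D * (κ * q) * s)))
        ≈⟨ -‿cong (*-congˡ (*-congˡ eq)) ⟩
      - (A * B * (a′ * b′) * (κ * q * D′ * (Q * a * B - b * P * A)))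
        ≈⟨ solve 9 (λ A B X P Q a b x y → :- (A :* B :* (x :* y) :* (X :* (Q :* a :* B :- b :* P :* A))) :=
             X :* (P :* x :* B :* ((A :* A) :* (b :* y)) :- Q :* y :* A :* ((B :* B) :* (a :* x)))) refl A B (κ * q * D′) P Q a b a′ b′ ⟩
      κ * q * D′ * (P * a′ * B * ((A * A) * (b * b′)) - Q * b′ * A * ((B * B) * (a * a′)))
        ≈⟨ *-congˡ (+-cong (trans (*-congˡ (trans (*-cong AA bb′) (*-identityʳ 1#))) (*-identityʳ _))
                           (-‿cong (trans (*-congˡ (trans (*-cong BB aa′) (*-identityʳ 1#))) (*-identityʳ _)))) ⟩
      κ * q * D′ * (P * a′ * B - Q * b′ * A) ∎

-- Roots of polynomials modulo p and Euler's criterion.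

eval : List ℤ → ℤ → ℤ
eval []       x = 0ℤ
eval (c ∷ cs) x = c ℤ.+ x ℤ.* eval cs x

-- Synthetic division by X - r: each coefficient of the quotient is the value at r of a tail. The
-- constant coefficient of the dividend does not influence the quotient and is left out of the
-- argument.
quotientBy : ℤ → List ℤ → List ℤ
quotientBy r []       = []
quotientBy r (c ∷ cs) = eval (c ∷ cs) r ∷ quotientBy r cs

eval-quotientBy : ∀ r c cs x → eval (c ∷ cs) x ≡ eval (c ∷ cs) r ℤ.+ (x ℤ.- r) ℤ.* eval (quotientBy r cs) x
eval-quotientBy r c []       x = base c x r
  where
  base : ∀ c x r → c ℤ.+ x ℤ.* 0ℤ ≡ c ℤ.+ r ℤ.* 0ℤ ℤ.+ (x ℤ.- r) ℤ.* 0ℤ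
  base = solve-∀
eval-quotientBy r c (d ∷ cs) x = ≡.trans (cong (λ z → c ℤ.+ x ℤ.* z) (eval-quotientBy r d cs x))
    (step c x r (eval (d ∷ cs) r) (eval (quotientBy r cs) x))
  where
  step : ∀ c x r E Q → c ℤ.+ x ℤ.* (E ℤ.+ (x ℤ.- r) ℤ.* Q) ≡ c ℤ.+ r ℤ.* E ℤ.+ (x ℤ.- r) ℤ.* (E ℤ.+ x ℤ.* Q)
  step = solve-∀

length-quotientBy : ∀ r cs → length (quotientBy r cs) ≡ length cs
length-quotientBy r []       = ≡.refl
length-quotientBy r (c ∷ cs) = cong suc (length-quotientBy r cs)

X^ : ℕ → List ℤ
X^ zero    = 1ℤ ∷ []
X^ (suc n) = 0ℤ ∷ X^ n

length-X^ : ∀ n → length (X^ n) ≡ suc n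
length-X^ zero    = ≡.refl
length-X^ (suc n) = cong suc (length-X^ n)

eval-X^ : ∀ n x → eval (X^ n) x ≡ x ℤ.^ n
eval-X^ zero    x = cong (ℤ._+_ 1ℤ) (ℤₚ.*-zeroʳ x)
eval-X^ (suc n) x = ≡.trans (ℤₚ.+-identityˡ _) (cong (x ℤ.*_) (eval-X^ n x))

-- The outcomes of the Boolean search in `legendre` as propositions, so that Euler's criterion can
-- be argued by cases.
data LegendreView (a : ℤ) (p : ℕ) .{{_ : ℕ.NonZero p}} : ℤ → Set where
  divisible  : a ℤ.%ℕ p ≡ 0 → LegendreView a p 0ℤ
  residue    : ∀ x → (x ℕ.* x) ℕ.% p ≡ a ℤ.%ℕ p → LegendreView a p 1ℤ
  nonresidue : (∀ {x} → x < p → ¬ (x ℕ.* x) ℕ.% p ≡ a ℤ.%ℕ p) → LegendreView a p (ℤ.- 1ℤ)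

legendreView : ∀ a n → LegendreView a (suc n) (legendre a (suc n))
legendreView a n with a ℤ.%ℕ suc n in eq
... | zero  = divisible eq
... | suc r with any (λ x → ((x ℕ.* x) ℕ.% suc n) ℕ.≡ᵇ suc r) (upTo (suc n)) in found
...   | true with x , x²≡r ← satisfied (any⁻ (λ x → ((x ℕ.* x) ℕ.% suc n) ℕ.≡ᵇ suc r) (upTo (suc n)) (subst T (≡.sym found) _))
        = residue x (≡.trans (ℕₚ.≡ᵇ⇒≡ _ _ x²≡r) (≡.sym eq))
...   | false = nonresidue λ {x} x<p x²≡a → subst T found
          (any⁺ (λ x → ((x ℕ.* x) ℕ.% suc n) ℕ.≡ᵇ suc r) (lose (∈-upTo⁺ x<p) (ℕₚ.≡⇒≡ᵇ _ _ (≡.trans x²≡a eq))))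

module EulerCriterion {p : ℕ} (pp : Prime p) {m : ℕ} (p≡1+2m : p ≡ suc (2 ℕ.* m)) where

  open PrimeField pp

  -- Dividing by X - r shortens the list of coefficients by one, and every other root s remains a
  -- root of the quotient because s - r is nonzero. Coefficients are counted, one more than the
  -- formal degree.
  too-many-roots : ∀ cs rs → length cs ≤ length rs → AllPairs (λ r s → ¬ r ≈ s) rs →
                   All (λ r → eval cs r ≈ 0ℤ) rs → ∀ x → eval cs x ≈ 0ℤ
  too-many-roots []       rs       len distinct roots x = refl
  too-many-roots (c ∷ cs) (r ∷ rs) (s≤s len) (r≉rs ∷ distinct) (root ∷ roots) x = begin
    eval (c ∷ cs) x                                               ≡⟨ eval-quotientBy r c cs x ⟩
    eval (c ∷ cs) r + (x ℤ.- r) * eval (quotientBy r cs) x        ≈⟨ +-cong root (*-congˡ {x ℤ.- r} (quotient-vanishes x)) ⟩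
    0ℤ + (x ℤ.- r) * 0ℤ                                           ≡⟨ cong (ℤ._+_ 0ℤ) (ℤₚ.*-zeroʳ (x ℤ.- r)) ⟩
    0ℤ                                                            ∎
    where
    quotient-root : ∀ {s} → ¬ r ≈ s → eval (c ∷ cs) s ≈ 0ℤ → eval (quotientBy r cs) s ≈ 0ℤ
    quotient-root {s} r≉s s-root = *-cancelˡ (s ℤ.- r) (λ eq → r≉s (sym (x-y≈0⇒x≈y eq))) (begin
      (s ℤ.- r) * eval (quotientBy r cs) s                        ≡⟨ ℤₚ.+-identityˡ _ ⟨
      0ℤ + (s ℤ.- r) * eval (quotientBy r cs) s                   ≈⟨ +-congʳ {(s ℤ.- r) * eval (quotientBy r cs) s} root ⟨
      eval (c ∷ cs) r + (s ℤ.- r) * eval (quotientBy r cs) s      ≡⟨ eval-quotientBy r c cs s ⟨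
      eval (c ∷ cs) s                                             ≈⟨ s-root ⟩
      0ℤ                                                          ≡⟨ ℤₚ.*-zeroʳ (s ℤ.- r) ⟨
      (s ℤ.- r) * 0ℤ                                              ∎)
    quotient-vanishes : ∀ x → eval (quotientBy r cs) x ≈ 0ℤ
    quotient-vanishes = too-many-roots (quotientBy r cs) rs (subst (_≤ length rs) (≡.sym (length-quotientBy r cs)) len)
      distinct (All.zipWith (λ (r≉s , s-root) → quotient-root r≉s s-root) (r≉rs , roots))

  2m<p : 2 ℕ.* m < p
  2m<p = subst (2 ℕ.* m <_) (≡.sym p≡1+2m) (ℕₚ.n<1+n _)

  unit-^m : ∀ {x} → ¬ x ≈ 0ℤ → x ^ m * x ^ m ≈ 1ℤ
  unit-^m {x} x≉0 = begin
    x ^ m * x ^ m       ≈⟨ ^-homo-* x m m ⟨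
    x ^ (m ℕ.+ m)       ≡⟨ cong (λ n → x ^ (m ℕ.+ n)) (ℕₚ.+-identityʳ m) ⟨
    x ^ (2 ℕ.* m)       ≈⟨ fermat-unit p≡1+2m x≉0 ⟩
    1ℤ                  ∎

  square-^m : ∀ {x} → ¬ x ≈ 0ℤ → (x * x) ^ m ≈ 1ℤ
  square-^m {x} x≉0 = trans (^-distrib-* x x m) (unit-^m x≉0)

  -- (j+1)² - (i+1)² = (j-i)(i+j+2), and both factors lie strictly between 0 and p.
  squares-distinct : ∀ {i j} → i < j → j < m → ¬ + suc i * + suc i ≈ + suc j * + suc j
  squares-distinct {i} {j} i<j j<m eq with ℕₚ.m≤n⇒∃[o]m+o≡n i<j
  ... | d , ≡.refl = small≉0 (ℕₚ.≤-<-trans sum≤ 2m<p) sum≈0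
    where
    identity : ∀ i d → (+ 1 ℤ.+ (+ 1 ℤ.+ i ℤ.+ d)) ℤ.* (+ 1 ℤ.+ (+ 1 ℤ.+ i ℤ.+ d)) ℤ.- (+ 1 ℤ.+ i) ℤ.* (+ 1 ℤ.+ i) ≡
               (+ 1 ℤ.+ d) ℤ.* (+ 1 ℤ.+ i ℤ.+ (+ 1 ℤ.+ (+ 1 ℤ.+ i ℤ.+ d)))
    identity = solve-∀
    m≤2m : m ≤ 2 ℕ.* m
    m≤2m = ℕₚ.m≤m+n m (m ℕ.+ 0)
    sum≤ : suc (i ℕ.+ suc (suc i ℕ.+ d)) ≤ 2 ℕ.* m
    sum≤ = ℕₚ.+-mono-≤ (ℕₚ.<-trans i<j j<m) (subst (suc (suc i ℕ.+ d) ≤_) (≡.sym (ℕₚ.+-identityʳ m)) j<m)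
    d<p : suc d < p
    d<p = ℕₚ.≤-<-trans (ℕₚ.≤-trans (s≤s (ℕₚ.m≤n+m d i)) (ℕₚ.≤-trans (ℕₚ.<⇒≤ j<m) m≤2m)) 2m<p
    sum≈0 : + suc (i ℕ.+ suc (suc i ℕ.+ d)) ≈ 0ℤ
    sum≈0 = *-cancelˡ (+ suc d) (small≉0 d<p) (begin
      + suc d * + suc (i ℕ.+ suc (suc i ℕ.+ d))               ≡⟨ identity (+ i) (+ d) ⟨
      + suc (suc i ℕ.+ d) * + suc (suc i ℕ.+ d) ℤ.- + suc i * + suc i   ≈⟨ x≈y⇒x-y≈0 (sym eq) ⟩
      0ℤ                                                      ≡⟨ ℤₚ.*-zeroʳ (+ suc d) ⟨
      + suc d * 0ℤ                                            ∎)

  -- Otherwise X^m - 1 would have the m + 1 distinct roots a, 1², ..., m², hence vanish identically,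
  -- yet its value at 0 is -1.
  nonsquare⇒^m≉1 : ∀ {a} → (∀ {x} → suc x < p → ¬ + suc x * + suc x ≈ a) → ¬ a ^ m ≈ 1ℤ
  nonsquare⇒^m≉1 {a} nonsquare a^m≈1 = go m ≡.refl
    where
    go : ∀ k → k ≡ m → ⊥
    go zero    ≡.refl = contradiction (subst Prime p≡1+2m pp) ¬prime[1]
    go (suc k) k≡m = -1≉0 (trans (sym (≡⇒≈ (eval-0))) (too-many-roots poly roots (ℕₚ.≤-reflexive lengths) distinct vanish 0ℤ))
      where
      -- Since m = k + 1, this is X^m - 1.
      poly = ℤ.- 1ℤ ∷ X^ k
      f : ℕ → ℤ
      f i = + suc i * + suc i
      roots = a ∷ applyUpTo f m
      lengths : length poly ≡ length roots
      lengths = cong suc (≡.trans (length-X^ k) (≡.trans k≡m (≡.sym (length-applyUpTo f m))))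
      small : ∀ {i} → i < m → suc i < p
      small {i} i<m = ℕₚ.≤-<-trans (ℕₚ.≤-trans i<m (ℕₚ.m≤m+n m (m ℕ.+ 0))) 2m<p
      distinct : AllPairs (λ r s → ¬ r ≈ s) roots
      distinct = All.applyUpTo⁺₁ f m (λ i<m eq → nonsquare (small i<m) (sym eq)) ∷ AllPairs.applyUpTo⁺₁ f m squares-distinct
      is-root : ∀ x → x ^ m ≈ 1ℤ → eval poly x ≈ 0ℤ
      is-root x x^m≈1 = begin
        ℤ.- 1ℤ + x * eval (X^ k) x    ≡⟨ cong (λ z → ℤ.- 1ℤ ℤ.+ x ℤ.* z) (eval-X^ k x) ⟩
        ℤ.- 1ℤ + x ℤ.^ suc k          ≈⟨ +-congˡ {ℤ.- 1ℤ} (trans (≡⇒≈ (cong (x ℤ.^_) k≡m)) (trans (ι-^ x m) x^m≈1)) ⟩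
        ℤ.- 1ℤ + 1ℤ                   ≡⟨⟩
        0ℤ                            ∎
      vanish : All (λ r → eval poly r ≈ 0ℤ) roots
      vanish = is-root a a^m≈1 ∷ All.applyUpTo⁺₁ f m (λ {i} i<m → is-root (f i) (square-^m (small≉0 (small i<m))))
      eval-0 : eval poly 0ℤ ≡ ℤ.- 1ℤ
      eval-0 = ≡.refl
      -1≉0 : ¬ ℤ.- 1ℤ ≈ 0ℤ
      -1≉0 eq = ℕ∣.>⇒∤ (small {0} (subst (0 <_) k≡m z<s)) (≈0⇒∣ eq)

  distinct-residues : ∀ {x y} → x < y → y < p → ¬ + x ≈ + y
  distinct-residues {x} x<y y<p eq with ℕₚ.m≤n⇒∃[o]m+o≡n x<y
  ... | d , ≡.refl = small≉0 (ℕₚ.≤-<-trans (s≤s (ℕₚ.m≤n+m d x)) y<p)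
      (trans (≡⇒≈ (≡.sym (identity (+ x) (+ d)))) (x≈y⇒x-y≈0 (sym eq)))
    where
    identity : ∀ x d → + 1 ℤ.+ x ℤ.+ d ℤ.- x ≡ + 1 ℤ.+ d
    identity = solve-∀

  residues-injective : ∀ {x y} → x < p → y < p → + x ≈ + y → x ≡ y
  residues-injective {x} {y} x<p y<p eq with ℕₚ.<-cmp x y
  ... | tri< x<y _ _ = contradiction eq (distinct-residues x<y y<p)
  ... | tri≈ _ x≡y _ = x≡y
  ... | tri> _ _ y<x = contradiction (sym eq) (distinct-residues y<x x<p)

  module _ .{{_ : ℕ.NonZero p}} where

    ≈-remainder : ∀ a → a ≈ + (a ℤ.%ℕ p)
    ≈-remainder a = differ-by (a ℤ./ℕ p) (a≡a%ℕn+[a/ℕn]*n a p)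

    -- A square x² has m-th power x^(2m) = 1. In general (a^m - 1)(a^m + 1) = 0 by Fermat, and for a
    -- nonresidue the first factor is excluded by the count of roots.
    euler-view : ∀ {a l} → ¬ a ≈ 0ℤ → LegendreView a p l → l ≈ a ^ m
    euler-view {a} a≉0 (divisible a%p≡0) = contradiction (trans (≈-remainder a) (≡⇒≈ (cong +_ a%p≡0))) a≉0
    euler-view {a} a≉0 (residue x x²≡a) = trans (sym (square-^m x≉0)) (^-congˡ m x²≈a)
      where
      x²≈a : + x * + x ≈ a
      x²≈a = begin
        + x * + x                     ≡⟨ ℤₚ.pos-* x x ⟨
        + (x ℕ.* x)                   ≈⟨ ≈-remainder (+ (x ℕ.* x)) ⟩
        + ((x ℕ.* x) ℕ.% p)           ≡⟨ cong +_ x²≡a ⟩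
        + (a ℤ.%ℕ p)                  ≈⟨ ≈-remainder a ⟨
        a                             ∎
      x≉0 : ¬ + x ≈ 0ℤ
      x≉0 x≈0 = a≉0 (trans (sym x²≈a) (trans (*-cong {+ x} {0ℤ} {+ x} {0ℤ} x≈0 x≈0) refl))
    euler-view {a} a≉0 (nonresidue no-root) =
        [ (λ a^m-1≈0 → contradiction (x-y≈0⇒x≈y a^m-1≈0) (nonsquare⇒^m≉1 nonsquare))
        , (λ a^m+1≈0 → sym (x-y≈0⇒x≈y {a ^ m} {ℤ.- 1ℤ} a^m+1≈0)) ]′
        (≈0-split (a ^ m ℤ.- 1ℤ) (a ^ m ℤ.- ℤ.- 1ℤ) (trans (≡⇒≈ (difference (a ^ m))) (x≈y⇒x-y≈0 (unit-^m a≉0))))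
      where
      difference : ∀ x → (x ℤ.- 1ℤ) ℤ.* (x ℤ.- ℤ.- 1ℤ) ≡ x ℤ.* x ℤ.- 1ℤ
      difference = solve-∀
      nonsquare : ∀ {x} → suc x < p → ¬ + suc x * + suc x ≈ a
      nonsquare {x} x<p x²≈a = no-root x<p (residues-injective (m%n<n _ p) (n%ℕd<d a p) (begin
        + ((suc x ℕ.* suc x) ℕ.% p)   ≈⟨ ≈-remainder (+ (suc x ℕ.* suc x)) ⟨
        + (suc x ℕ.* suc x)           ≡⟨ ℤₚ.pos-* (suc x) (suc x) ⟩
        + suc x * + suc x             ≈⟨ x²≈a ⟩
        a                             ≈⟨ ≈-remainder a ⟩
        + (a ℤ.%ℕ p)                  ∎))

  euler : ∀ {a} → ¬ a ≈ 0ℤ → legendre a p ≈ a ^ m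
  euler {a} a≉0 = go p ≡.refl
    where
    go : ∀ q → q ≡ p → legendre a p ≈ a ^ m
    go zero    ≡.refl = contradiction pp ¬prime[0]
    go (suc q) ≡.refl = euler-view a≉0 (legendreView a q)

-- The two sums as residues modulo p.

module QuadraticExtension {p : ℕ} (pp : Prime p) {m : ℕ} (p≡1+2m : p ≡ suc (2 ℕ.* m)) (e : ℤ) where

  open PrimeField pp
  open AdjoinSquareRoot ℤ/p reduction e
  open GeneratingFunction R[√d] inclusion pp (p≈0 , refl) {m} p≡1+2m
  -- Equality of pairs contains equality of first coordinates, so `proj₁` is the injectivity of the
  -- inclusion.
  open Descent proj₁ {√d} {e} √d-square public

module Residues {p : ℕ} (pp : Prime p) (3<p : 3 < p) {m : ℕ} (p≡1+2m : p ≡ suc (2 ℕ.* m)) where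

  open PrimeField pp
  open EulerCriterion pp {m} p≡1+2m
  open Elimination ℤ/p reduction

  2≉0 : ¬ + 2 ≈ 0ℤ
  2≉0 = small≉0 (ℕₚ.<-trans (ℕₚ.n<1+n 2) 3<p)

  2′ : ℤ
  2′ = proj₁ (inverse 2≉0)

  22′ : + 2 * 2′ ≈ 1ℤ
  22′ = proj₂ (inverse 2≉0)

  8′ : ℤ
  8′ = 2′ * 2′ * 2′

  88′ : + 8 * 8′ ≈ 1ℤ
  88′ = trans (≡⇒≈ (cube 2′)) (*-cong {_} {1ℤ} (*-cong {_} {1ℤ} 22′ 22′) 22′)
    where
    cube : ∀ x → + 8 ℤ.* (x ℤ.* x ℤ.* x) ≡ + 2 ℤ.* x ℤ.* (+ 2 ℤ.* x) ℤ.* (+ 2 ℤ.* x)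
    cube = solve-∀

  -- Used with c = b for the binomial sum and c = -b for the Catalan sum. Then t = (a + c)²/(64ac)
  -- is the number whose k-th power occurs in the k-th term.
  module Pair {a c a′ c′ : ℤ} (aa′ : a * a′ ≈ 1ℤ) (cc′ : c * c′ ≈ 1ℤ) where

    e e′ t : ℤ
    e = c * a′
    e′ = a * c′
    t = (a + c) * (a + c) * (8′ * 8′ * (a′ * c′))

    ee′ : e * e′ ≈ 1ℤ
    ee′ = trans (≡⇒≈ (reorder a c a′ c′)) (*-cong {_} {1ℤ} aa′ cc′)
      where
      reorder : ∀ a c a′ c′ → c ℤ.* a′ ℤ.* (a ℤ.* c′) ≡ a ℤ.* a′ ℤ.* (c ℤ.* c′)
      reorder = solve-∀

    ea : e * a ≈ c
    ea = trans (≡⇒≈ (reorder a c a′)) (trans (*-congˡ {c} aa′) (*-identityʳ c))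
      where
      reorder : ∀ a c a′ → c ℤ.* a′ ℤ.* a ≡ c ℤ.* (a ℤ.* a′)
      reorder = solve-∀

    eaa : e * (a * a) ≈ a * c
    eaa = trans (≡⇒≈ (reorder e a)) (*-congˡ {a} ea)
      where
      reorder : ∀ e a → e ℤ.* (a ℤ.* a) ≡ a ℤ.* (e ℤ.* a)
      reorder = solve-∀

    t≈ : t ≈ (1ℤ + e) * (1ℤ + e) * e′ * (8′ * 8′)
    t≈ = begin
      (a + c) * (a + c) * w                            ≈⟨ *-congʳ {w} (*-cong {a + e * a} (+-congˡ {a} ea) (+-congˡ {a} ea)) ⟨
      (a + e * a) * (a + e * a) * w                    ≡⟨ reorder a e a′ c′ 8′ ⟩
      (1ℤ + e) * (1ℤ + e) * e′ * (8′ * 8′) * (a * a′)  ≈⟨ *-congˡ {(1ℤ + e) * (1ℤ + e) * e′ * (8′ * 8′)} aa′ ⟩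
      (1ℤ + e) * (1ℤ + e) * e′ * (8′ * 8′) * 1ℤ        ≈⟨ *-identityʳ _ ⟩
      (1ℤ + e) * (1ℤ + e) * e′ * (8′ * 8′)             ∎
      where
      w = 8′ * 8′ * (a′ * c′)
      reorder : ∀ a e a′ c′ x → (a ℤ.+ e ℤ.* a) ℤ.* (a ℤ.+ e ℤ.* a) ℤ.* (x ℤ.* x ℤ.* (a′ ℤ.* c′)) ≡
        (1ℤ ℤ.+ e) ℤ.* (1ℤ ℤ.+ e) ℤ.* (a ℤ.* c′) ℤ.* (x ℤ.* x) ℤ.* (a ℤ.* a′)
      reorder = solve-∀

    EA : e ^ m * a ^ m ≈ c ^ m
    EA = trans (sym (^-distrib-* e a m)) (^-congˡ m ea)

    -- Since e·a² = ac, the power e^r a^(2r) is (ac)^r, the number q of the elimination.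
    EᵣA-even : ∀ r → m ≡ 2 ℕ.* r → e ^ r * a ^ m ≈ (a * c) ^ r
    EᵣA-even r m≡2r = begin
      e ^ r * a ^ m           ≡⟨ cong (λ n → e ^ r * a ^ n) m≡2r ⟩
      e ^ r * a ^ (2 ℕ.* r)   ≈⟨ *-congˡ {e ^ r} (square-^ a r) ⟩
      e ^ r * (a * a) ^ r     ≈⟨ ^-distrib-* e (a * a) r ⟨
      (e * (a * a)) ^ r       ≈⟨ ^-congˡ r eaa ⟩
      (a * c) ^ r             ∎

    EᵣA-odd : ∀ r → m ≡ suc (2 ℕ.* r) → e ^ suc r * (a ^ m * a) ≈ (a * c) ^ suc r
    EᵣA-odd r m≡1+2r = begin
      e ^ suc r * (a ^ m * a)               ≡⟨ cong (λ n → e ^ suc r * (a ^ n * a)) m≡1+2r ⟩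
      e ^ suc r * (a ^ suc (2 ℕ.* r) * a)   ≈⟨ *-congˡ {e ^ suc r} (*-congʳ {a} (*-congˡ {a} (square-^ a r))) ⟩
      e ^ suc r * (a * (a * a) ^ r * a)     ≡⟨ cong (e ^ suc r *_) (reorder a ((a * a) ^ r)) ⟩
      e ^ suc r * (a * a) ^ suc r           ≈⟨ ^-distrib-* e (a * a) (suc r) ⟨
      (e * (a * a)) ^ suc r                 ≈⟨ ^-congˡ (suc r) eaa ⟩
      (a * c) ^ suc r                       ∎
      where
      reorder : ∀ a x → a ℤ.* x ℤ.* a ≡ a ℤ.* a ℤ.* x
      reorder = solve-∀

    qq-even : ∀ r → m ≡ 2 ℕ.* r → (a * c) ^ r * (a * c) ^ r ≈ a ^ m * c ^ m
    qq-even r m≡2r = begin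
      (a * c) ^ r * (a * c) ^ r   ≈⟨ ^-distrib-* (a * c) (a * c) r ⟨
      (a * c * (a * c)) ^ r       ≈⟨ square-^ (a * c) r ⟨
      (a * c) ^ (2 ℕ.* r)         ≡⟨ cong ((a * c) ^_) m≡2r ⟨
      (a * c) ^ m                 ≈⟨ ^-distrib-* a c m ⟩
      a ^ m * c ^ m               ∎

    qq-odd : ∀ r → m ≡ suc (2 ℕ.* r) → (a * c) ^ suc r * (a * c) ^ suc r ≈ a ^ m * c ^ m * (a * c)
    qq-odd r m≡1+2r = begin
      (a * c) ^ suc r * (a * c) ^ suc r     ≡⟨ reorder (a * c) ((a * c) ^ r) ⟩
      a * c * ((a * c) ^ r * (a * c) ^ r) * (a * c)
        ≈⟨ *-congʳ {a * c} (*-congˡ {a * c} (trans (sym (^-distrib-* (a * c) (a * c) r)) (sym (square-^ (a * c) r)))) ⟩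
      (a * c) ^ suc (2 ℕ.* r) * (a * c)     ≡⟨ cong (λ n → (a * c) ^ n * (a * c)) m≡1+2r ⟨
      (a * c) ^ m * (a * c)                 ≈⟨ *-congʳ {a * c} (^-distrib-* a c m) ⟩
      a ^ m * c ^ m * (a * c)               ∎
      where
      reorder : ∀ x y → x ℤ.* y ℤ.* (x ℤ.* y) ≡ x ℤ.* (y ℤ.* y) ℤ.* x
      reorder = solve-∀

    open QuadraticExtension pp {m} p≡1+2m e
    open Sums ee′ 88′ (unit-^m (unit≉0 ee′)) t≈ public
    open Homogenise {a} {c} {e} {a ^ m} {c ^ m} {e ^ m} ea EA public

  module _ {a b a′ b′ : ℤ} (aa′ : a * a′ ≈ 1ℤ) (bb′ : b * b′ ≈ 1ℤ) where

    private
      module C = Pair {a} {b} {a′} {b′} aa′ bb′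

      A = a ^ m
      B = b ^ m
      κ = (+ 2) ^ m

      AA : A * A ≈ 1ℤ
      AA = unit-^m (unit≉0 aa′)

      BB : B * B ≈ 1ℤ
      BB = unit-^m (unit≉0 bb′)

      κκ : κ * κ ≈ 1ℤ
      κκ = unit-^m (unit≉0 22′)

      L₂ : legendre (+ 2) p ≈ κ
      L₂ = euler 2≉0

      Lₐ : legendre a p ≈ A
      Lₐ = euler (unit≉0 aa′)

      L_b : legendre b p ≈ B
      L_b = euler (unit≉0 bb′)

      -‿cong₂ : ∀ {x y u v} → x ≈ y → u ≈ v → x ℤ.- u ≈ y ℤ.- v
      -‿cong₂ x≈y u≈v = +-cong x≈y (-‿cong u≈v)

    central-sum-even : ∀ r → m ≡ 2 ℕ.* r → ∀ {D′} → + 4 * (a ℤ.- b) * D′ ≈ 1ℤ →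
      central∑ C.t ≈ legendre (+ 2) p * (a * b) ^ r * D′ *
        ((+ 3 * a ℤ.- b) * legendre b p ℤ.- (+ 3 * b ℤ.- a) * legendre a p)
    central-sum-even r m≡2r {D′} DD′ = trans
      (eliminate-even {A} {B} {κ} {+ 4 * (a ℤ.- b)} {D′} {central∑ C.t} {+ 3 * a ℤ.- b} {+ 3 * b ℤ.- a} AA BB κκ
        {(a * b) ^ r} (C.qq-even r m≡2r) DD′
        (C.Even.central-even {e ^ r} {(a * b) ^ r} (C.EᵣA-even r m≡2r) {κ} {central∑ C.t} (C.central∑-even r m≡2r)))
      (sym (*-cong {legendre (+ 2) p * (a * b) ^ r * D′} (*-congʳ {D′} (*-congʳ {(a * b) ^ r} L₂))
        (-‿cong₂ (*-congˡ {+ 3 * a ℤ.- b} L_b) (*-congˡ {+ 3 * b ℤ.- a} Lₐ))))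
      where e = C.e

    central-sum-odd : ∀ r → m ≡ suc (2 ℕ.* r) → ∀ {D′} → + 4 * (b ℤ.- a) * D′ ≈ 1ℤ →
      central∑ C.t ≈ legendre (+ 2) p * (a * b) ^ suc r * D′ *
        ((+ 3 * a ℤ.- b) * a′ * legendre b p ℤ.- (+ 3 * b ℤ.- a) * b′ * legendre a p)
    central-sum-odd r m≡1+2r {D′} DD′ = trans
      (eliminate-odd {A} {B} {κ} {+ 4 * (a ℤ.- b)} {D′} {central∑ C.t} {+ 3 * a ℤ.- b} {+ 3 * b ℤ.- a} AA BB κκ
        {a} {b} {a′} {b′} {(a * b) ^ suc r} aa′ bb′ (C.qq-odd r m≡1+2r) (trans (≡⇒≈ (flip a b D′)) DD′)
        (C.Odd.central-odd {e ^ suc r} {(a * b) ^ suc r} (C.EᵣA-odd r m≡1+2r) {κ} {central∑ C.t} (C.central∑-odd r m≡1+2r)))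
      (sym (*-cong {legendre (+ 2) p * (a * b) ^ suc r * D′} (*-congʳ {D′} (*-congʳ {(a * b) ^ suc r} L₂))
        (-‿cong₂ (*-congˡ {(+ 3 * a ℤ.- b) * a′} L_b) (*-congˡ {(+ 3 * b ℤ.- a) * b′} Lₐ))))
      where
      e = C.e
      flip : ∀ a b D′ → ℤ.- (+ 4 ℤ.* (a ℤ.- b)) ℤ.* D′ ≡ + 4 ℤ.* (b ℤ.- a) ℤ.* D′
      flip = solve-∀

    private
      neg-neg : ∀ x y → ℤ.- x ℤ.* ℤ.- y ≡ x ℤ.* y
      neg-neg = solve-∀

      -- The Catalan sum belongs to the pair (a, -b).
      module N = Pair {a} {ℤ.- b} {a′} {ℤ.- b′} aa′ (trans (≡⇒≈ (neg-neg b b′)) bb′)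

      module I = QuadraticExtension pp {m} p≡1+2m (ℤ.- 1ℤ)
      module S = I.Supplementary {2′} 22′ ≡.refl

      neg-^ : ∀ x n → (ℤ.- x) ^ n ≈ (ℤ.- 1ℤ) ^ n * x ^ n
      neg-^ x n = trans (^-congˡ n (≡⇒≈ (≡.sym (ℤₚ.-1*i≡-i x)))) (^-distrib-* (ℤ.- 1ℤ) x n)

      -1^even : ∀ r → (ℤ.- 1ℤ) ^ (2 ℕ.* r) ≈ 1ℤ
      -1^even r = trans (square-^ (ℤ.- 1ℤ) r) (1^ r)

      B-even : ∀ r → m ≡ 2 ℕ.* r → (ℤ.- b) ^ m ≈ B
      B-even r m≡2r = trans (neg-^ b m) (trans (*-congʳ {B} (trans (≡⇒≈ (cong ((ℤ.- 1ℤ) ^_) m≡2r)) (-1^even r))) (*-identityˡ B))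

      B-odd : ∀ r → m ≡ suc (2 ℕ.* r) → (ℤ.- b) ^ m ≈ ℤ.- B
      B-odd r m≡1+2r = trans (neg-^ b m) (trans (*-congʳ {B}
        (trans (≡⇒≈ (cong ((ℤ.- 1ℤ) ^_) m≡1+2r)) (trans (*-congˡ {ℤ.- 1ℤ} (-1^even r)) refl))) (≡⇒≈ (ℤₚ.-1*i≡-i B)))

      -- The power of -b contributes (-1)^n, which for the exponents in use equals the symbol of 2.
      -- The two cancel, and no symbol of 2 is left in the Catalan sum.
      absorb-sign : ∀ n → κ * (ℤ.- 1ℤ) ^ n ≈ 1ℤ → κ * (a * ℤ.- b) ^ n ≈ 1ℤ * (a * b) ^ n
      absorb-sign n κ-1^n≈1 = begin
        κ * (a * ℤ.- b) ^ n               ≡⟨ cong (λ x → κ * x ^ n) (ℤₚ.neg-distribʳ-* a b) ⟨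
        κ * (ℤ.- (a * b)) ^ n             ≈⟨ *-congˡ {κ} (neg-^ (a * b) n) ⟩
        κ * ((ℤ.- 1ℤ) ^ n * (a * b) ^ n)  ≈⟨ *-assoc κ _ _ ⟨
        κ * (ℤ.- 1ℤ) ^ n * (a * b) ^ n    ≈⟨ *-congʳ {(a * b) ^ n} κ-1^n≈1 ⟩
        1ℤ * (a * b) ^ n                  ∎

      drop-1 : ∀ x y z → 1ℤ ℤ.* x ℤ.* y ℤ.* z ≡ x ℤ.* y ℤ.* z
      drop-1 = solve-∀

    catalan-sum-even : ∀ r → m ≡ 2 ℕ.* r → ∀ {D′} → + 2 * (a ℤ.- b) * D′ ≈ 1ℤ →
      catalan∑ N.t ≈ (a * b) ^ r * D′ * ((+ 3 * a + b) * legendre b p ℤ.- (+ 3 * b + a) * legendre a p)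
    catalan-sum-even r m≡2r {D′} DD′ = trans
      -- κ is 1 here because 2^m has been absorbed into the sign, and `(a * b) ^ r` takes the place
      -- of the power of a·(-b).
      (eliminate-even {A} {B} {1ℤ} {+ 2 * (a ℤ.- b)} {D′} {s} {+ 3 * a + b} {+ 3 * b + a} AA BB refl
        {(a * b) ^ r} (C.qq-even r m≡2r) DD′ (begin
          + 2 * (a ℤ.- b) * (1ℤ * (a * b) ^ r) * s
            ≈⟨ *-congʳ {s} (*-congˡ {+ 2 * (a ℤ.- b)} (absorb-sign r (S.2^m-even r m≡2r))) ⟨
          + 2 * (a + ℤ.- b) * (κ * (a * ℤ.- b) ^ r) * s
            ≈⟨ N.Even.catalan-even {N.e ^ r} {(a * ℤ.- b) ^ r} (N.EᵣA-even r m≡2r) {κ} {s} (N.catalan∑-even r m≡2r) ⟩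
          (+ 3 * a ℤ.- ℤ.- b) * A + (+ 3 * ℤ.- b ℤ.- a) * (ℤ.- b) ^ m
            ≈⟨ +-congˡ {(+ 3 * a ℤ.- ℤ.- b) * A} (*-congˡ {+ 3 * ℤ.- b ℤ.- a} (B-even r m≡2r)) ⟩
          (+ 3 * a ℤ.- ℤ.- b) * A + (+ 3 * ℤ.- b ℤ.- a) * B
            ≡⟨ signs a b A B ⟩
          (+ 3 * a + b) * A ℤ.- (+ 3 * b + a) * B ∎))
      (trans (≡⇒≈ (drop-1 ((a * b) ^ r) D′ _)) (sym (*-congˡ {(a * b) ^ r * D′}
        (-‿cong₂ (*-congˡ {+ 3 * a + b} L_b) (*-congˡ {+ 3 * b + a} Lₐ)))))
      where
      s = catalan∑ N.t
      signs : ∀ a b A B → (+ 3 ℤ.* a ℤ.- ℤ.- b) ℤ.* A ℤ.+ (+ 3 ℤ.* ℤ.- b ℤ.- a) ℤ.* B ≡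
                          (+ 3 ℤ.* a ℤ.+ b) ℤ.* A ℤ.- (+ 3 ℤ.* b ℤ.+ a) ℤ.* B
      signs = solve-∀

    catalan-sum-odd : ∀ r → m ≡ suc (2 ℕ.* r) → ∀ {D′} → + 2 * (b ℤ.- a) * D′ ≈ 1ℤ →
      catalan∑ N.t ≈ (a * b) ^ suc r * D′ *
        ((+ 3 * a + b) * a′ * legendre b p ℤ.- (+ 3 * b + a) * b′ * legendre a p)
    catalan-sum-odd r m≡1+2r {D′} DD′ = trans
      (eliminate-odd {A} {B} {1ℤ} {+ 2 * (a ℤ.- b)} {D′} {s} {+ 3 * a + b} {+ 3 * b + a} AA BB refl
        {a} {b} {a′} {b′} {(a * b) ^ suc r} aa′ bb′ (C.qq-odd r m≡1+2r) (trans (≡⇒≈ (flip a b D′)) DD′) (begin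
          + 2 * (a ℤ.- b) * (1ℤ * (a * b) ^ suc r) * s
            ≈⟨ *-congʳ {s} (*-congˡ {+ 2 * (a ℤ.- b)} (absorb-sign (suc r) (S.2^m-odd r m≡1+2r))) ⟨
          + 2 * (a + ℤ.- b) * (κ * (a * ℤ.- b) ^ suc r) * s
            ≈⟨ N.Odd.catalan-odd {N.e ^ suc r} {(a * ℤ.- b) ^ suc r} (N.EᵣA-odd r m≡1+2r) {κ} {s} (N.catalan∑-odd r m≡1+2r) ⟩
          (+ 3 * ℤ.- b ℤ.- a) * a * (ℤ.- b) ^ m + ℤ.- b * (+ 3 * a ℤ.- ℤ.- b) * A
            ≈⟨ +-congʳ {ℤ.- b * (+ 3 * a ℤ.- ℤ.- b) * A} (*-congˡ {(+ 3 * ℤ.- b ℤ.- a) * a} (B-odd r m≡1+2r)) ⟩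
          (+ 3 * ℤ.- b ℤ.- a) * a * ℤ.- B + ℤ.- b * (+ 3 * a ℤ.- ℤ.- b) * A
            ≡⟨ signs a b A B ⟩
          (+ 3 * b + a) * a * B ℤ.- b * (+ 3 * a + b) * A ∎))
      (trans (≡⇒≈ (drop-1 ((a * b) ^ suc r) D′ _)) (sym (*-congˡ {(a * b) ^ suc r * D′}
        (-‿cong₂ (*-congˡ {(+ 3 * a + b) * a′} L_b) (*-congˡ {(+ 3 * b + a) * b′} Lₐ)))))
      where
      s = catalan∑ N.t
      flip : ∀ a b D′ → ℤ.- (+ 2 ℤ.* (a ℤ.- b)) ℤ.* D′ ≡ + 2 ℤ.* (b ℤ.- a) ℤ.* D′
      flip = solve-∀
      signs : ∀ a b A B → (+ 3 ℤ.* ℤ.- b ℤ.- a) ℤ.* a ℤ.* ℤ.- B ℤ.+ ℤ.- b ℤ.* (+ 3 ℤ.* a ℤ.- ℤ.- b) ℤ.* A ≡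
                          (+ 3 ℤ.* b ℤ.+ a) ℤ.* a ℤ.* B ℤ.- b ℤ.* (+ 3 ℤ.* a ℤ.+ b) ℤ.* A
      signs = solve-∀

-- Rational numbers and their residues modulo p.

private
  toℚᵘ-⟦⟧ : ∀ i → toℚᵘ ⟦ i ⟧ ℚᵘ.≃ mkℚᵘ i 0
  toℚᵘ-⟦⟧ i = ℚₚ.toℚᵘ-fromℚᵘ (mkℚᵘ i 0)

-- Checked on unnormalised fractions, where equality is cross-multiplication and no common factor is
-- removed.
ℤ→ℚ : ℤ.+-*-rawRing -Raw-AlmostCommutative⟶ fromCommutativeRing ℚₚ.+-*-commutativeRing
ℤ→ℚ = record
  { ⟦_⟧ = ⟦_⟧
  ; +-homo = λ i j → ℚₚ.toℚᵘ-injective (begin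
      toℚᵘ ⟦ i ℤ.+ j ⟧               ≈⟨ toℚᵘ-⟦⟧ (i ℤ.+ j) ⟩
      mkℚᵘ (i ℤ.+ j) 0               ≈⟨ *≡* (+-eq i j) ⟩
      mkℚᵘ i 0 ℚᵘ.+ mkℚᵘ j 0         ≈⟨ ℚᵘₚ.+-cong (toℚᵘ-⟦⟧ i) (toℚᵘ-⟦⟧ j) ⟨
      toℚᵘ ⟦ i ⟧ ℚᵘ.+ toℚᵘ ⟦ j ⟧     ≈⟨ ℚₚ.toℚᵘ-homo-+ ⟦ i ⟧ ⟦ j ⟧ ⟨
      toℚᵘ (⟦ i ⟧ ℚ.+ ⟦ j ⟧)         ∎)
  ; *-homo = λ i j → ℚₚ.toℚᵘ-injective (begin
      toℚᵘ ⟦ i ℤ.* j ⟧               ≈⟨ toℚᵘ-⟦⟧ (i ℤ.* j) ⟩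
      mkℚᵘ i 0 ℚᵘ.* mkℚᵘ j 0         ≈⟨ ℚᵘₚ.*-cong (toℚᵘ-⟦⟧ i) (toℚᵘ-⟦⟧ j) ⟨
      toℚᵘ ⟦ i ⟧ ℚᵘ.* toℚᵘ ⟦ j ⟧     ≈⟨ ℚₚ.toℚᵘ-homo-* ⟦ i ⟧ ⟦ j ⟧ ⟨
      toℚᵘ (⟦ i ⟧ ℚ.* ⟦ j ⟧)         ∎)
  ; -‿homo = λ i → ℚₚ.toℚᵘ-injective (begin
      toℚᵘ ⟦ ℤ.- i ⟧                 ≈⟨ toℚᵘ-⟦⟧ (ℤ.- i) ⟩
      ℚᵘ.- mkℚᵘ i 0                  ≈⟨ ℚᵘₚ.-‿cong (toℚᵘ-⟦⟧ i) ⟨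
      ℚᵘ.- toℚᵘ ⟦ i ⟧                ≈⟨ ℚₚ.toℚᵘ-homo‿- ⟦ i ⟧ ⟨
      toℚᵘ (ℚ.- ⟦ i ⟧)               ∎)
  ; 0-homo = ≡.refl
  ; 1-homo = ≡.refl
  }
  where
  open import Relation.Binary.Reasoning.Setoid ℚᵘₚ.≃-setoid
  +-eq : ∀ i j → (i ℤ.+ j) ℤ.* + 1 ≡ (i ℤ.* + 1 ℤ.+ j ℤ.* + 1) ℤ.* + 1
  +-eq = solve-∀

module Fractions {r ℓ} (R : CommutativeRing r ℓ)
    (φ : ℤ.+-*-rawRing -Raw-AlmostCommutative⟶ fromCommutativeRing R) where

  open IntegerAlgebra R φ

  infix 4 _represents_/_
  -- Division-free form of x = u/d. The fraction need not be reduced, so sums and products are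
  -- formed without normalising.
  _represents_/_ : Carrier → ℤ → ℤ → Set ℓ
  x represents u / d = x * ι d ≈ ι u

  represents-ι : ∀ i → ι i represents i / 1ℤ
  represents-ι i = trans (*-congˡ 1-homo) (*-identityʳ (ι i))

  represents-+ : ∀ {x y u w d e} → x represents u / d → y represents w / e →
                 x + y represents u ℤ.* e ℤ.+ w ℤ.* d / d ℤ.* e
  represents-+ {x} {y} {u} {w} {d} {e} xd ye = begin
    (x + y) * ι (d ℤ.* e)               ≈⟨ *-congˡ (*-homo d e) ⟩
    (x + y) * (ι d * ι e)               ≈⟨ solve 4 (λ x y d e → (x :+ y) :* (d :* e) := x :* d :* e :+ y :* e :* d) refl x y (ι d) (ι e) ⟩
    x * ι d * ι e + y * ι e * ι d       ≈⟨ +-cong (*-congʳ xd) (*-congʳ ye) ⟩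
    ι u * ι e + ι w * ι d               ≈⟨ +-cong (*-homo u e) (*-homo w d) ⟨
    ι (u ℤ.* e) + ι (w ℤ.* d)           ≈⟨ +-homo (u ℤ.* e) (w ℤ.* d) ⟨
    ι (u ℤ.* e ℤ.+ w ℤ.* d)             ∎

  represents-neg : ∀ {x u d} → x represents u / d → - x represents ℤ.- u / d
  represents-neg {x} {u} {d} xd = begin
    - x * ι d       ≈⟨ solve 2 (λ x d → :- x :* d := :- (x :* d)) refl x (ι d) ⟩
    - (x * ι d)     ≈⟨ -‿cong xd ⟩
    - ι u           ≈⟨ -‿homo u ⟨
    ι (ℤ.- u)       ∎

  represents-* : ∀ {x y u w d e} → x represents u / d → y represents w / e → x * y represents u ℤ.* w / d ℤ.* e
  represents-* {x} {y} {u} {w} {d} {e} xd ye = begin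
    x * y * ι (d ℤ.* e)         ≈⟨ *-congˡ (*-homo d e) ⟩
    x * y * (ι d * ι e)         ≈⟨ solve 4 (λ x y d e → x :* y :* (d :* e) := x :* d :* (y :* e)) refl x y (ι d) (ι e) ⟩
    x * ι d * (y * ι e)         ≈⟨ *-cong xd ye ⟩
    ι u * ι w                   ≈⟨ *-homo u w ⟨
    ι (u ℤ.* w)                 ∎

  represents-quotient : ∀ {x y u d D} → y * ι D ≈ x → x represents u / d → y represents u / D ℤ.* d
  represents-quotient {x} {y} {u} {d} {D} yD xd = begin
    y * ι (D ℤ.* d)     ≈⟨ *-congˡ (*-homo D d) ⟩
    y * (ι D * ι d)     ≈⟨ *-assoc y (ι D) (ι d) ⟨
    y * ι D * ι d       ≈⟨ *-congʳ yD ⟩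
    x * ι d             ≈⟨ xd ⟩
    ι u                 ∎

⟦⟧≡0⇒≡0 : ∀ {i} → ⟦ i ⟧ ≡ 0ℚ → i ≡ 0ℤ
⟦⟧≡0⇒≡0 {i} eq = numerator≡0 (ℚᵘₚ.≃-trans (ℚᵘₚ.≃-sym (toℚᵘ-⟦⟧ i)) (ℚᵘₚ.≃-reflexive (cong toℚᵘ eq)))
  where
  numerator≡0 : mkℚᵘ i 0 ℚᵘ.≃ ℚᵘ.0ℚᵘ → i ≡ 0ℤ
  numerator≡0 (*≡* i*1≡0) = ≡.trans (≡.sym (ℤₚ.*-identityʳ i)) i*1≡0

÷₀-cancel : ∀ x {y} → ¬ y ≡ 0ℚ → x ÷₀ y ℚ.* y ≡ x
÷₀-cancel x {y} y≢0 with y ℚₚ.≟ 0ℚ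
... | yes y≡0 = contradiction y≡0 y≢0
... | no y≢0′ = ≡.trans (ℚₚ.*-assoc x _ y) (≡.trans (cong (x ℚ.*_) (ℚₚ.*-inverseˡ y {{ℚ.≢-nonZero y≢0′}})) (ℚₚ.*-identityʳ x))

-- Links the reduced numerator, in which the congruence of the theorem is stated, to an arbitrary
-- fraction representing x.
cross-multiply : ∀ x {u d} → x ℚ.* ⟦ d ⟧ ≡ ⟦ u ⟧ → ↥ x ℤ.* d ≡ u ℤ.* ↧ x
cross-multiply x@record{} {u} {d} eq = cross (begin
    toℚᵘ x ℚᵘ.* mkℚᵘ d 0        ≈⟨ ℚᵘₚ.*-congˡ {toℚᵘ x} (toℚᵘ-⟦⟧ d) ⟨
    toℚᵘ x ℚᵘ.* toℚᵘ ⟦ d ⟧      ≈⟨ ℚₚ.toℚᵘ-homo-* x ⟦ d ⟧ ⟨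
    toℚᵘ (x ℚ.* ⟦ d ⟧)          ≡⟨ cong toℚᵘ eq ⟩
    toℚᵘ ⟦ u ⟧                  ≈⟨ toℚᵘ-⟦⟧ u ⟩
    mkℚᵘ u 0                    ∎)
  where
  open import Relation.Binary.Reasoning.Setoid ℚᵘₚ.≃-setoid
  cross : toℚᵘ x ℚᵘ.* mkℚᵘ d 0 ℚᵘ.≃ mkℚᵘ u 0 → ↥ x ℤ.* d ≡ u ℤ.* ↧ x
  cross (*≡* e) = ≡.trans (≡.sym (ℤₚ.*-identityʳ _)) (≡.trans e (cong (λ n → u ℤ.* + n) (ℕₚ.*-identityʳ _)))

module Reduction {p : ℕ} (pp : Prime p) where

  open PrimeField pp
  open Fractions ℚₚ.+-*-commutativeRing ℤ→ℚ

  -- x is p-integral with residue n; the witnessing fraction need not be in lowest terms.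
  infix 4 _↦_
  record _↦_ (x : ℚ) (n : ℤ) : Set where
    constructor fraction
    field
      {num den} : ℤ
      represent : x represents num / den
      den≉0     : ¬ den ≈ 0ℤ
      num≈      : num ≈ n * den

  ↦-⟦⟧ : ∀ n → ⟦ n ⟧ ↦ n
  ↦-⟦⟧ n = fraction (represents-ι n) 1≉0 (sym (*-identityʳ n))

  ↦-≈ : ∀ {x n k} → n ≈ k → x ↦ n → x ↦ k
  ↦-≈ n≈k (fraction rep unit res) = fraction rep unit (trans res (*-congʳ n≈k))

  ↦-+ : ∀ {x y n k} → x ↦ n → y ↦ k → x ℚ.+ y ↦ n + k
  ↦-+ {x} {y} {n} {k} (fraction {u} {d} xd d≉0 u≈nd) (fraction {w} {e} ye e≉0 w≈ke) =
    fraction (represents-+ {x} {y} {u} {w} {d} {e} xd ye) (≉0-* d≉0 e≉0)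
      (trans (+-cong (*-congʳ {e} u≈nd) (*-congʳ {d} w≈ke)) (≡⇒≈ (reorder n k d e)))
    where
    reorder : ∀ n k d e → n ℤ.* d ℤ.* e ℤ.+ k ℤ.* e ℤ.* d ≡ (n ℤ.+ k) ℤ.* (d ℤ.* e)
    reorder = solve-∀

  ↦-neg : ∀ {x n} → x ↦ n → ℚ.- x ↦ ℤ.- n
  ↦-neg {x} {n} (fraction {u} {d} xd d≉0 u≈nd) =
    fraction (represents-neg {x} {u} {d} xd) d≉0 (trans (-‿cong u≈nd) (≡⇒≈ (ℤₚ.neg-distribˡ-* n d)))

  ↦-- : ∀ {x y n k} → x ↦ n → y ↦ k → x ℚ.- y ↦ n ℤ.- k
  ↦-- xn yk = ↦-+ xn (↦-neg yk)

  ↦-* : ∀ {x y n k} → x ↦ n → y ↦ k → x ℚ.* y ↦ n * k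
  ↦-* {x} {y} {n} {k} (fraction {u} {d} xd d≉0 u≈nd) (fraction {w} {e} ye e≉0 w≈ke) =
    fraction (represents-* {x} {y} {u} {w} {d} {e} xd ye) (≉0-* d≉0 e≉0)
      (trans (*-cong u≈nd w≈ke) (≡⇒≈ (reorder n k d e)))
    where
    reorder : ∀ n k d e → n ℤ.* d ℤ.* (k ℤ.* e) ≡ n ℤ.* k ℤ.* (d ℤ.* e)
    reorder = solve-∀

  -- D is invertible modulo p, hence nonzero as a rational, so the total division is a true one and
  -- its default value 0 does not occur.
  ↦-÷₀ : ∀ {x n D D′} → x ↦ n → D * D′ ≈ 1ℤ → x ÷₀ ⟦ D ⟧ ↦ n * D′
  ↦-÷₀ {x} {n} {D} {D′} (fraction {u} {d} xd d≉0 u≈nd) DD′ =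
    fraction (represents-quotient {x} {x ÷₀ ⟦ D ⟧} {u} {d} {D} (÷₀-cancel x (λ eq → D≉0 (≡⇒≈ (⟦⟧≡0⇒≡0 eq)))) xd)
      (≉0-* D≉0 d≉0)
      (trans u≈nd (trans (sym (trans (*-congˡ {n * d} DD′) (*-identityʳ (n * d)))) (≡⇒≈ (reorder n d D D′))))
    where
    D≉0 : ¬ D ≈ 0ℤ
    D≉0 = unit≉0 DD′
    reorder : ∀ n d D D′ → n ℤ.* d ℤ.* (D ℤ.* D′) ≡ n ℤ.* D′ ℤ.* (D ℤ.* d)
    reorder = solve-∀

  -- With x = u/d one has d·↥x = u·↧x, where p divides u but not d.
  ↦-numerator : ∀ {x n} → n ≈ 0ℤ → x ↦ n → p ∣ ∣ ↥ x ∣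
  ↦-numerator {x} {n} n≈0 (fraction {u} {d} rep d≉0 u≈nd) = ≈0⇒∣ (*-cancelˡ d d≉0 (begin
    d * ↥ x       ≡⟨ ℤₚ.*-comm d (↥ x) ⟩
    ↥ x * d       ≡⟨ cross-multiply x {u} {d} rep ⟩
    u * ↧ x       ≈⟨ *-congʳ {↧ x} (trans u≈nd (trans (*-congʳ {d} n≈0) (zeroˡ d))) ⟩
    0ℤ * ↧ x      ≈⟨ zeroˡ (↧ x) ⟩
    0ℤ            ≡⟨ ℤₚ.*-zeroʳ d ⟨
    d * 0ℤ        ∎))

  ↦-unique : ∀ {x y n} → x ↦ n → y ↦ n → x ≡ y [modℚ p ]
  ↦-unique {n = n} xn yn = ↦-numerator (-‿inverseʳ n) (↦-- xn yn)

  ∑ℤ-front : ∀ n f → ∑ℤ (suc n) f ≡ f 0 ℤ.+ ∑ℤ n (f ∘ suc)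
  ∑ℤ-front zero    f = ℤₚ.+-comm 0ℤ (f 0)
  ∑ℤ-front (suc n) f = ≡.trans (cong (ℤ._+ f (suc n)) (∑ℤ-front n f)) (ℤₚ.+-assoc (f 0) (∑ℤ n (f ∘ suc)) (f (suc n)))

  -- The index function g is general because the tail of `upTo` is no longer of that form. `foldr`
  -- peels off the first term while `∑ℤ` adds the last one, hence `∑ℤ-front`.
  ↦-foldr : ∀ n (f : ℕ → ℚ) g h → (∀ k → f (g k) ↦ h k) → foldr ℚ._+_ 0ℚ (map f (applyUpTo g n)) ↦ ∑ℤ n h
  ↦-foldr zero    f g h eq = ↦-⟦⟧ 0ℤ
  ↦-foldr (suc n) f g h eq = ↦-≈ (≡⇒≈ (≡.sym (∑ℤ-front n h)))
    (↦-+ (eq 0) (↦-foldr n f (g ∘ suc) (h ∘ suc) (eq ∘ suc)))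

  ↦-Σ< : ∀ n {f h} → (∀ k → f k ↦ h k) → Σ< n f ↦ ∑ℤ n h
  ↦-Σ< n {f} {h} = ↦-foldr n f id h

  -- The power of ℤ in the statement and the power of the ring ℤ/p are separate functions on the
  -- same carrier.
  ℤ^≡^ : ∀ x n → x ℤ.^ n ≡ x ^ n
  ℤ^≡^ x zero    = ≡.refl
  ℤ^≡^ x (suc n) = cong (x ℤ.*_) (ℤ^≡^ x n)

  -- Reads c y^(2k)/z^k as c (y²/z)^k, a term of a power series in one residue.
  ↦-term : ∀ c {y z z′} → z * z′ ≈ 1ℤ → ∀ k → ⟦ c ℤ.* y ℤ.^ (2 ℕ.* k) ⟧ ÷₀ ⟦ z ℤ.^ k ⟧ ↦ c * (y * y * z′) ^ k
  ↦-term c {y} {z} {z′} zz′ k = ↦-≈ term≈ (↦-÷₀ {D = z ℤ.^ k} (↦-⟦⟧ (c ℤ.* y ℤ.^ (2 ℕ.* k))) unit)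
    where
    unit : z ℤ.^ k * z′ ^ k ≈ 1ℤ
    unit = trans (≡⇒≈ (cong (_* z′ ^ k) (ℤ^≡^ z k))) (^-unit {z} {z′} k zz′)
    term≈ : c ℤ.* y ℤ.^ (2 ℕ.* k) * z′ ^ k ≈ c * (y * y * z′) ^ k
    term≈ = begin
      c * y ℤ.^ (2 ℕ.* k) * z′ ^ k     ≡⟨ cong (λ w → c * w * z′ ^ k) (ℤ^≡^ y (2 ℕ.* k)) ⟩
      c * y ^ (2 ℕ.* k) * z′ ^ k       ≈⟨ *-assoc c _ _ ⟩
      c * (y ^ (2 ℕ.* k) * z′ ^ k)     ≈⟨ *-congˡ {c} (*-congʳ {z′ ^ k} (square-^ y k)) ⟩
      c * ((y * y) ^ k * z′ ^ k)       ≈⟨ *-congˡ {c} (^-distrib-* (y * y) z′ k) ⟨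
      c * (y * y * z′) ^ k             ∎

-- The four congruences.

module Theorem {p : ℕ} (pp : Prime p) (3<p : 3 < p) {m : ℕ} (p≡1+2m : p ≡ suc (2 ℕ.* m)) (a b : ℤ)
    (p∤ab : ¬ p ∣ ∣ a ℤ.* b ∣) (p∤a-b : ¬ p ∣ ∣ a ℤ.- b ∣) where

  open PrimeField pp
  open Reduction pp
  open Residues pp 3<p {m} p≡1+2m

  a≉0 : ¬ a ≈ 0ℤ
  a≉0 a≈0 = p∤ab (≈0⇒∣ (trans (*-congʳ {b} a≈0) (zeroˡ b)))

  b≉0 : ¬ b ≈ 0ℤ
  b≉0 b≈0 = p∤ab (≈0⇒∣ (trans (*-congˡ {a} b≈0) (zeroʳ a)))

  a-b≉0 : ¬ a ℤ.- b ≈ 0ℤ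
  a-b≉0 eq = p∤a-b (≈0⇒∣ eq)

  b-a≉0 : ¬ b ℤ.- a ≈ 0ℤ
  b-a≉0 eq = a-b≉0 (x≈y⇒x-y≈0 {a} {b} (sym (x-y≈0⇒x≈y {b} {a} eq)))

  a′ b′ : ℤ
  a′ = proj₁ (inverse a≉0)
  b′ = proj₁ (inverse b≉0)

  aa′ : a * a′ ≈ 1ℤ
  aa′ = proj₂ (inverse a≉0)

  bb′ : b * b′ ≈ 1ℤ
  bb′ = proj₂ (inverse b≉0)

  4≉0 : ¬ + 4 ≈ 0ℤ
  4≉0 = ≉0-* {+ 2} {+ 2} 2≉0 2≉0

  module Denominator {c d : ℤ} (c≉0 : ¬ c ≈ 0ℤ) (d≉0 : ¬ d ≈ 0ℤ) where

    D′ : ℤ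
    D′ = proj₁ (inverse (≉0-* c≉0 d≉0))

    DD′ : c * d * D′ ≈ 1ℤ
    DD′ = proj₂ (inverse (≉0-* c≉0 d≉0))

  catalanΣ centralΣ : ℚ
  catalanΣ = Σ< p (λ k → ⟦ + catalan (2 ℕ.* k) ℤ.* (a ℤ.- b) ℤ.^ (2 ℕ.* k) ⟧ ÷₀ ⟦ (ℤ.- (+ 64) ℤ.* a ℤ.* b) ℤ.^ k ⟧)
  centralΣ = Σ< p (λ k → ⟦ + ((4 ℕ.* k) C (2 ℕ.* k)) ℤ.* (a ℤ.+ b) ℤ.^ (2 ℕ.* k) ⟧ ÷₀ ⟦ (+ 64 ℤ.* a ℤ.* b) ℤ.^ k ⟧)

  central∑-↦ : centralΣ ↦ central∑ ((a + b) * (a + b) * (8′ * 8′ * (a′ * b′)))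
  central∑-↦ = ↦-Σ< p λ k → subst
      (λ n → ⟦ + (n C (2 ℕ.* k)) ℤ.* (a ℤ.+ b) ℤ.^ (2 ℕ.* k) ⟧ ÷₀ ⟦ (+ 64 ℤ.* a ℤ.* b) ℤ.^ k ⟧ ↦
             + central (2 ℕ.* k) * ((a + b) * (a + b) * (8′ * 8′ * (a′ * b′))) ^ k)
      -- 4k = 2(2k), so the binomial coefficient is `central (2 * k)`.
      (≡.sym (ℕₚ.*-assoc 2 2 k)) (↦-term (+ central (2 ℕ.* k)) {a + b} {+ 64 * a * b} {8′ * 8′ * (a′ * b′)} zz′ k)
    where
    reorder : ∀ a b a′ b′ x → + 64 ℤ.* a ℤ.* b ℤ.* (x ℤ.* x ℤ.* (a′ ℤ.* b′)) ≡ + 8 ℤ.* x ℤ.* (+ 8 ℤ.* x) ℤ.* (a ℤ.* a′ ℤ.* (b ℤ.* b′))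
    reorder = solve-∀
    zz′ : + 64 * a * b * (8′ * 8′ * (a′ * b′)) ≈ 1ℤ
    zz′ = trans (≡⇒≈ (reorder a b a′ b′ 8′)) (*-cong {_} {1ℤ} (*-cong {_} {1ℤ} 88′ 88′) (*-cong {_} {1ℤ} aa′ bb′))

  catalan∑-↦ : catalanΣ ↦ catalan∑ ((a + ℤ.- b) * (a + ℤ.- b) * (8′ * 8′ * (a′ * ℤ.- b′)))
  catalan∑-↦ = ↦-Σ< p λ k → ↦-term (+ catalan (2 ℕ.* k)) {a ℤ.- b} {ℤ.- (+ 64) * a * b} {8′ * 8′ * (a′ * ℤ.- b′)} zz′ k
    where
    reorder : ∀ a b a′ b′ x → ℤ.- (+ 64) ℤ.* a ℤ.* b ℤ.* (x ℤ.* x ℤ.* (a′ ℤ.* ℤ.- b′)) ≡ + 8 ℤ.* x ℤ.* (+ 8 ℤ.* x) ℤ.* (a ℤ.* a′ ℤ.* (b ℤ.* b′))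
    reorder = solve-∀
    zz′ : ℤ.- (+ 64) * a * b * (8′ * 8′ * (a′ * ℤ.- b′)) ≈ 1ℤ
    zz′ = trans (≡⇒≈ (reorder a b a′ b′ 8′)) (*-cong {_} {1ℤ} (*-cong {_} {1ℤ} 88′ 88′) (*-cong {_} {1ℤ} aa′ bb′))

  ⟦^⟧-↦ : ∀ c x n → ⟦ c ℤ.* x ℤ.^ n ⟧ ↦ c * x ^ n
  ⟦^⟧-↦ c x n = subst (λ y → ⟦ c ℤ.* x ℤ.^ n ⟧ ↦ c * y) (ℤ^≡^ x n) (↦-⟦⟧ (c ℤ.* x ℤ.^ n))

  ⟦x^⟧-↦ : ∀ x n → ⟦ x ℤ.^ n ⟧ ↦ x ^ n
  ⟦x^⟧-↦ x n = subst (⟦ x ℤ.^ n ⟧ ↦_) (ℤ^≡^ x n) (↦-⟦⟧ (x ℤ.^ n))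

  module _ (r : ℕ) (m≡2r : m ≡ 2 ℕ.* r) where

    catalan-even : catalanΣ
      ≡ ⟦ (a ℤ.* b) ℤ.^ r ⟧ ÷₀ ⟦ + 2 ℤ.* (a ℤ.- b) ⟧
        ℚ.* ⟦ (+ 3 ℤ.* a ℤ.+ b) ℤ.* legendre b p ℤ.- (+ 3 ℤ.* b ℤ.+ a) ℤ.* legendre a p ⟧ [modℚ p ]
    catalan-even = ↦-unique (↦-≈ (catalan-sum-even {a} {b} {a′} {b′} aa′ bb′ r m≡2r {D′} DD′) catalan∑-↦)
      (↦-* (↦-÷₀ {D = + 2 ℤ.* (a ℤ.- b)} {D′} (⟦x^⟧-↦ (a ℤ.* b) r) DD′) (↦-⟦⟧ ((+ 3 ℤ.* a ℤ.+ b) ℤ.* legendre b p ℤ.- (+ 3 ℤ.* b ℤ.+ a) ℤ.* legendre a p)))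
      where open Denominator {+ 2} {a ℤ.- b} 2≉0 a-b≉0

    central-even : centralΣ
      ≡ ⟦ legendre (+ 2) p ℤ.* (a ℤ.* b) ℤ.^ r ⟧ ÷₀ ⟦ + 4 ℤ.* (a ℤ.- b) ⟧
        ℚ.* ⟦ (+ 3 ℤ.* a ℤ.- b) ℤ.* legendre b p ℤ.- (+ 3 ℤ.* b ℤ.- a) ℤ.* legendre a p ⟧ [modℚ p ]
    central-even = ↦-unique (↦-≈ (central-sum-even {a} {b} {a′} {b′} aa′ bb′ r m≡2r {D′} DD′) central∑-↦)
      (↦-* (↦-÷₀ {D = + 4 ℤ.* (a ℤ.- b)} {D′} (⟦^⟧-↦ (legendre (+ 2) p) (a ℤ.* b) r) DD′) (↦-⟦⟧ ((+ 3 ℤ.* a ℤ.- b) ℤ.* legendre b p ℤ.- (+ 3 ℤ.* b ℤ.- a) ℤ.* legendre a p)))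
      where open Denominator {+ 4} {a ℤ.- b} 4≉0 a-b≉0

  module _ (r : ℕ) (m≡1+2r : m ≡ suc (2 ℕ.* r)) where

    private
      ↦-÷a : ∀ n k → ⟦ n ⟧ ÷₀ ⟦ a ⟧ ℚ.* ⟦ k ⟧ ↦ n * a′ * k
      ↦-÷a n k = ↦-* (↦-÷₀ {D = a} {a′} (↦-⟦⟧ n) aa′) (↦-⟦⟧ k)

      ↦-÷b : ∀ n k → ⟦ n ⟧ ÷₀ ⟦ b ⟧ ℚ.* ⟦ k ⟧ ↦ n * b′ * k
      ↦-÷b n k = ↦-* (↦-÷₀ {D = b} {b′} (↦-⟦⟧ n) bb′) (↦-⟦⟧ k)

    -- The exponent is a variable with an equation, so that (p+1)/4 can be supplied as it stands in
    -- the theorem.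
    catalan-odd : ∀ {n} → n ≡ suc r → catalanΣ
      ≡ ⟦ (a ℤ.* b) ℤ.^ n ⟧ ÷₀ ⟦ + 2 ℤ.* (b ℤ.- a) ⟧
        ℚ.* (⟦ + 3 ℤ.* a ℤ.+ b ⟧ ÷₀ ⟦ a ⟧ ℚ.* ⟦ legendre b p ⟧ ℚ.- ⟦ + 3 ℤ.* b ℤ.+ a ⟧ ÷₀ ⟦ b ⟧ ℚ.* ⟦ legendre a p ⟧) [modℚ p ]
    catalan-odd ≡.refl = ↦-unique (↦-≈ (catalan-sum-odd {a} {b} {a′} {b′} aa′ bb′ r m≡1+2r {D′} DD′) catalan∑-↦)
      (↦-* (↦-÷₀ {D = + 2 ℤ.* (b ℤ.- a)} {D′} (⟦x^⟧-↦ (a ℤ.* b) (suc r)) DD′)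
        (↦-- (↦-÷a (+ 3 ℤ.* a ℤ.+ b) (legendre b p)) (↦-÷b (+ 3 ℤ.* b ℤ.+ a) (legendre a p))))
      where open Denominator {+ 2} {b ℤ.- a} 2≉0 b-a≉0

    central-odd : ∀ {n} → n ≡ suc r → centralΣ
      ≡ ⟦ legendre (+ 2) p ℤ.* (a ℤ.* b) ℤ.^ n ⟧ ÷₀ ⟦ + 4 ℤ.* (b ℤ.- a) ⟧
        ℚ.* (⟦ + 3 ℤ.* a ℤ.- b ⟧ ÷₀ ⟦ a ⟧ ℚ.* ⟦ legendre b p ⟧ ℚ.- ⟦ + 3 ℤ.* b ℤ.- a ⟧ ÷₀ ⟦ b ⟧ ℚ.* ⟦ legendre a p ⟧) [modℚ p ]
    central-odd ≡.refl = ↦-unique (↦-≈ (central-sum-odd {a} {b} {a′} {b′} aa′ bb′ r m≡1+2r {D′} DD′) central∑-↦)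
      (↦-* (↦-÷₀ {D = + 4 ℤ.* (b ℤ.- a)} {D′} (⟦^⟧-↦ (legendre (+ 2) p) (a ℤ.* b) (suc r)) DD′)
        (↦-- (↦-÷a (+ 3 ℤ.* a ℤ.- b) (legendre b p)) (↦-÷b (+ 3 ℤ.* b ℤ.- a) (legendre a p))))
      where open Denominator {+ 4} {b ℤ.- a} 4≉0 b-a≉0

-- The residue of p modulo 4 and the exponents.

p≡1+4r : ∀ p → p ℕ.% 4 ≡ 1 → p ≡ suc (2 ℕ.* (2 ℕ.* ((p ℕ.∸ 1) ℕ./ 4)))
p≡1+4r p p%4≡1 = ≡.trans p≡ (cong (λ q → suc (2 ℕ.* (2 ℕ.* q)))
    (≡.sym (≡.trans (cong (λ n → (n ℕ.∸ 1) ℕ./ 4) p≡′) (m*n/n≡m (p ℕ./ 4) 4))))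
  where
  p≡′ : p ≡ suc (p ℕ./ 4 ℕ.* 4)
  p≡′ = ≡.trans (m≡m%n+[m/n]*n p 4) (cong (ℕ._+ p ℕ./ 4 ℕ.* 4) p%4≡1)
  regroup : ∀ r → suc (r ℕ.* 4) ≡ suc (2 ℕ.* (2 ℕ.* r))
  regroup = ℕ-Solver.solve-∀
  p≡ : p ≡ suc (2 ℕ.* (2 ℕ.* (p ℕ./ 4)))
  p≡ = ≡.trans p≡′ (regroup (p ℕ./ 4))

p≡3+4r : ∀ p → p ℕ.% 4 ≡ 3 → p ≡ suc (2 ℕ.* suc (2 ℕ.* (p ℕ./ 4)))
p≡3+4r p p%4≡3 = ≡.trans (≡.trans (m≡m%n+[m/n]*n p 4) (cong (ℕ._+ p ℕ./ 4 ℕ.* 4) p%4≡3)) (regroup (p ℕ./ 4))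
  where
  regroup : ∀ r → 3 ℕ.+ r ℕ.* 4 ≡ suc (2 ℕ.* suc (2 ℕ.* r))
  regroup = ℕ-Solver.solve-∀

[p+1]/4≡1+r : ∀ p → p ℕ.% 4 ≡ 3 → (p ℕ.+ 1) ℕ./ 4 ≡ suc (p ℕ./ 4)
[p+1]/4≡1+r p p%4≡3 = ≡.trans (cong (λ n → (n ℕ.+ 1) ℕ./ 4) (p≡3+4r p p%4≡3))
    (≡.trans (cong (ℕ._/ 4) (regroup (p ℕ./ 4))) (m*n/n≡m (suc (p ℕ./ 4)) 4))
  where
  regroup : ∀ r → suc (2 ℕ.* suc (2 ℕ.* r)) ℕ.+ 1 ≡ suc r ℕ.* 4
  regroup = ℕ-Solver.solve-∀

open import Data.Nat using (_%_; _∸_)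
open import Data.Integer using (_*_; _+_; _-_; -_; _^_)

theorem10 : (p : ℕ) → Prime p → 3 ℕ.< p → (a b : ℤ) →
  ¬ (p ∣ ∣ a * b ∣) → ¬ (p ∣ ∣ a - b ∣) →
  ((p % 4 ≡ 1 →
    Σ< p (λ k → ⟦ + catalan (2 ℕ.* k) * (a - b) ^ (2 ℕ.* k) ⟧ ÷₀ ⟦ (- (+ 64) * a * b) ^ k ⟧)
      ≡ ⟦ (a * b) ^ ((p ∸ 1) ℕ./ 4) ⟧ ÷₀ ⟦ + 2 * (a - b) ⟧
        ℚ.* ⟦ (+ 3 * a + b) * legendre b p - (+ 3 * b + a) * legendre a p ⟧
      [modℚ p ])
  × (p % 4 ≡ 3 →
    Σ< p (λ k → ⟦ + catalan (2 ℕ.* k) * (a - b) ^ (2 ℕ.* k) ⟧ ÷₀ ⟦ (- (+ 64) * a * b) ^ k ⟧)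
      ≡ ⟦ (a * b) ^ ((p ℕ.+ 1) ℕ./ 4) ⟧ ÷₀ ⟦ + 2 * (b - a) ⟧
        ℚ.* (⟦ + 3 * a + b ⟧ ÷₀ ⟦ a ⟧ ℚ.* ⟦ legendre b p ⟧
             ℚ.- ⟦ + 3 * b + a ⟧ ÷₀ ⟦ b ⟧ ℚ.* ⟦ legendre a p ⟧)
      [modℚ p ])
  × (p % 4 ≡ 1 →
    Σ< p (λ k → ⟦ + ((4 ℕ.* k) C (2 ℕ.* k)) * (a + b) ^ (2 ℕ.* k) ⟧ ÷₀ ⟦ (+ 64 * a * b) ^ k ⟧)
      ≡ ⟦ legendre (+ 2) p * (a * b) ^ ((p ∸ 1) ℕ./ 4) ⟧ ÷₀ ⟦ + 4 * (a - b) ⟧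
        ℚ.* ⟦ (+ 3 * a - b) * legendre b p - (+ 3 * b - a) * legendre a p ⟧
      [modℚ p ])
  × (p % 4 ≡ 3 →
    Σ< p (λ k → ⟦ + ((4 ℕ.* k) C (2 ℕ.* k)) * (a + b) ^ (2 ℕ.* k) ⟧ ÷₀ ⟦ (+ 64 * a * b) ^ k ⟧)
      ≡ ⟦ legendre (+ 2) p * (a * b) ^ ((p ℕ.+ 1) ℕ./ 4) ⟧ ÷₀ ⟦ + 4 * (b - a) ⟧
        ℚ.* (⟦ + 3 * a - b ⟧ ÷₀ ⟦ a ⟧ ℚ.* ⟦ legendre b p ⟧
             ℚ.- ⟦ + 3 * b - a ⟧ ÷₀ ⟦ b ⟧ ℚ.* ⟦ legendre a p ⟧)
      [modℚ p ]))
theorem10 p pp 3<p a b p∤ab p∤a-b =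
    (λ p%4≡1 → Even.catalan-even p%4≡1 ((p ∸ 1) ℕ./ 4) ≡.refl)
  , (λ p%4≡3 → Odd.catalan-odd p%4≡3 (p ℕ./ 4) ≡.refl ([p+1]/4≡1+r p p%4≡3))
  , (λ p%4≡1 → Even.central-even p%4≡1 ((p ∸ 1) ℕ./ 4) ≡.refl)
  , (λ p%4≡3 → Odd.central-odd p%4≡3 (p ℕ./ 4) ≡.refl ([p+1]/4≡1+r p p%4≡3))
  where
  module Even (p%4≡1 : p % 4 ≡ 1) = Theorem pp 3<p {2 ℕ.* ((p ∸ 1) ℕ./ 4)} (p≡1+4r p p%4≡1) a b p∤ab p∤a-b
  -- With r = p/4 rounded down, p = 4r + 3, so m = 2r + 1 and (p+1)/4 = r + 1.
  module Odd (p%4≡3 : p % 4 ≡ 3) = Theorem pp 3<p {suc (2 ℕ.* (p ℕ./ 4))} (p≡3+4r p p%4≡3) a b p∤ab p∤a-b
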